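{- Let $(u_n)_{n\ge 0}$ be the sequence defined by the recurrence $$u_0=1,\qquad u_{n+1}=1-\left(1-\frac{u_n}{q^{d-1}}\right)^{q^{d-1}}.$$ Then, for every positive integer $n$, $$\mathbb E[X_n]=1-(1-u_n)^{1+q^{ -1}+\cdots+q^{ -(d-1)}}.$$
   Context: $K$ is a field complete with respect to a discrete valuation $\mathrm{val}$ normalized by $\mathrm{val}(\pi)=1$ for a uniformizer $\pi$; $R$ is its ring of integers, $\mathfrak m=\pi R$ its maximal ideal, and the residue field $k=R/\mathfrak m$ is finite with $q$ elements. The norm is $|x|=q^{ -\mathrm{val}(x)}$, and $d\ge 2$ is an integer. $K^d$ is equipped with $\|(x_1,\dots,x_d)\|_\infty=\max_i|x_i|$ and with the Haar measure $\mu$ normalized by $\mu(R^d)=1$. $\mathbb S^{d-1}(K)=\{x\in K^d:\|x\|_\infty=1\}$. $\mathbb P^{d-1}(K)$ is the set of lines through $0$ in $K^d$, identified with $\mathbb S^{d-1}(K)/R^\times$, with the distance $\mathrm{dist}(a,b)=\inf\|\hat a-\hat b\|_\infty$, the infimum being over all representatives $\hat a,\hat b\in\mathbb S^{d-1}(K)$ of $a$ and $b$. For $a\in\mathbb P^{d-1}(K)$, $\mathrm{can}(a)=(a_1,\dots,a_d)\in\mathbb S^{d-1}(K)$ is the unique representative of $a$ for which there is an index $j$ with $a_j=1$ and $|a_i|<1$ for all $i<j$. $\Omega$ is the set of $1$-Lipschitz functions $\mathbb P^{d-1}(K)\to R^d$. It is a group under pointwise addition, compact for the topology of uniform convergence,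 and is equipped with its Haar probability measure, with respect to which the expectation $\mathbb E$ is taken. For $f\in\Omega$ set $$N(f)=\bigcup_{a\in\mathbb P^{d-1}(K)}\{t\cdot\mathrm{can}(a)+f(a): t\in R\}\subset R^d,$$ and for a positive integer $n$ let $X_n(f)=\mu(N_n(f))$, where $N_n(f)=\{x\in R^d:\inf_{y\in N(f)}\|x-y\|_\infty\le q^{ -n}\}$. -}

module Defs where

open import Level using (0ℓ; Setω)
open import Algebra.Bundles using (AbelianGroup; CommutativeRing; Group; Semiring)
open import Algebra.Core using (Op₂)
import Algebra.Construct.NaturalChoice.Max as Max
import Algebra.Construct.NaturalChoice.Min as Min
import Algebra.Construct.Pointwise as Pointwise
import Algebra.Definitions.RawSemiring as RawSemiringDefs
import Algebra.Properties.AbelianGroup as AbelianGroupProperties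
import Algebra.Properties.CommutativeSemigroup as CommutativeSemigroupProperties
import Algebra.Properties.Group as GroupProperties
import Algebra.Properties.Monoid.Sum as MonoidSum
import Algebra.Properties.Ring as RingProperties
open import Axiom.ExcludedMiddle using (ExcludedMiddle)
open import Data.Empty using (⊥-elim)
open import Data.Fin as Fin using (Fin; toℕ)
open import Data.Fin.Properties using (nonZeroIndex)
open import Data.Integer as ℤ using (ℤ; +_; -[1+_])
import Data.Integer.Properties as ℤ
open import Data.Nat as ℕ using (ℕ; zero; suc; NonZero)
import Data.Nat.Properties as ℕ
open import Data.Product using (∃; ∃-syntax; Σ; _×_; _,_; proj₁; proj₂)
open import Data.Rational as ℚ using (ℚ; ↥_; ↧ₙ_)
import Data.Rational.Properties as ℚ
open import Data.Sum using (inj₁; inj₂)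
open import Data.Vec.Functional using (Vector; foldr)
open import Function using (Bijection; _∘_)
open import Relation.Binary using (Rel; Setoid; IsEquivalence; IsTotalOrder; TotalOrder)
import Relation.Binary.Construct.Add.Supremum.Equality as SupEq
import Relation.Binary.Construct.Add.Supremum.NonStrict as SupOrder
import Relation.Binary.Construct.NonStrictToStrict as ToStrict
open import Relation.Binary.PropositionalEquality as ≡ using (_≡_; _≢_)
open import Relation.Nullary using (¬_; yes; no)
open import Relation.Nullary.Construct.Add.Supremum using (_⁺; ⊤⁺; [_])
open import Relation.Unary using (Pred; _∈_; _≐_; _⊥_; ∁; ∅; U; ⋃; Satisfiable)

-- The mathematics below is classical.  Since `P` ranges over all types,
-- excluded middle in this form also yields definite descriptions.
Classical : Setω
Classical = ∀ {ℓ} → ExcludedMiddle ℓ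

IsUpperBound : ∀ {a r ℓ} {A : Set a} → Rel A r → Pred A ℓ → A → Set _
IsUpperBound _≤_ S b = ∀ {x} → x ∈ S → x ≤ b

IsLUB : ∀ {a r ℓ} {A : Set a} → Rel A r → Pred A ℓ → A → Set _
IsLUB _≤_ S s = IsUpperBound _≤_ S s × (∀ b → IsUpperBound _≤_ S b → s ≤ b)

IsGLB : ∀ {a r ℓ} {A : Set a} → Rel A r → Pred A ℓ → A → Set _
IsGLB _≤_ = IsLUB (λ x y → y ≤ x)

module AddTop {a} {A : Set a} (_+_ : Op₂ A) where

  infixl 6 _+⁺_

  _+⁺_ : Op₂ (A ⁺)
  [ x ] +⁺ [ y ] = [ x + y ]
  [ x ] +⁺ ⊤⁺    = ⊤⁺
  ⊤⁺    +⁺ _     = ⊤⁺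

-- The inverse is a total function whose value at 0 is unconstrained.
record Field : Set₁ where
  infix 8 _⁻¹
  field
    commutativeRing : CommutativeRing 0ℓ 0ℓ
  open CommutativeRing commutativeRing public
  field
    0≉1      : ¬ 0# ≈ 1#
    _⁻¹      : Carrier → Carrier
    inverseʳ : ∀ x → ¬ x ≈ 0# → x * x ⁻¹ ≈ 1#

  open RawSemiringDefs (Semiring.rawSemiring semiring) public using (_^_) renaming (_×_ to _×ₙ_)

  fromℕ : ℕ → Carrier
  fromℕ n = n ×ₙ 1#

  infixr 8 _^ℤ_
  _^ℤ_ : Carrier → ℤ → Carrier
  x ^ℤ (+ n)    = x ^ n
  x ^ℤ -[1+ n ] = (x ⁻¹) ^ suc n

-- Complete ordered fields are unique up to isomorphism, so a statement about
-- all of them is a statement about the real numbers.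
record RealNumbers : Set₁ where
  infix 4 _≤_
  field
    realField : Field
  open Field realField public hiding (_≉_)
  field
    _≤_          : Rel Carrier 0ℓ
    isTotalOrder : IsTotalOrder _≈_ _≤_
    +-monoˡ-≤    : ∀ {x y} z → x ≤ y → x + z ≤ y + z
    *-nonNeg     : ∀ {x y} → 0# ≤ x → 0# ≤ y → 0# ≤ x * y
    lub          : (S : Pred Carrier 0ℓ) → Satisfiable S →
                   ∃ (IsUpperBound _≤_ S) → ∃ (IsLUB _≤_ S)

  totalOrder : TotalOrder 0ℓ 0ℓ 0ℓ
  totalOrder = record { isTotalOrder = isTotalOrder }

  open Max totalOrder public using (_⊔_)
  open ToStrict _≈_ _≤_ public using (_<_)

ℤ∞-totalOrder : TotalOrder 0ℓ 0ℓ 0ℓ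
ℤ∞-totalOrder = record
  { isTotalOrder = SupOrder.≤⁺-isTotalOrder-≡ ℤ._≤_ ℤ.≤-isTotalOrder }

module ℤ∞ where
  open TotalOrder ℤ∞-totalOrder public using (_≤_; total) renaming (trans to ≤-trans)
  open Min ℤ∞-totalOrder public using (_⊓_)
  open AddTop ℤ._+_ public renaming (_+⁺_ to _+_)

record DiscretelyValuedField : Set₁ where
  field
    valuedField : Field
  open Field valuedField public
  field
    val      : Carrier → ℤ ⁺
    val-cong : ∀ {x y} → x ≈ y → val x ≡ val y
    val-0    : val 0# ≡ ⊤⁺
    val-≢⊤   : ∀ {x} → ¬ x ≈ 0# → val x ≢ ⊤⁺
    val-*    : ∀ x y → val (x * y) ≡ val x ℤ∞.+ val y
    val-+    : ∀ x y → val x ℤ∞.⊓ val y ℤ∞.≤ val (x + y)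
    π        : Carrier
    val-π    : val π ≡ [ + 1 ]

  R : Pred Carrier 0ℓ
  R x = [ + 0 ] ℤ∞.≤ val x

  𝔪 : Pred Carrier 0ℓ
  𝔪 x = ∃[ r ] r ∈ R × x ≈ π * r

  R× : Pred Carrier 0ℓ
  R× x = x ∈ R × ∃[ y ] y ∈ R × x * y ≈ 1#

  private
    module ℤG = GroupProperties (AbelianGroup.group ℤ.+-0-abelianGroup)
    open RingProperties ring using (-1*x≈-x; -‿distribˡ-*; -‿distribʳ-*)
    open AbelianGroupProperties +-abelianGroup using (⁻¹-involutive; ⁻¹-∙-comm)

    idempotent⇒0 : ∀ v → v ≢ ⊤⁺ → v ≡ v ℤ∞.+ v → v ≡ [ + 0 ]
    idempotent⇒0 ⊤⁺    v≢⊤ _ = ⊥-elim (v≢⊤ ≡.refl)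
    idempotent⇒0 [ k ] _   e =
      ≡.cong [_] (ℤG.identityˡ-unique k k (≡.sym (inj e)))
      where inj : ∀ {i j : ℤ} → [ i ] ≡ [ j ] → i ≡ j
            inj ≡.refl = ≡.refl

    double≡0⇒0 : ∀ v → v ℤ∞.+ v ≡ [ + 0 ] → v ≡ [ + 0 ]
    double≡0⇒0 [ + zero ] _ = ≡.refl

  val-1 : val 1# ≡ [ + 0 ]
  val-1 = idempotent⇒0 (val 1#) (val-≢⊤ (0≉1 ∘ sym))
    (≡.trans (val-cong (sym (*-identityˡ 1#))) (val-* 1# 1#))

  val-neg1 : val (- 1#) ≡ [ + 0 ]
  val-neg1 = double≡0⇒0 (val (- 1#)) (begin
    val (- 1#) ℤ∞.+ val (- 1#)  ≡⟨ val-* (- 1#) (- 1#) ⟨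
    val (- 1# * - 1#)           ≡⟨ val-cong (-1*x≈-x (- 1#)) ⟩
    val (- - 1#)                ≡⟨ val-cong (⁻¹-involutive 1#) ⟩
    val 1#                      ≡⟨ val-1 ⟩
    [ + 0 ]                     ∎)
    where open ≡.≡-Reasoning

  val-neg : ∀ x → val (- x) ≡ val x
  val-neg x = begin
    val (- x)               ≡⟨ val-cong (-1*x≈-x x) ⟨
    val (- 1# * x)          ≡⟨ val-* (- 1#) x ⟩
    val (- 1#) ℤ∞.+ val x   ≡⟨ ≡.cong (ℤ∞._+ val x) val-neg1 ⟩
    [ + 0 ] ℤ∞.+ val x      ≡⟨ 0+ (val x) ⟩
    val x                   ∎
    where
    open ≡.≡-Reasoning
    0+ : ∀ v → [ + 0 ] ℤ∞.+ v ≡ v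
    0+ [ k ] = ≡.cong [_] (ℤ.+-identityˡ k)
    0+ ⊤⁺    = ≡.refl

  ⊓-glb : ∀ {k} u v → k ℤ∞.≤ u → k ℤ∞.≤ v → k ℤ∞.≤ u ℤ∞.⊓ v
  ⊓-glb u v p q with ℤ∞.total u v
  ... | inj₁ _ = p
  ... | inj₂ _ = q

  R-+ : ∀ {x y} → x ∈ R → y ∈ R → x + y ∈ R
  R-+ {x} {y} p q = ℤ∞.≤-trans (⊓-glb (val x) (val y) p q) (val-+ x y)

  R-neg : ∀ {x} → x ∈ R → - x ∈ R
  R-neg {x} p = ≡.subst ([ + 0 ] ℤ∞.≤_) (≡.sym (val-neg x)) p

  R-0 : 0# ∈ R
  R-0 = ≡.subst ([ + 0 ] ℤ∞.≤_) (≡.sym val-0) ([ + 0 ] SupOrder.≤⊤⁺)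

  R-1 : 1# ∈ R
  R-1 = ≡.subst ([ + 0 ] ℤ∞.≤_) (≡.sym val-1) SupOrder.[ ℤ.≤-refl ]

  R-* : ∀ {x y} → x ∈ R → y ∈ R → x * y ∈ R
  R-* {x} {y} p q = ≡.subst ([ + 0 ] ℤ∞.≤_) (≡.sym (val-* x y)) (nonNeg p q)
    where
    nonNeg : ∀ {u v} → [ + 0 ] ℤ∞.≤ u → [ + 0 ] ℤ∞.≤ v → [ + 0 ] ℤ∞.≤ u ℤ∞.+ v
    nonNeg {[ k ]} {[ l ]} SupOrder.[ a ] SupOrder.[ b ] = SupOrder.[ ℤ.+-mono-≤ a b ]
    nonNeg {[ k ]} {⊤⁺}    _              _              = [ + 0 ] SupOrder.≤⊤⁺
    nonNeg {⊤⁺}            _              _              = [ + 0 ] SupOrder.≤⊤⁺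

  -- The set underlying the residue field R / 𝔪.
  residueSetoid : Setoid 0ℓ 0ℓ
  residueSetoid = record
    { Carrier       = Σ Carrier R
    ; _≈_           = λ x y → proj₁ x - proj₁ y ∈ 𝔪
    ; isEquivalence = record
      { refl  = λ {x} → 0# , R-0 , trans (-‿inverseʳ (proj₁ x)) (sym (zeroʳ π))
      ; sym   = λ {x} {y} (r , r∈R , e) → - r , R-neg r∈R ,
          trans (neg-minus (proj₁ x) (proj₁ y)) (trans (-‿cong e) (-‿distribʳ-* π r))
      ; trans = λ {x} {y} {z} (r , r∈R , e) (s , s∈R , e′) → r + s , R-+ r∈R s∈R ,
          trans (telescope (proj₁ x) (proj₁ y) (proj₁ z))
                (trans (+-cong e e′) (sym (distribˡ π r s)))
      }
    }
    where
    neg-minus : ∀ x y → y - x ≈ - (x - y)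
    neg-minus x y = sym (trans (sym (⁻¹-∙-comm x (- y)))
      (trans (+-congˡ (⁻¹-involutive y)) (+-comm (- x) y)))
    telescope : ∀ x y z → x - z ≈ (x - y) + (y - z)
    telescope x y z = sym (trans (+-assoc x (- y) (y - z)) (+-congˡ
      (trans (sym (+-assoc (- y) y (- z)))
        (trans (+-congʳ (-‿inverseˡ y)) (+-identityˡ (- z))))))

  IsCauchy : (ℕ → Carrier) → Set
  IsCauchy s = ∀ N → ∃[ M ] ∀ m n → M ℕ.≤ m → M ℕ.≤ n → [ + N ] ℤ∞.≤ val (s m - s n)

  ConvergesTo : (ℕ → Carrier) → Carrier → Set
  ConvergesTo s x = ∀ N → ∃[ M ] ∀ m → M ℕ.≤ m → [ + N ] ℤ∞.≤ val (s m - x)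

record LocalField : Set₁ where
  field
    discretelyValuedField : DiscretelyValuedField
  open DiscretelyValuedField discretelyValuedField public
  field
    complete     : ∀ s → IsCauchy s → ∃ (ConvergesTo s)
    q            : ℕ
    residueCount : Bijection residueSetoid (≡.setoid (Fin q))

  instance
    q-nonZero : NonZero q
    q-nonZero = nonZeroIndex (Bijection.to residueCount (0# , R-0))

module Analysis (em : Classical) (ℝ : RealNumbers) where
  private module ℝ = RealNumbers ℝ
  open ℝ using (0#; 1#; _≤_) renaming (Carrier to |ℝ|)

  -- Some element satisfying `P` if there is one, and otherwise the given
  -- default.  It is only applied to properties whose solutions are all equal.
  the : ∀ {a ℓ} {A : Set a} → A → Pred A ℓ → A
  the default P with em {P = ∃ P}
  ... | yes (x , _) = x
  ... | no  _       = default

  sup : ∀ {ℓ} → Pred |ℝ| ℓ → |ℝ|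
  sup S = the 0# (IsLUB _≤_ S)

  inf : ∀ {ℓ} → Pred |ℝ| ℓ → |ℝ|
  inf S = the 0# (IsGLB _≤_ S)

  root : ℕ → |ℝ| → |ℝ|
  root n x = sup (λ y → 0# ≤ y × y ℝ.^ n ≤ x)

  -- Meaningful for a nonnegative base.
  infixr 8 _^ℚ_
  _^ℚ_ : |ℝ| → ℚ → |ℝ|
  x ^ℚ r = root (↧ₙ r) (x ℝ.^ℤ (↥ r))

  ℝ∞ : Set
  ℝ∞ = |ℝ| ⁺

  open SupOrder _≤_ public using () renaming (_≤⁺_ to _≤∞_)
  open SupEq ℝ._≈_ public using () renaming (_≈⁺_ to _≈∞_)
  open AddTop ℝ._+_ public using () renaming (_+⁺_ to _+∞_)

  sup∞ : ∀ {ℓ} → Pred ℝ∞ ℓ → ℝ∞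
  sup∞ S = the [ 0# ] (IsLUB _≤∞_ S)

  partialSum : (ℕ → ℝ∞) → ℕ → ℝ∞
  partialSum s zero    = [ 0# ]
  partialSum s (suc n) = partialSum s n +∞ s n

  module _ {X : Set} (dist : X → X → |ℝ|) where

    Open : Pred X 0ℓ → Set
    Open A = ∀ {x} → x ∈ A → ∃[ ε ] 0# ℝ.< ε × (∀ {y} → dist x y ℝ.< ε → y ∈ A)

    data Borel : Pred X 0ℓ → Set₁ where
      open-set   : ∀ {A} → Open A → Borel A
      complement : ∀ {A} → Borel A → Borel (∁ A)
      union      : ∀ {A : ℕ → Pred X 0ℓ} → (∀ i → Borel (A i)) → Borel (⋃ ℕ A)
      respects   : ∀ {A B} → A ≐ B → Borel A → Borel B

    -- `measure` is unconstrained on sets that are not Borel.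
    record BorelMeasure : Set₁ where
      field
        measure    : Pred X 0ℓ → ℝ∞
        cong       : ∀ {A B} → Borel A → A ≐ B → measure A ≈∞ measure B
        nonNeg     : ∀ {A} → Borel A → [ 0# ] ≤∞ measure A
        empty      : measure ∅ ≈∞ [ 0# ]
        σ-additive : ∀ {A : ℕ → Pred X 0ℓ} → (∀ i → Borel (A i)) →
                     (∀ i j → i ≢ j → A i ⊥ A j) →
                     IsLUB _≤∞_ (λ s → ∃[ n ] s ≡ partialSum (λ i → measure (A i)) n)
                           (measure (⋃ ℕ A))

    record SimpleFunction : Set₁ where
      field
        size     : ℕ
        value    : Fin size → |ℝ|
        positive : ∀ i → 0# ℝ.< value i
        piece    : Fin size → Pred X 0ℓ
        borel    : ∀ i → Borel (piece i)
        disjoint : ∀ i j → i ≢ j → piece i ⊥ piece j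

    module _ (μ : BorelMeasure) where
      open BorelMeasure μ
      open SimpleFunction

      -- Values are positive, so no convention for 0 · ∞ is needed.
      scale : |ℝ| → ℝ∞ → ℝ∞
      scale c [ m ] = [ c ℝ.* m ]
      scale c ⊤⁺    = ⊤⁺

      simpleIntegral : SimpleFunction → ℝ∞
      simpleIntegral s =
        foldr _+∞_ [ 0# ] (λ i → scale (value s i) (measure (piece s i)))

      -- The Lebesgue integral of a [0,∞]-valued function.
      ∫ : (X → ℝ∞) → ℝ∞
      ∫ g = sup∞ (λ v → ∃[ s ]
        (∀ i {x} → x ∈ piece s i → [ value s i ] ≤∞ g x) × v ≡ simpleIntegral s)

  -- For a locally compact group metrized by `dist` and a compact open set `C`,
  -- the Haar measure with mass 1 on `C`.  Finiteness on compact sets follows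
  -- from these conditions; so does regularity, as the groups to which this is
  -- applied are second countable.
  record HaarMeasure (G : Group 0ℓ 0ℓ) (dist : Group.Carrier G → Group.Carrier G → |ℝ|)
                     (C : Pred (Group.Carrier G) 0ℓ) : Set₁ where
    private module G = Group G
    field
      borelMeasure : BorelMeasure dist
    open BorelMeasure borelMeasure public
    field
      invariant  : ∀ g {A} → Borel dist A → measure (λ x → g G.∙ x ∈ A) ≈∞ measure A
      normalized : measure C ≈∞ [ 1# ]

module Kakeya (em : Classical) (ℝ : RealNumbers) (K : LocalField) (d : ℕ) where
  open Analysis em ℝ public
  private
    module ℝ = RealNumbers ℝ
    module K = LocalField K
  open ℝ using (0#; 1#; _≤_; _⊔_) renaming (Carrier to |ℝ|)
  open K using (q; R; R×; val) renaming (Carrier to |K|)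

  -- q ^ (-v), with q ^ (-∞) = 0.
  q^-_ : ℤ ⁺ → |ℝ|
  q^- [ k ] = ℝ.fromℕ q ℝ.^ℤ (ℤ.- k)
  q^- ⊤⁺    = 0#

  ∣_∣ : |K| → |ℝ|
  ∣ x ∣ = q^- val x

  Kᵈ : Group 0ℓ 0ℓ
  Kᵈ = Pointwise.group (Fin d) (AbelianGroup.group K.+-abelianGroup)

  module Kᵈ where
    open Group Kᵈ public
      using (Carrier; _≈_)
      renaming (_∙_ to infixl 6 _+_; ε to 0#; _⁻¹ to -_; _//_ to infixl 6 _-_)

  infixr 7 _·_
  _·_ : |K| → Kᵈ.Carrier → Kᵈ.Carrier
  (t · x) i = t K.* x i

  -- The maximum norm; starting the maximum at 0 is harmless as d ≥ 1.
  ‖_‖ : Kᵈ.Carrier → |ℝ|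
  ‖ x ‖ = foldr _⊔_ 0# (λ i → ∣ x i ∣)

  Rᵈ : Pred Kᵈ.Carrier 0ℓ
  Rᵈ x = ∀ i → x i ∈ R

  distKᵈ : Kᵈ.Carrier → Kᵈ.Carrier → |ℝ|
  distKᵈ x y = ‖ x Kᵈ.- y ‖

  𝕊 : Set
  𝕊 = ∃[ x ] ‖ x ‖ ℝ.≈ 1#

  infix 4 _∼_
  _∼_ : Rel 𝕊 0ℓ
  (x , _) ∼ (y , _) = ∃[ u ] u ∈ R× × y Kᵈ.≈ u · x

  ∼-isEquivalence : IsEquivalence _∼_
  ∼-isEquivalence = record
    { refl  = K.1# , (K.R-1 , K.1# , K.R-1 , K.*-identityˡ K.1#) , λ i → K.sym (K.*-identityˡ _)
    ; sym   = λ (u , (u∈R , v , v∈R , uv≈1) , y≈ux) →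
        v , (v∈R , u , u∈R , K.trans (K.*-comm v u) uv≈1) , λ i → K.sym
          (K.trans (K.*-congˡ (y≈ux i)) (K.trans (K.sym (K.*-assoc v u _))
            (K.trans (K.*-congʳ (K.trans (K.*-comm v u) uv≈1)) (K.*-identityˡ _))))
    ; trans = λ (u , (u∈R , u′ , u′∈R , e) , y≈ux) (v , (v∈R , v′ , v′∈R , e′) , z≈vy) →
        v K.* u ,
        (K.R-* v∈R u∈R , v′ K.* u′ , K.R-* v′∈R u′∈R ,
          K.trans (interchange v u v′ u′) (K.trans (K.*-cong e′ e) (K.*-identityˡ K.1#))) ,
        λ i → K.trans (z≈vy i) (K.trans (K.*-congˡ (y≈ux i)) (K.sym (K.*-assoc v u _)))
    }
    where open CommutativeSemigroupProperties K.*-commutativeSemigroup using (interchange)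

  -- A point of ℙ is given by a representative in 𝕊.
  ℙ : Setoid 0ℓ 0ℓ
  ℙ = record { isEquivalence = ∼-isEquivalence }

  distℙ : 𝕊 → 𝕊 → |ℝ|
  distℙ a b = inf (λ r → ∃[ â ] ∃[ b̂ ] â ∼ a × b̂ ∼ b × r ≡ distKᵈ (proj₁ â) (proj₁ b̂))

  IsCanonical : 𝕊 → Set
  IsCanonical (x , _) = ∃[ j ] x j K.≈ K.1# × (∀ i → i Fin.< j → ∣ x i ∣ ℝ.< 1#)

  can : 𝕊 → Kᵈ.Carrier
  can a = proj₁ (the a (λ c → c ∼ a × IsCanonical c))

  record Ω : Set where
    field
      to        : 𝕊 → Kᵈ.Carrier
      cong      : ∀ {a b} → a ∼ b → to a Kᵈ.≈ to b
      integral  : ∀ a → to a ∈ Rᵈ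
      lipschitz : ∀ a b → distKᵈ (to a) (to b) ≤ distℙ a b
  open Ω

  private
    module ℝO = TotalOrder ℝ.totalOrder
    module Mx = Max ℝ.totalOrder
    module ℝR = RingProperties ℝ.ring

  0≤-x : ∀ {x} → x ≤ 0# → 0# ≤ ℝ.- x
  0≤-x {x} x≤0 = ℝO.≤-respˡ-≈ (ℝ.-‿inverseʳ x)
    (ℝO.≤-respʳ-≈ (ℝ.+-identityˡ (ℝ.- x)) (ℝ.+-monoˡ-≤ (ℝ.- x) x≤0))

  0≤1 : 0# ≤ 1#
  0≤1 with ℝO.total 0# 1#
  ... | inj₁ p = p
  ... | inj₂ p = ℝO.≤-respʳ-≈ (ℝ.trans (ℝR.-1*x≈-x (ℝ.- 1#)) (ℝR.-‿involutive 1#))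
                   (ℝ.*-nonNeg (0≤-x p) (0≤-x p))

  x≤y⇒0≤y-x : ∀ {x y} → x ≤ y → 0# ≤ y ℝ.- x
  x≤y⇒0≤y-x {x} p = ℝO.≤-respˡ-≈ (ℝ.-‿inverseʳ x) (ℝ.+-monoˡ-≤ (ℝ.- x) p)

  0≤y-x⇒x≤y : ∀ {x y} → 0# ≤ y ℝ.- x → x ≤ y
  0≤y-x⇒x≤y {x} {y} p = ℝO.≤-respˡ-≈ (ℝ.+-identityˡ x) (ℝO.≤-respʳ-≈
    (ℝ.trans (ℝ.+-assoc y (ℝ.- x) x)
      (ℝ.trans (ℝ.+-congˡ (ℝ.-‿inverseˡ x)) (ℝ.+-identityʳ y)))
    (ℝ.+-monoˡ-≤ x p))

  *-monoˡ : ∀ {x y} z → 0# ≤ z → x ≤ y → z ℝ.* x ≤ z ℝ.* y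
  *-monoˡ {x} {y} z 0≤z x≤y = 0≤y-x⇒x≤y (ℝO.≤-respʳ-≈
    (ℝ.trans (ℝ.distribˡ z y (ℝ.- x)) (ℝ.+-congˡ (ℝ.sym (ℝR.-‿distribʳ-* z x))))
    (ℝ.*-nonNeg 0≤z (x≤y⇒0≤y-x x≤y)))

  x≤1+x : ∀ x → x ≤ 1# ℝ.+ x
  x≤1+x x = ℝO.≤-respˡ-≈ (ℝ.+-identityˡ x) (ℝ.+-monoˡ-≤ x 0≤1)

  0≤fromℕ : ∀ n → 0# ≤ ℝ.fromℕ n
  0≤fromℕ zero    = ℝO.refl
  0≤fromℕ (suc n) = ℝO.trans (0≤fromℕ n) (x≤1+x (ℝ.fromℕ n))

  1≤fromℕ : ∀ n → .{{NonZero n}} → 1# ≤ ℝ.fromℕ n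
  1≤fromℕ (suc n) = ℝO.≤-respˡ-≈ (ℝ.+-identityˡ 1#)
    (ℝO.≤-respʳ-≈ (ℝ.+-comm (ℝ.fromℕ n) 1#) (ℝ.+-monoˡ-≤ 1# (0≤fromℕ n)))

  module Powers (b : |ℝ|) (1≤b : 1# ≤ b) where
    c : |ℝ|
    c = b ℝ.⁻¹

    0≤b : 0# ≤ b
    0≤b = ℝO.trans 0≤1 1≤b

    bc≈1 : b ℝ.* c ℝ.≈ 1#
    bc≈1 = ℝ.inverseʳ b
      (λ b≈0 → ℝ.0≉1 (ℝO.antisym 0≤1 (ℝO.≤-respʳ-≈ b≈0 1≤b)))

    0≤c : 0# ≤ c
    0≤c with ℝO.total 0# c
    ... | inj₁ p = p
    ... | inj₂ p = ⊥-elim (ℝ.0≉1 (ℝO.antisym 0≤1 (ℝO.≤-respˡ-≈ bc≈1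
                     (ℝO.≤-respʳ-≈ (ℝ.zeroʳ b) (*-monoˡ b 0≤b p)))))

    c≤1 : c ≤ 1#
    c≤1 = ℝO.≤-respˡ-≈ (ℝ.*-identityʳ c)
      (ℝO.≤-respʳ-≈ (ℝ.trans (ℝ.*-comm c b) bc≈1) (*-monoˡ c 0≤c 1≤b))

    ^-nonNeg : ∀ {x} → 0# ≤ x → ∀ n → 0# ≤ x ℝ.^ n
    ^-nonNeg 0≤x zero    = 0≤1
    ^-nonNeg 0≤x (suc n) = ℝ.*-nonNeg 0≤x (^-nonNeg 0≤x n)

    b^-step : ∀ n → b ℝ.^ n ≤ b ℝ.^ suc n
    b^-step n = ℝO.≤-respˡ-≈ (ℝ.*-identityʳ _) (ℝO.≤-respʳ-≈ (ℝ.*-comm _ b)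
      (*-monoˡ (b ℝ.^ n) (^-nonNeg 0≤b n) 1≤b))

    c^-step : ∀ n → c ℝ.^ suc n ≤ c ℝ.^ n
    c^-step n = ℝO.≤-respʳ-≈ (ℝ.*-identityʳ _) (ℝO.≤-respˡ-≈ (ℝ.*-comm _ c)
      (*-monoˡ (c ℝ.^ n) (^-nonNeg 0≤c n) c≤1))

    b^-mono : ∀ {m n} → m ℕ.≤′ n → b ℝ.^ m ≤ b ℝ.^ n
    b^-mono ℕ.≤′-refl       = ℝO.refl
    b^-mono (ℕ.≤′-step {n} m≤n) = ℝO.trans (b^-mono m≤n) (b^-step n)

    c^-anti : ∀ {m n} → m ℕ.≤′ n → c ℝ.^ n ≤ c ℝ.^ m
    c^-anti ℕ.≤′-refl       = ℝO.refl
    c^-anti (ℕ.≤′-step {n} m≤n) = ℝO.trans (c^-step n) (c^-anti m≤n)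

    ^ℤ-mono : ∀ {i j} → i ℤ.≤ j → b ℝ.^ℤ i ≤ b ℝ.^ℤ j
    ^ℤ-mono (ℤ.-≤- n≤m) = c^-anti (ℕ.≤⇒≤′ (ℕ.s≤s n≤m))
    ^ℤ-mono { -[1+ m ]} {+ n} ℤ.-≤+ =
      ℝO.trans (c^-anti {0} {suc m} ℕ.z≤′n) (b^-mono {0} {n} ℕ.z≤′n)
    ^ℤ-mono (ℤ.+≤+ m≤n) = b^-mono (ℕ.≤⇒≤′ m≤n)

    ^ℤ-nonNeg : ∀ i → 0# ≤ b ℝ.^ℤ i
    ^ℤ-nonNeg (+ n)    = ^-nonNeg 0≤b n
    ^ℤ-nonNeg -[1+ n ] = ^-nonNeg 0≤c (suc n)

  module q^ = Powers (ℝ.fromℕ q) (1≤fromℕ q)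

  q^--antitone : ∀ {v w} → v ℤ∞.≤ w → q^- w ≤ q^- v
  q^--antitone SupOrder.[ k≤l ] = q^.^ℤ-mono (ℤ.neg-mono-≤ k≤l)
  q^--antitone ([ k ] SupOrder.≤⊤⁺) = q^.^ℤ-nonNeg (ℤ.- k)
  q^--antitone (⊤⁺    SupOrder.≤⊤⁺) = ℝO.refl

  ∣∣-cong : ∀ {x y} → x K.≈ y → ∣ x ∣ ≡ ∣ y ∣
  ∣∣-cong x≈y = ≡.cong q^-_ (K.val-cong x≈y)

  ∣∣-neg : ∀ x → ∣ K.- x ∣ ≡ ∣ x ∣
  ∣∣-neg x = ≡.cong q^-_ (K.val-neg x)

  ∣∣-ultrametric : ∀ {r} x y → ∣ x ∣ ≤ r → ∣ y ∣ ≤ r → ∣ x K.+ y ∣ ≤ r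
  ∣∣-ultrametric x y p q with ℤ∞.total (val x) (val y) | q^--antitone (K.val-+ x y)
  ... | inj₁ _ | h = ℝO.trans h p
  ... | inj₂ _ | h = ℝO.trans h q

  0≤fold : ∀ {n} (v : Vector |ℝ| n) → 0# ≤ foldr _⊔_ 0# v
  0≤fold {zero}  v = ℝO.refl
  0≤fold {suc n} v = ℝO.trans (0≤fold (v ∘ Fin.suc)) (Mx.x≤y⊔x _ _)

  fold≥ : ∀ {n} (v : Vector |ℝ| n) i → v i ≤ foldr _⊔_ 0# v
  fold≥ v Fin.zero    = Mx.x≤x⊔y _ _
  fold≥ v (Fin.suc i) = ℝO.trans (fold≥ (v ∘ Fin.suc) i) (Mx.x≤y⊔x _ _)

  fold≤ : ∀ {n r} (v : Vector |ℝ| n) → 0# ≤ r → (∀ i → v i ≤ r) → foldr _⊔_ 0# v ≤ r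
  fold≤ {zero}  v 0≤r h = 0≤r
  fold≤ {suc n} v 0≤r h = Mx.⊔-lub (h Fin.zero) (fold≤ (v ∘ Fin.suc) 0≤r (h ∘ Fin.suc))

  0≤‖‖ : ∀ x → 0# ≤ ‖ x ‖
  0≤‖‖ x = 0≤fold (λ i → ∣ x i ∣)

  ∣∣≤‖‖ : ∀ x i → ∣ x i ∣ ≤ ‖ x ‖
  ∣∣≤‖‖ x = fold≥ (λ i → ∣ x i ∣)

  ‖‖≤ : ∀ {r} x → 0# ≤ r → (∀ i → ∣ x i ∣ ≤ r) → ‖ x ‖ ≤ r
  ‖‖≤ x = fold≤ (λ i → ∣ x i ∣)

  private
    ≡⇒≤ : ∀ {x y z : |ℝ|} → x ≡ y → y ≤ z → x ≤ z
    ≡⇒≤ ≡.refl p = p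

    minus-interchange : ∀ a b c e →
      (a K.+ b) K.- (c K.+ e) K.≈ (a K.- c) K.+ (b K.- e)
    minus-interchange a b c e = K.trans
      (K.+-congˡ (K.sym (⁻¹-∙-comm c e))) (interchange a b (K.- c) (K.- e))
      where open CommutativeSemigroupProperties K.+-commutativeSemigroup using (interchange)
            open AbelianGroupProperties K.+-abelianGroup using (⁻¹-∙-comm)

  Ω-group : Group 0ℓ 0ℓ
  Ω-group = record
    { Carrier = Ω
    ; _≈_     = λ f g → ∀ a → to f a Kᵈ.≈ to g a
    ; _∙_     = plus
    ; ε       = null
    ; _⁻¹     = minus
    ; isGroup = record
      { isMonoid = record
        { isSemigroup = record
          { isMagma = record
            { isEquivalence = record
              { refl  = λ a i → K.refl
              ; sym   = λ e a i → K.sym (e a i)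
              ; trans = λ e e′ a i → K.trans (e a i) (e′ a i)
              }
            ; ∙-cong = λ e e′ a i → K.+-cong (e a i) (e′ a i)
            }
          ; assoc = λ f g h a i → K.+-assoc _ _ _
          }
        ; identity = (λ f a i → K.+-identityˡ _) , (λ f a i → K.+-identityʳ _)
        }
      ; inverse = (λ f a i → K.-‿inverseˡ _) , (λ f a i → K.-‿inverseʳ _)
      ; ⁻¹-cong = λ e a i → K.-‿cong (e a i)
      }
    }
    where
    plus : Op₂ Ω
    plus f g .to a          = to f a Kᵈ.+ to g a
    plus f g .cong e i      = K.+-cong (cong f e i) (cong g e i)
    plus f g .integral a i  = K.R-+ (integral f a i) (integral g a i)
    plus f g .lipschitz a b = ‖‖≤ _ (ℝO.trans (0≤‖‖ _) (lipschitz f a b)) λ i →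
      ≡⇒≤ (∣∣-cong (minus-interchange (to f a i) (to g a i) (to f b i) (to g b i)))
        (∣∣-ultrametric _ _
          (ℝO.trans (∣∣≤‖‖ (to f a Kᵈ.- to f b) i) (lipschitz f a b))
          (ℝO.trans (∣∣≤‖‖ (to g a Kᵈ.- to g b) i) (lipschitz g a b)))

    minus : Ω → Ω
    minus f .to a          = Kᵈ.- to f a
    minus f .cong e i      = K.-‿cong (cong f e i)
    minus f .integral a i  = K.R-neg (integral f a i)
    minus f .lipschitz a b = ‖‖≤ _ (ℝO.trans (0≤‖‖ _) (lipschitz f a b)) λ i →
      ≡⇒≤ (≡.trans (∣∣-cong (⁻¹-∙-comm (to f a i) (K.- to f b i)))
                   (∣∣-neg (to f a i K.- to f b i)))
        (ℝO.trans (∣∣≤‖‖ (to f a Kᵈ.- to f b) i) (lipschitz f a b))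
      where open AbelianGroupProperties K.+-abelianGroup using (⁻¹-∙-comm)

    0≤distℙ : ∀ a b → 0# ≤ distℙ a b
    0≤distℙ a b with em {P = ∃ (IsGLB _≤_ (λ r →
      ∃[ â ] ∃[ b̂ ] â ∼ a × b̂ ∼ b × r ≡ distKᵈ (proj₁ â) (proj₁ b̂)))}
    ... | yes (δ , _ , greatest) =
          greatest 0# λ { (â , b̂ , _ , _ , ≡.refl) → 0≤‖‖ (proj₁ â Kᵈ.- proj₁ b̂) }
    ... | no _ = ℝO.refl

    null : Ω
    null .to a          = Kᵈ.0#
    null .cong e i      = K.refl
    null .integral a i  = K.R-0
    null .lipschitz a b = ‖‖≤ _ (0≤distℙ a b) λ i →
      ≡⇒≤ (≡.trans (∣∣-cong (K.-‿inverseʳ K.0#)) (≡.cong q^-_ K.val-0)) (0≤distℙ a b)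

  -- The metric of uniform convergence.
  distΩ : Ω → Ω → |ℝ|
  distΩ f g = sup (λ r → ∃[ a ] r ≡ distKᵈ (to f a) (to g a))

  HaarMeasureKᵈ : Set₁
  HaarMeasureKᵈ = HaarMeasure Kᵈ distKᵈ Rᵈ

  HaarProbabilityΩ : Set₁
  HaarProbabilityΩ = HaarMeasure Ω-group distΩ U

  N : Ω → Pred Kᵈ.Carrier 0ℓ
  N f x = ∃[ a ] ∃[ t ] t ∈ R × x Kᵈ.≈ t · can a Kᵈ.+ to f a

  N[_] : ℕ → Ω → Pred Kᵈ.Carrier 0ℓ
  N[ n ] f x = x ∈ Rᵈ × inf (λ r → ∃[ y ] y ∈ N f × r ≡ distKᵈ x y) ≤ q^- [ + n ]

  X[_] : ℕ → HaarMeasureKᵈ → Ω → ℝ∞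
  X[ n ] μ f = HaarMeasure.measure μ (N[ n ] f)

  𝔼 : HaarProbabilityΩ → (Ω → ℝ∞) → ℝ∞
  𝔼 P = ∫ distΩ (HaarMeasure.borelMeasure P)

  u : ℕ → |ℝ|
  u zero    = 1#
  u (suc n) =
    1# ℝ.- (1# ℝ.- u n ℝ.* ℝ.fromℕ (q ℕ.^ (d ℕ.∸ 1)) ℝ.⁻¹) ℝ.^ (q ℕ.^ (d ℕ.∸ 1))

  exponent : ℚ
  exponent = ∑[ i < d ] ((+ 1) ℚ./ (q ℕ.^ toℕ i)) {{ℕ.m^n≢0 q (toℕ i)}}
    where open MonoidSum ℚ.+-0-monoid using (sum-syntax)

{-# OPTIONS --safe #-}

-- Let j be the pivot of a, that is can(a)_j = 1.  The map
--   f ↦ (a ↦ (f(a)_j , f(a)_i - f(a)_j can(a)_i for i ≠ j))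
-- permutes the Lipschitz functions on projective space, and the line attached
-- to a comes within q⁻ⁿ of 0 exactly when the last d - 1 coordinates of the
-- image vanish modulo 𝔪ⁿ.  So one has to count the Lipschitz functions modulo
-- 𝔪ⁿ with such a zero.  These are labelled trees: projective space consists of
-- 1 + q + ⋯ + q^(d-1) residue classes, each residue class of q^(d-1) smaller
-- ones and so on, and in each class one chooses freely a digit in k^d and then
-- a function on the class, rescaled by π⁻¹.  A zero survives a class when the
-- d - 1 relevant digits are 0, which has probability q^-(d-1), and the
-- rescaled function has a zero modulo 𝔪ⁿ⁻¹; the classes being independent, this
-- is the recurrence for uₙ.
-- The expectation becomes a finite average because all residue classes modulo
-- 𝔪ⁿ, in Rᵈ as in Ω, are translates of one another, and by translation
-- invariance of Ω every point of Rᵈ is as likely to be hit as 0.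

module Submission where

-- The rational exponent measures how the top of the tree differs from its lower levels. A branch
-- with m levels below it avoids the origin with probability `missing m`, that is 1 - `u m` /
-- q^(d-1). Below the top a class has `Q` = q^(d-1) branches, so 1 - `u (suc m)` is the power `Q` of
-- `missing m`; projective space has `S` = 1 + q + ⋯ + q^(d-1) of them and gives the power `S`.
-- Eliminating `missing m` leaves the exponent S / Q, applied to a number whose root is known in
-- advance. The obstacle is that the permutation of functions uses a coordinate change that varies
-- with the line. It respects distances because the pivot is constant on residue classes and `can`
-- is itself 1-Lipschitz; points of different classes are at distance 1, where integrality of the
-- values is enough. Limits and compactness are avoided because the norm is discrete: congruences
-- modulo powers of 𝔪 replace the infima and suprema, and classes modulo 𝔪ⁿ are open, so the random
-- variable is a finite step function.

open import Defs
import Algebra.Properties.AbelianGroup as AbelianGroupProperties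
import Algebra.Properties.CommutativeMonoid.Sum as MonoidSum
import Algebra.Properties.CommutativeSemigroup as CommutativeSemigroupProperties
import Algebra.Properties.Monoid.Mult as MonoidMult
import Algebra.Properties.Ring as RingProperties
import Algebra.Properties.Semiring.Exp as Exp
import Algebra.Properties.Semiring.Mult as SemiringMult
import Algebra.Properties.Semiring.Mult.TCOptimised as Mult
import Algebra.Properties.Semiring.Sum as SemiringSum
import Algebra.Solver.Ring as RingSolver
open import Algebra.Bundles using (CommutativeRing; Group)
open import Algebra.Solver.Ring.AlmostCommutativeRing
  using (fromCommutativeRing; _-Raw-AlmostCommutative⟶_)
open import Data.Empty using (⊥-elim)
open import Data.Fin as Fin using (Fin; zero; suc; _↑ˡ_; _↑ʳ_; combine; remQuot; finToFun; funToFin)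
import Data.Fin.Properties as Fin
open import Data.Integer as ℤ using (ℤ; +_; -[1+_]; _⊖_)
import Data.Integer.Properties as ℤ
import Data.Integer.Solver as ℤSolver
open import Data.Maybe using (Maybe; just; nothing)
open import Data.Nat as ℕ using (ℕ; zero; suc; NonZero)
import Data.Nat.Properties as ℕ
open import Data.Product using (∃; ∃-syntax; _×_; _,_; proj₁; proj₂; uncurry)
open import Data.Rational as ℚ using (toℚᵘ; ↥_; ↧_; ↧ₙ_)
import Data.Rational.Properties as ℚ
open import Data.Rational.Unnormalised as ℚᵘ using (_≃_; *≡*)
import Data.Rational.Unnormalised.Properties as ℚᵘ
open import Data.Sum using (_⊎_; inj₁; inj₂; [_,_]′)
open import Data.Unit using (⊤; tt)
open import Data.Vec.Functional using (foldr; _∷_; insertAt)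
import Data.Vec.Functional.Properties as Vector
open import Function using (_∘_; id; const; Bijection)
open import Level using (0ℓ)
open import Relation.Binary using (Rel; TotalOrder; IsEquivalence; tri<; tri≈; tri>)
import Relation.Binary.Construct.Add.Supremum.Equality as SupEq
import Relation.Binary.Construct.Add.Supremum.NonStrict as SupOrder
open import Relation.Binary.PropositionalEquality as ≡ using (_≡_; _≢_)
import Relation.Binary.Reasoning.Setoid as SetoidReasoning
open import Relation.Nullary using (¬_; yes; no; contradiction)
open import Relation.Nullary.Construct.Add.Supremum using (⊤⁺; [_])
open import Relation.Unary using (Pred; _∈_; _∉_; _≐_; _⊆_; _∩_; _∪_; _⊥_; ∁; ∅; U; ⋃; Satisfiable)

-- Integer coefficients, unlike those of the ring itself, have decidable
-- equality, which is what lets the solver cancel terms.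
module IntegerSolver {c ℓ} (A : CommutativeRing c ℓ) where
  open CommutativeRing A
  open Mult semiring using (×-homo-+; ×1-homo-*; 1+×) renaming (_×_ to _×′_)
  open RingProperties ring using (-‿distribˡ-*; -‿distribʳ-*; -0#≈0#; -‿involutive)
  open AbelianGroupProperties +-abelianGroup using (⁻¹-∙-comm)
  open CommutativeSemigroupProperties +-commutativeSemigroup using (interchange)
  open import Relation.Binary.Reasoning.Setoid setoid

  -- The optimised multiple `_×′_` reduces `1 ×′ 1#` to `1#`, so `con (+ 1)` denotes `1#`
  -- definitionally and matches it in goals.
  ⟦_⟧ᶻ : ℤ → Carrier
  ⟦ + n ⟧ᶻ      = n ×′ 1#
  ⟦ -[1+ n ] ⟧ᶻ = - (suc n ×′ 1#)

  ⊖-homo : ∀ m n → ⟦ m ⊖ n ⟧ᶻ ≈ m ×′ 1# - n ×′ 1#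
  ⊖-homo m zero = sym (trans (+-congˡ -0#≈0#) (+-identityʳ _))
  ⊖-homo zero (suc n) = sym (+-identityˡ _)
  ⊖-homo (suc m) (suc n) = begin
    ⟦ suc m ⊖ suc n ⟧ᶻ                 ≡⟨ ≡.cong ⟦_⟧ᶻ (ℤ.[1+m]⊖[1+n]≡m⊖n m n) ⟩
    ⟦ m ⊖ n ⟧ᶻ                         ≈⟨ ⊖-homo m n ⟩
    m ×′ 1# - n ×′ 1#                    ≈⟨ +-identityˡ _ ⟨
    0# + (m ×′ 1# - n ×′ 1#)             ≈⟨ +-congʳ (-‿inverseʳ 1#) ⟨
    (1# - 1#) + (m ×′ 1# - n ×′ 1#)      ≈⟨ interchange 1# (- 1#) _ _ ⟩
    (1# + m ×′ 1#) + (- 1# - n ×′ 1#)    ≈⟨ +-cong (sym (1+× m 1#)) (⁻¹-∙-comm 1# (n ×′ 1#)) ⟩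
    suc m ×′ 1# - (1# + n ×′ 1#)         ≈⟨ +-congˡ (-‿cong (sym (1+× n 1#))) ⟩
    suc m ×′ 1# - suc n ×′ 1#            ∎

  neg-homo : ∀ i → ⟦ ℤ.- i ⟧ᶻ ≈ - ⟦ i ⟧ᶻ
  neg-homo (+ zero)  = sym -0#≈0#
  neg-homo (+ suc n) = refl
  neg-homo -[1+ n ]  = sym (-‿involutive _)

  +-homo : ∀ i j → ⟦ i ℤ.+ j ⟧ᶻ ≈ ⟦ i ⟧ᶻ + ⟦ j ⟧ᶻ
  +-homo (+ m) (+ n)       = ×-homo-+ 1# m n
  +-homo (+ m) -[1+ n ]    = ⊖-homo m (suc n)
  +-homo -[1+ m ] (+ n)    = trans (⊖-homo n (suc m)) (+-comm _ _)
  +-homo -[1+ m ] -[1+ n ] = trans (-‿cong (trans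
    (reflexive (≡.cong (_×′ 1#) (≡.cong suc (≡.sym (ℕ.+-suc m n)))))
    (×-homo-+ 1# (suc m) (suc n)))) (sym (⁻¹-∙-comm _ _))

  *-homo⁺ : ∀ m j → ⟦ + m ℤ.* j ⟧ᶻ ≈ (m ×′ 1#) * ⟦ j ⟧ᶻ
  *-homo⁺ m (+ n) = trans (reflexive (≡.cong ⟦_⟧ᶻ (≡.sym (ℤ.pos-* m n)))) (×1-homo-* m n)
  *-homo⁺ m -[1+ n ] = begin
    ⟦ + m ℤ.* (ℤ.- + suc n) ⟧ᶻ      ≡⟨ ≡.cong ⟦_⟧ᶻ (ℤ.neg-distribʳ-* (+ m) (+ suc n)) ⟨
    ⟦ ℤ.- (+ m ℤ.* + suc n) ⟧ᶻ      ≈⟨ neg-homo (+ m ℤ.* + suc n) ⟩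
    - ⟦ + m ℤ.* + suc n ⟧ᶻ          ≈⟨ -‿cong (*-homo⁺ m (+ suc n)) ⟩
    - ((m ×′ 1#) * (suc n ×′ 1#))     ≈⟨ -‿distribʳ-* _ _ ⟩
    (m ×′ 1#) * - (suc n ×′ 1#)       ∎

  *-homo : ∀ i j → ⟦ i ℤ.* j ⟧ᶻ ≈ ⟦ i ⟧ᶻ * ⟦ j ⟧ᶻ
  *-homo (+ m) j = *-homo⁺ m j
  *-homo -[1+ m ] j = begin
    ⟦ (ℤ.- + suc m) ℤ.* j ⟧ᶻ        ≡⟨ ≡.cong ⟦_⟧ᶻ (ℤ.neg-distribˡ-* (+ suc m) j) ⟨
    ⟦ ℤ.- (+ suc m ℤ.* j) ⟧ᶻ        ≈⟨ neg-homo (+ suc m ℤ.* j) ⟩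
    - ⟦ + suc m ℤ.* j ⟧ᶻ            ≈⟨ -‿cong (*-homo⁺ (suc m) j) ⟩
    - ((suc m ×′ 1#) * ⟦ j ⟧ᶻ)       ≈⟨ -‿distribˡ-* _ _ ⟩
    - (suc m ×′ 1#) * ⟦ j ⟧ᶻ         ∎

  morphism : ℤ.+-*-rawRing -Raw-AlmostCommutative⟶ fromCommutativeRing A
  morphism = record
    { ⟦_⟧ = ⟦_⟧ᶻ ; +-homo = +-homo ; *-homo = *-homo ; -‿homo = neg-homo
    ; 0-homo = refl ; 1-homo = refl }

  coefficients-equal? : ∀ i j → Maybe (⟦ i ⟧ᶻ ≈ ⟦ j ⟧ᶻ)
  coefficients-equal? i j with i ℤ.≟ j
  ... | yes ≡.refl = just refl
  ... | no  _      = nothing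

  open RingSolver ℤ.+-*-rawRing (fromCommutativeRing A) morphism coefficients-equal? public
    using (solve; _:=_; _:+_; _:*_; _:-_; :-_; con)

-- Ordered fields, finite sums and averages.

module OrderedField (ℝ : RealNumbers) where
  open RealNumbers ℝ hiding (zero)
  open TotalOrder totalOrder using (antisym; total; ≤-respˡ-≈; ≤-respʳ-≈)
    renaming (refl to ≤-refl; trans to ≤-trans; reflexive to ≤-reflexive)
  open IntegerSolver commutativeRing
  open RingProperties ring using (-1*x≈-x; -‿involutive)
  open SemiringSum semiring using (sum; sum-cong-≋; *-distribʳ-sum; ∑-distrib-+; ∑-comm; sum-replicate)
  open MonoidSum *-commutativeMonoid using ()
    renaming (sum to product; sum-cong-≋ to product-cong; sum-replicate to product-replicate)
  open SemiringMult semiring using (×1-homo-*; ×-assoc-*)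
  open MonoidMult +-monoid using (×-congʳ)
  open Exp semiring using (^-congˡ)

  ≤-by-nonNeg : ∀ {x y} → 0# ≤ y - x → x ≤ y
  ≤-by-nonNeg {x} {y} p = ≤-respˡ-≈ (+-identityˡ x)
    (≤-respʳ-≈ (solve 2 (λ x y → (y :- x) :+ x := y) refl x y) (+-monoˡ-≤ x p))

  nonNeg-diff : ∀ {x y} → x ≤ y → 0# ≤ y - x
  nonNeg-diff {x} p = ≤-respˡ-≈ (-‿inverseʳ x) (+-monoˡ-≤ (- x) p)

  nonPos-neg : ∀ {x} → x ≤ 0# → 0# ≤ - x
  nonPos-neg {x} p = ≤-respʳ-≈ (+-identityˡ (- x)) (nonNeg-diff p)

  +-mono-≤ : ∀ {x y u v} → x ≤ y → u ≤ v → x + u ≤ y + v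
  +-mono-≤ {x} {y} {u} {v} p q = ≤-trans (+-monoˡ-≤ u p)
    (≤-respˡ-≈ (+-comm u y) (≤-respʳ-≈ (+-comm v y) (+-monoˡ-≤ y q)))

  +-nonNeg : ∀ {x y} → 0# ≤ x → 0# ≤ y → 0# ≤ x + y
  +-nonNeg p q = ≤-respˡ-≈ (+-identityˡ 0#) (+-mono-≤ p q)

  x≤x+y : ∀ {x y} → 0# ≤ y → x ≤ x + y
  x≤x+y {x} p = ≤-respˡ-≈ (+-identityʳ x) (+-mono-≤ ≤-refl p)

  x-y≤x : ∀ {x y} → 0# ≤ y → x - y ≤ x
  x-y≤x {x} {y} p = ≤-by-nonNeg (≤-respʳ-≈ (solve 2 (λ x y → y := x :- (x :- y)) refl x y) p)

  *-monoʳ-≤ : ∀ {x y} z → 0# ≤ z → x ≤ y → x * z ≤ y * z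
  *-monoʳ-≤ {x} {y} z 0≤z x≤y = ≤-by-nonNeg (≤-respʳ-≈
    (solve 3 (λ x y z → (y :- x) :* z := y :* z :- x :* z) refl x y z)
    (*-nonNeg (nonNeg-diff x≤y) 0≤z))

  *-monoˡ-≤ : ∀ {x y} z → 0# ≤ z → x ≤ y → z * x ≤ z * y
  *-monoˡ-≤ {x} {y} z 0≤z x≤y = ≤-respˡ-≈ (*-comm x z) (≤-respʳ-≈ (*-comm y z) (*-monoʳ-≤ z 0≤z x≤y))

  0≤1 : 0# ≤ 1#
  0≤1 with total 0# 1#
  ... | inj₁ p = p
  ... | inj₂ p = ≤-respʳ-≈ (trans (-1*x≈-x (- 1#)) (-‿involutive 1#))
                   (*-nonNeg (nonPos-neg p) (nonPos-neg p))

  0<1 : 0# < 1#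
  0<1 = 0≤1 , 0≉1

  <-≤-trans : ∀ {x y z} → x < y → y ≤ z → x < z
  <-≤-trans (p , ¬e) q = ≤-trans p q , λ x≈z → ¬e (antisym p (≤-respʳ-≈ (sym x≈z) q))

  ≤-<-trans : ∀ {x y z} → x ≤ y → y < z → x < z
  ≤-<-trans p (q , ¬e) = ≤-trans p q , λ x≈z → ¬e (antisym q (≤-respˡ-≈ x≈z p))

  <⇒≱ : ∀ {x y} → x < y → ¬ y ≤ x
  <⇒≱ (p , ¬e) q = ¬e (antisym p q)

  *-cancel-0 : ∀ {x y} → ¬ x ≈ 0# → x * y ≈ 0# → y ≈ 0#
  *-cancel-0 {x} {y} x≉0 e = begin
    y                ≈⟨ *-identityˡ y ⟨
    1# * y           ≈⟨ *-congʳ (inverseʳ x x≉0) ⟨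
    (x * x ⁻¹) * y   ≈⟨ solve 3 (λ x x′ y → (x :* x′) :* y := x′ :* (x :* y)) refl x (x ⁻¹) y ⟩
    x ⁻¹ * (x * y)   ≈⟨ *-congˡ e ⟩
    x ⁻¹ * 0#        ≈⟨ zeroʳ _ ⟩
    0#               ∎
    where open SetoidReasoning setoid

  *-pos : ∀ {x y} → 0# < x → 0# < y → 0# < x * y
  *-pos (0≤x , x≉0) (0≤y , y≉0) =
    *-nonNeg 0≤x 0≤y , λ e → y≉0 (sym (*-cancel-0 (x≉0 ∘ sym) (sym e)))

  *-monoʳ-< : ∀ {x y} z → 0# < z → x < y → x * z < y * z
  *-monoʳ-< {x} {y} z 0<z (x≤y , x≉y) =
    *-monoʳ-≤ z (proj₁ 0<z) x≤y , λ e → x≉y (begin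
      x            ≈⟨ solve 2 (λ x y → x := y :- (y :- x)) refl x y ⟩
      y - (y - x)  ≈⟨ +-congˡ (-‿cong (*-cancel-0 (proj₂ 0<z ∘ sym) (difference e))) ⟩
      y - 0#       ≈⟨ solve 1 (λ y → y :- con (+ 0) := y) refl y ⟩
      y            ∎)
    where
    open SetoidReasoning setoid
    difference : x * z ≈ y * z → z * (y - x) ≈ 0#
    difference e = trans (solve 3 (λ x y z → z :* (y :- x) := y :* z :- x :* z) refl x y z)
      (trans (+-congʳ (sym e)) (-‿inverseʳ _))

  ^-nonNeg : ∀ {x} → 0# ≤ x → ∀ n → 0# ≤ x ^ n
  ^-nonNeg 0≤x zero    = 0≤1
  ^-nonNeg 0≤x (suc n) = *-nonNeg 0≤x (^-nonNeg 0≤x n)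

  ^-pos : ∀ {x} → 0# < x → ∀ n → 0# < x ^ n
  ^-pos 0<x zero    = 0<1
  ^-pos 0<x (suc n) = *-pos 0<x (^-pos 0<x n)

  ^-mono-≤ : ∀ {x y} → 0# ≤ x → x ≤ y → ∀ n → x ^ n ≤ y ^ n
  ^-mono-≤ 0≤x x≤y zero = ≤-refl
  ^-mono-≤ 0≤x x≤y (suc n) = ≤-trans (*-monoˡ-≤ _ 0≤x (^-mono-≤ 0≤x x≤y n))
    (*-monoʳ-≤ _ (^-nonNeg (≤-trans 0≤x x≤y) n) x≤y)

  ^-mono-< : ∀ {x y} → 0# ≤ x → x < y → ∀ n → x ^ suc n < y ^ suc n
  ^-mono-< 0≤x x<y n = ≤-<-trans (*-monoˡ-≤ _ 0≤x (^-mono-≤ 0≤x (proj₁ x<y) n))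
    (*-monoʳ-< _ (^-pos (≤-<-trans 0≤x x<y) n) x<y)

  fromℕ-pos : ∀ n → .{{_ : NonZero n}} → 0# < fromℕ n
  fromℕ-pos (suc n) = <-≤-trans 0<1 (x≤x+y (nonNeg n))
    where
    nonNeg : ∀ n → 0# ≤ fromℕ n
    nonNeg zero    = ≤-refl
    nonNeg (suc n) = +-nonNeg 0≤1 (nonNeg n)

  ⁻¹-unique : ∀ {x y} → x * y ≈ 1# → y ≈ x ⁻¹
  ⁻¹-unique {x} {y} e = begin
    y               ≈⟨ *-identityʳ y ⟨
    y * 1#          ≈⟨ *-congˡ (inverseʳ x x≉0) ⟨
    y * (x * x ⁻¹)  ≈⟨ solve 3 (λ x x′ y → y :* (x :* x′) := (x :* y) :* x′) refl x (x ⁻¹) y ⟩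
    (x * y) * x ⁻¹  ≈⟨ *-congʳ e ⟩
    1# * x ⁻¹       ≈⟨ *-identityˡ _ ⟩
    x ⁻¹            ∎
    where
    open SetoidReasoning setoid
    x≉0 : ¬ x ≈ 0#
    x≉0 x≈0 = 0≉1 (trans (sym (zeroˡ y)) (trans (*-congʳ (sym x≈0)) e))

  ⁻¹-nonNeg : ∀ {x} → 0# < x → 0# ≤ x ⁻¹
  ⁻¹-nonNeg {x} (0≤x , x≉0) with total 0# (x ⁻¹)
  ... | inj₁ p = p
  ... | inj₂ p = ⊥-elim (0≉1 (antisym 0≤1 (≤-respˡ-≈ (inverseʳ x (x≉0 ∘ sym))
                   (≤-respʳ-≈ (zeroʳ x) (*-monoˡ-≤ x 0≤x p)))))

  ⁻¹-pos : ∀ {x} → 0# < x → 0# < x ⁻¹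
  ⁻¹-pos {x} 0<x = ⁻¹-nonNeg 0<x , λ e →
    0≉1 (trans (sym (zeroʳ x)) (trans (*-congˡ e) (inverseʳ x (proj₂ 0<x ∘ sym))))

  fromℕ-* : ∀ m n → fromℕ (m ℕ.* n) ≈ fromℕ m * fromℕ n
  fromℕ-* = ×1-homo-*

  fromℕ-^ : ∀ m n → fromℕ (m ℕ.^ n) ≈ fromℕ m ^ n
  fromℕ-^ m zero    = +-identityʳ 1#
  fromℕ-^ m (suc n) = trans (fromℕ-* m (m ℕ.^ n)) (*-congˡ (fromℕ-^ m n))

  *-⁻¹-cancel : ∀ n .{{_ : NonZero n}} → fromℕ n * fromℕ n ⁻¹ ≈ 1#
  *-⁻¹-cancel n = inverseʳ _ (proj₂ (fromℕ-pos n) ∘ sym)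

  ^-distrib-* : ∀ x y n → (x * y) ^ n ≈ x ^ n * y ^ n
  ^-distrib-* x y zero    = sym (*-identityˡ 1#)
  ^-distrib-* x y (suc n) = trans (*-congˡ (^-distrib-* x y n))
    (solve 4 (λ x y u v → (x :* y) :* (u :* v) := (x :* u) :* (y :* v)) refl x y (x ^ n) (y ^ n))

  1^n≈1 : ∀ n → 1# ^ n ≈ 1#
  1^n≈1 zero    = refl
  1^n≈1 (suc n) = trans (*-identityˡ _) (1^n≈1 n)

  sum-nonNeg : ∀ {n} (f : Fin n → Carrier) → (∀ i → 0# ≤ f i) → 0# ≤ sum f
  sum-nonNeg {zero}  f p = ≤-refl
  sum-nonNeg {suc n} f p = +-nonNeg (p zero) (sum-nonNeg (f ∘ suc) (p ∘ suc))

  sum-mono : ∀ {n} (f g : Fin n → Carrier) → (∀ i → f i ≤ g i) → sum f ≤ sum g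
  sum-mono {zero}  f g p = ≤-refl
  sum-mono {suc n} f g p = +-mono-≤ (p zero) (sum-mono (f ∘ suc) (g ∘ suc) (p ∘ suc))

  term≤sum : ∀ {n} (f : Fin n → Carrier) → (∀ i → 0# ≤ f i) → ∀ i → f i ≤ sum f
  term≤sum f p zero    = x≤x+y (sum-nonNeg (f ∘ suc) (p ∘ suc))
  term≤sum f p (suc i) = ≤-trans (term≤sum (f ∘ suc) (p ∘ suc) i)
    (≤-respʳ-≈ (+-comm _ _) (x≤x+y (p zero)))

  sum-const : ∀ n x → sum {n} (const x) ≈ fromℕ n * x
  sum-const n x = trans (sum-replicate n)
    (trans (×-congʳ n (sym (*-identityˡ x))) (sym (×-assoc-* n 1# x)))

  sum-split : ∀ m {n} (f : Fin (m ℕ.+ n) → Carrier) →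
              sum f ≈ sum (f ∘ (_↑ˡ n)) + sum (f ∘ (m ↑ʳ_))
  sum-split zero    f = sym (+-identityˡ _)
  sum-split (suc m) f = trans (+-congˡ (sum-split m (f ∘ suc))) (sym (+-assoc _ _ _))

  sum-combine : ∀ m n (f : Fin (m ℕ.* n) → Carrier) →
                sum f ≈ sum {m} λ i → sum {n} λ j → f (combine i j)
  sum-combine zero    n f = refl
  sum-combine (suc m) n f = trans (sum-split n f) (+-congˡ (sum-combine m n (f ∘ (n ↑ʳ_))))

  product-cong-≡ : ∀ {n} {f g : Fin n → Carrier} → (∀ i → f i ≡ g i) → product f ≈ product g
  product-cong-≡ e = product-cong (reflexive ∘ e)

  -- Distributivity: expanding the product picks one summand from each factor, and `finToFun τ` runs
  -- through all such choices. The induction splits off the leading digit of `τ`. This is the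
  -- independence of the branches of a tree.
  sum-of-products : ∀ {m} n (g : Fin n → Fin m → Carrier) →
    sum {m ℕ.^ n} (λ τ → product λ i → g i (finToFun τ i)) ≈ product λ i → sum (g i)
  sum-of-products zero g = +-identityʳ 1#
  sum-of-products {m} (suc n) g = begin
    sum {m ℕ.^ suc n} (λ τ → product λ i → g i (finToFun τ i))
      ≈⟨ sum-combine m (m ℕ.^ n) _ ⟩
    sum {m} (λ a → sum {m ℕ.^ n} λ b → product λ i → g i (finToFun (combine a b) i))
      ≈⟨ sum-cong-≋ (λ a → sum-cong-≋ λ b → *-cong
           (reflexive (≡.cong (g zero ∘ proj₁) (Fin.remQuot-combine a b)))
           (product-cong-≡ λ i → ≡.cong (λ p → g (suc i) (finToFun (proj₂ p) i)) (Fin.remQuot-combine {m} a b))) ⟩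
    sum {m} (λ a → sum {m ℕ.^ n} λ b → g zero a * rest b)
      ≈⟨ sum-cong-≋ (λ a → trans (sum-cong-≋ λ b → *-comm (g zero a) (rest b))
           (trans (sym (*-distribʳ-sum (g zero a) rest)) (*-comm _ _))) ⟩
    sum (λ a → g zero a * sum rest)
      ≈⟨ *-distribʳ-sum (sum rest) (g zero) ⟨
    sum (g zero) * sum rest
      ≈⟨ *-congˡ (sum-of-products n (g ∘ suc)) ⟩
    product (λ i → sum (g i)) ∎
    where
    open SetoidReasoning setoid
    rest : Fin (m ℕ.^ n) → Carrier
    rest b = product λ i → g (suc i) (finToFun b i)

  average : ∀ {n} → (Fin n → Carrier) → Carrier
  average {n} f = sum f * fromℕ n ⁻¹

  average-cong : ∀ {n} {f g : Fin n → Carrier} → (∀ i → f i ≈ g i) → average f ≈ average g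
  average-cong e = *-congʳ (sum-cong-≋ e)

  average-const : ∀ n .{{_ : NonZero n}} x → average {n} (const x) ≈ x
  average-const n x = begin
    sum {n} (const x) * fromℕ n ⁻¹  ≈⟨ *-congʳ (sum-const n x) ⟩
    (fromℕ n * x) * fromℕ n ⁻¹      ≈⟨ solve 3 (λ n x y → (n :* x) :* y := (n :* y) :* x) refl _ _ _ ⟩
    (fromℕ n * fromℕ n ⁻¹) * x      ≈⟨ *-congʳ (*-⁻¹-cancel n) ⟩
    1# * x                          ≈⟨ *-identityˡ x ⟩
    x                               ∎
    where open SetoidReasoning setoid

  average-swap : ∀ m n (f : Fin m → Fin n → Carrier) →
    average (λ i → average (f i)) ≈ average (λ j → average λ i → f i j)
  average-swap m n f = begin
    sum (λ i → sum (f i) * fromℕ n ⁻¹) * fromℕ m ⁻¹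
      ≈⟨ *-congʳ (*-distribʳ-sum (fromℕ n ⁻¹) (λ i → sum (f i))) ⟨
    sum (λ i → sum (f i)) * fromℕ n ⁻¹ * fromℕ m ⁻¹
      ≈⟨ *-congʳ (*-congʳ (∑-comm f)) ⟩
    sum (λ j → sum λ i → f i j) * fromℕ n ⁻¹ * fromℕ m ⁻¹
      ≈⟨ solve 3 (λ a b c → (a :* b) :* c := (a :* c) :* b) refl _ _ _ ⟩
    sum (λ j → sum λ i → f i j) * fromℕ m ⁻¹ * fromℕ n ⁻¹
      ≈⟨ *-congʳ (*-distribʳ-sum (fromℕ m ⁻¹) (λ j → sum λ i → f i j)) ⟩
    sum (λ j → sum (λ i → f i j) * fromℕ m ⁻¹) * fromℕ n ⁻¹ ∎
    where open SetoidReasoning setoid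

  average-+ : ∀ {n} (f g : Fin n → Carrier) → average (λ i → f i + g i) ≈ average f + average g
  average-+ f g = trans (*-congʳ (∑-distrib-+ f g)) (distribʳ _ _ _)

  average-1- : ∀ n .{{_ : NonZero n}} (f : Fin n → Carrier) → average (λ i → 1# - f i) ≈ 1# - average f
  average-1- n f = begin
    average (λ i → 1# - f i)
      ≈⟨ solve 2 (λ x y → x := (x :+ y) :- y) refl _ (average f) ⟩
    (average (λ i → 1# - f i) + average f) - average f
      ≈⟨ +-congʳ (average-+ (λ i → 1# - f i) f) ⟨
    average (λ i → (1# - f i) + f i) - average f
      ≈⟨ +-congʳ (average-cong λ i → solve 2 (λ x y → (x :- y) :+ y := x) refl 1# (f i)) ⟩
    average {n} (const 1#) - average f
      ≈⟨ +-congʳ (average-const n 1#) ⟩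
    1# - average f ∎
    where open SetoidReasoning setoid

  average-× : ∀ m n .{{_ : NonZero m}} .{{_ : NonZero n}} (f : Fin m → Carrier) (g : Fin n → Carrier) →
    average {m ℕ.* n} (λ p → f (proj₁ (remQuot {m} n p)) * g (proj₂ (remQuot {m} n p))) ≈ average f * average g
  average-× m n f g = begin
    sum {m ℕ.* n} _ * fromℕ (m ℕ.* n) ⁻¹
      ≈⟨ *-cong (sum-combine m n _) (sym (⁻¹-unique inverse)) ⟩
    sum {m} (λ a → sum {n} λ b → h (remQuot {m} n (combine a b))) * (fromℕ m ⁻¹ * fromℕ n ⁻¹)
      ≈⟨ *-congʳ (sum-cong-≋ λ a → sum-cong-≋ λ b → reflexive (≡.cong h (Fin.remQuot-combine a b))) ⟩
    sum {m} (λ a → sum {n} λ b → f a * g b) * (fromℕ m ⁻¹ * fromℕ n ⁻¹)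
      ≈⟨ *-congʳ (sum-cong-≋ (λ a → trans (sum-cong-≋ λ b → *-comm (f a) (g b))
           (trans (sym (*-distribʳ-sum (f a) g)) (*-comm _ _)))) ⟩
    sum (λ a → f a * sum g) * (fromℕ m ⁻¹ * fromℕ n ⁻¹)
      ≈⟨ *-congʳ (*-distribʳ-sum (sum g) f) ⟨
    (sum f * sum g) * (fromℕ m ⁻¹ * fromℕ n ⁻¹)
      ≈⟨ solve 4 (λ a b c d → (a :* b) :* (c :* d) := (a :* c) :* (b :* d)) refl _ _ _ _ ⟩
    average f * average g ∎
    where
    open SetoidReasoning setoid
    h : Fin m × Fin n → Carrier
    h (a , b) = f a * g b
    inverse : fromℕ (m ℕ.* n) * (fromℕ m ⁻¹ * fromℕ n ⁻¹) ≈ 1#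
    inverse = begin
      fromℕ (m ℕ.* n) * (fromℕ m ⁻¹ * fromℕ n ⁻¹)
        ≈⟨ *-congʳ (fromℕ-* m n) ⟩
      (fromℕ m * fromℕ n) * (fromℕ m ⁻¹ * fromℕ n ⁻¹)
        ≈⟨ solve 4 (λ a b c d → (a :* b) :* (c :* d) := (a :* c) :* (b :* d)) refl _ _ _ _ ⟩
      (fromℕ m * fromℕ m ⁻¹) * (fromℕ n * fromℕ n ⁻¹)
        ≈⟨ *-cong (*-⁻¹-cancel m) (*-⁻¹-cancel n) ⟩
      1# * 1#  ≈⟨ *-identityˡ 1# ⟩
      1#       ∎

  -- The case of equal factors in `sum-of-products`; it is the source of the powers in the
  -- recurrence for `u`.
  average-^ : ∀ m n .{{_ : NonZero m}} (f : Fin m → Carrier) →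
    average {m ℕ.^ n} (λ τ → product {n} λ i → f (finToFun τ i)) ≈ average f ^ n
  average-^ m n f = begin
    sum {m ℕ.^ n} (λ τ → product {n} λ i → f (finToFun τ i)) * fromℕ (m ℕ.^ n) ⁻¹
      ≈⟨ *-cong (trans (sum-of-products n (const f)) (product-replicate n)) (sym (⁻¹-unique inverse)) ⟩
    sum f ^ n * (fromℕ m ⁻¹) ^ n
      ≈⟨ ^-distrib-* _ _ n ⟨
    average f ^ n ∎
    where
    open SetoidReasoning setoid
    inverse : fromℕ (m ℕ.^ n) * (fromℕ m ⁻¹) ^ n ≈ 1#
    inverse = begin
      fromℕ (m ℕ.^ n) * (fromℕ m ⁻¹) ^ n  ≈⟨ *-congʳ (fromℕ-^ m n) ⟩
      fromℕ m ^ n * (fromℕ m ⁻¹) ^ n      ≈⟨ ^-distrib-* _ _ n ⟨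
      (fromℕ m * fromℕ m ⁻¹) ^ n          ≈⟨ ^-congˡ n (*-⁻¹-cancel m) ⟩
      1# ^ n                              ≈⟨ 1^n≈1 n ⟩
      1#                                  ∎

-- Infima, roots, Borel sets and integrals of step functions.

module ClassicalAnalysis (em : Classical) (ℝ : RealNumbers) where
  open RealNumbers ℝ hiding (zero)
  open TotalOrder totalOrder using (antisym; total; ≤-respˡ-≈; ≤-respʳ-≈)
    renaming (refl to ≤-refl; trans to ≤-trans; reflexive to ≤-reflexive)
  open Analysis em ℝ
  open OrderedField ℝ
  open IntegerSolver commutativeRing
  open SemiringSum semiring using (sum; sum-cong-≋; *-distribˡ-sum; *-distribʳ-sum; ∑-comm)
  open MonoidSum *-commutativeMonoid using () renaming (sum to product)

  double-negation : ∀ {ℓ} {P : Set ℓ} → ¬ ¬ P → P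
  double-negation {P = P} ¬¬p with em {P = P}
  ... | yes p = p
  ... | no ¬p = ⊥-elim (¬¬p ¬p)

  ≰⇒≥ : ∀ {x y} → ¬ x ≤ y → y ≤ x
  ≰⇒≥ {x} {y} x≰y with total x y
  ... | inj₁ p = ⊥-elim (x≰y p)
  ... | inj₂ p = p

  the-satisfies : ∀ {a ℓ} {A : Set a} {default : A} {P : Pred A ℓ} → ∃ P → P (the default P)
  the-satisfies {P = P} e with em {P = ∃ P}
  ... | yes (_ , p) = p
  ... | no ¬e       = ⊥-elim (¬e e)

  -- Only suprema are postulated. The infimum is the supremum of the set of lower bounds, which any
  -- element of `S` bounds from above.
  inf-isGLB : ∀ {S : Pred Carrier 0ℓ} {b} → Satisfiable S → (∀ {x} → x ∈ S → b ≤ x) → IsGLB _≤_ S (inf S)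
  inf-isGLB {S} {b} (y , y∈S) b≤S with lub (λ z → ∀ {x} → x ∈ S → z ≤ x) (b , b≤S) (y , λ z≤S → z≤S y∈S)
  ... | s , above , least = the-satisfies {P = IsGLB _≤_ S} (s , (λ x∈S → least _ (λ z≤S → z≤S x∈S)) , λ z z≤S → above (λ {x} → z≤S {x}))

  sup-isLUB : ∀ {S : Pred Carrier 0ℓ} {b} → Satisfiable S → IsUpperBound _≤_ S b → IsLUB _≤_ S (sup S)
  sup-isLUB {S} ne bound = the-satisfies {P = IsLUB _≤_ S} (lub S ne (_ , bound))

  ^-cancel-≤ : ∀ {x y} → 0# ≤ x → 0# ≤ y → ∀ n → x ^ suc n ≤ y ^ suc n → x ≤ y
  ^-cancel-≤ {x} {y} 0≤x 0≤y n p = double-negation λ x≰y →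
    <⇒≱ (^-mono-< 0≤y (≰⇒≥ x≰y , λ y≈x → x≰y (≤-reflexive (sym y≈x))) n) p

  -- The set whose supremum defines `root` contains `y` and is bounded by `y`, so no existence
  -- theorem for roots enters.
  root-unique : ∀ n .{{_ : NonZero n}} {x y} → 0# ≤ y → x ≈ y ^ n → root n x ≈ y
  root-unique (suc n) {x} {y} 0≤y e = antisym (proj₂ isLUB y bound) (proj₁ isLUB (0≤y , ≤-reflexive (sym e)))
    where
    bound : IsUpperBound _≤_ (λ z → 0# ≤ z × z ^ suc n ≤ x) y
    bound (0≤z , p) = ^-cancel-≤ 0≤z 0≤y n (≤-respʳ-≈ e p)
    isLUB : IsLUB _≤_ (λ z → 0# ≤ z × z ^ suc n ≤ x) (root (suc n) x)
    isLUB = sup-isLUB (y , 0≤y , ≤-reflexive (sym e)) bound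

  𝟙 : Set → Carrier
  𝟙 P with em {P = P}
  ... | yes _ = 1#
  ... | no  _ = 0#

  𝟙-true : ∀ {P} → P → 𝟙 P ≡ 1#
  𝟙-true {P} p with em {P = P}
  ... | yes _ = ≡.refl
  ... | no ¬p = ⊥-elim (¬p p)

  𝟙-false : ∀ {P} → ¬ P → 𝟙 P ≡ 0#
  𝟙-false {P} ¬p with em {P = P}
  ... | yes p = ⊥-elim (¬p p)
  ... | no  _ = ≡.refl

  𝟙-cong : ∀ {P Q} → (P → Q) → (Q → P) → 𝟙 P ≡ 𝟙 Q
  𝟙-cong {P} f g with em {P = P}
  ... | yes p = ≡.sym (𝟙-true (f p))
  ... | no ¬p = ≡.sym (𝟙-false (¬p ∘ g))

  𝟙-nonNeg : ∀ {P} → 0# ≤ 𝟙 P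
  𝟙-nonNeg {P} with em {P = P}
  ... | yes _ = 0≤1
  ... | no  _ = ≤-refl

  𝟙-¬ : ∀ {P} → 𝟙 (¬ P) ≈ 1# - 𝟙 P
  𝟙-¬ {P} with em {P = P}
  ... | yes p = trans (reflexive (𝟙-false λ ¬p → ¬p p)) (sym (-‿inverseʳ 1#))
  ... | no ¬p = trans (reflexive (𝟙-true ¬p)) (solve 1 (λ x → x := x :- con (+ 0)) refl 1#)

  𝟙-× : ∀ {P Q} → 𝟙 (P × Q) ≈ 𝟙 P * 𝟙 Q
  𝟙-× {P} {Q} with em {P = P}
  ... | yes p = trans (reflexive (𝟙-cong proj₂ (p ,_))) (sym (*-identityˡ _))
  ... | no ¬p = trans (reflexive (𝟙-false (¬p ∘ proj₁))) (sym (zeroˡ _))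

  𝟙-∀ : ∀ {n} (P : Fin n → Set) → 𝟙 (∀ i → P i) ≈ product (λ i → 𝟙 (P i))
  𝟙-∀ {zero}  P = reflexive (𝟙-true λ ())
  𝟙-∀ {suc n} P = trans (reflexive (𝟙-cong (λ p → p zero , p ∘ suc)
      (λ { (p , ps) zero → p ; (p , ps) (suc i) → ps i })))
    (trans 𝟙-× (*-congˡ (𝟙-∀ (P ∘ suc))))

  sum-𝟙-≡ : ∀ {n} (j : Fin n) → sum (λ i → 𝟙 (i ≡ j)) ≈ 1#
  sum-𝟙-≡ {suc n} zero = trans (+-cong (reflexive (𝟙-true ≡.refl))
    (trans (sum-cong-≋ {n} λ i → reflexive (𝟙-false λ ())) (trans (sum-const n 0#) (zeroʳ _)))) (+-identityʳ 1#)
  sum-𝟙-≡ {suc n} (suc j) = trans (+-cong (reflexive (𝟙-false λ ()))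
    (trans (sum-cong-≋ {n} λ i → reflexive (𝟙-cong Fin.suc-injective (≡.cong suc))) (sum-𝟙-≡ j))) (+-identityˡ 1#)

  ≤∞-trans : ∀ {u v w} → u ≤∞ v → v ≤∞ w → u ≤∞ w
  ≤∞-trans = SupOrder.≤⁺-trans _≤_ ≤-trans

  ≤∞-reflexive : ∀ {u v} → u ≈∞ v → u ≤∞ v
  ≤∞-reflexive = SupOrder.≤⁺-reflexive _≤_ ≤-reflexive

  ≤∞-antisym : ∀ {u v} → u ≤∞ v → v ≤∞ u → u ≈∞ v
  ≤∞-antisym = SupOrder.≤⁺-antisym _≤_ antisym

  ≈∞-refl : ∀ {u} → u ≈∞ u
  ≈∞-refl = SupEq.≈⁺-refl _≈_ refl

  ≈∞-sym : ∀ {u v} → u ≈∞ v → v ≈∞ u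
  ≈∞-sym = SupEq.≈⁺-sym _≈_ sym

  ≈∞-trans : ∀ {u v w} → u ≈∞ v → v ≈∞ w → u ≈∞ w
  ≈∞-trans = SupEq.≈⁺-trans _≈_ trans

  [≈]-injective : ∀ {x y} → [ x ] ≈∞ [ y ] → x ≈ y
  [≈]-injective SupEq.[ e ] = e

  +∞-mono-≤ : ∀ {u u′ v v′} → u ≤∞ u′ → v ≤∞ v′ → u +∞ v ≤∞ u′ +∞ v′
  +∞-mono-≤ SupOrder.[ p ] SupOrder.[ q ]   = SupOrder.[ +-mono-≤ p q ]
  +∞-mono-≤ SupOrder.[ p ] (_ SupOrder.≤⊤⁺) = _ SupOrder.≤⊤⁺
  +∞-mono-≤ (_ SupOrder.≤⊤⁺) _              = _ SupOrder.≤⊤⁺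

  +∞-identityˡ : ∀ u → [ 0# ] +∞ u ≈∞ u
  +∞-identityˡ [ x ] = SupEq.[ +-identityˡ x ]
  +∞-identityˡ ⊤⁺    = SupEq.⊤⁺≈⊤⁺

  +∞-identityʳ : ∀ u → u +∞ [ 0# ] ≈∞ u
  +∞-identityʳ [ x ] = SupEq.[ +-identityʳ x ]
  +∞-identityʳ ⊤⁺    = SupEq.⊤⁺≈⊤⁺

  sup∞-≈ : ∀ {ℓ} {S : Pred ℝ∞ ℓ} {s} → IsLUB _≤∞_ S s → sup∞ S ≈∞ s
  sup∞-≈ {S = S} {s} (above , least) with the-satisfies {default = [ 0# ]} {P = IsLUB _≤∞_ S} (s , above , least)
  ... | above′ , least′ = ≤∞-antisym (least′ s above) (least _ above′)

  -- The value at `⊤⁺` is a dummy; `measure≡mass` shows that it does not occur for Borel subsets of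
  -- a set of finite measure.
  toℝ : ℝ∞ → Carrier
  toℝ [ x ] = x
  toℝ ⊤⁺    = 0#

  toℝ-cong : ∀ {u v} → u ≈∞ v → toℝ u ≈ toℝ v
  toℝ-cong SupEq.[ e ]    = e
  toℝ-cong SupEq.⊤⁺≈⊤⁺ = refl

  toℝ-nonNeg : ∀ {u} → [ 0# ] ≤∞ u → 0# ≤ toℝ u
  toℝ-nonNeg SupOrder.[ p ]      = p
  toℝ-nonNeg (_ SupOrder.≤⊤⁺) = ≤-refl

  module _ {X : Set} (dist : X → X → Carrier) where

    ∅-borel : Borel dist ∅
    ∅-borel = open-set λ ()

    ∪-borel : ∀ {A B} → Borel dist A → Borel dist B → Borel dist (A ∪ B)
    ∪-borel {A} {B} a b = respects (from , to) (union borel)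
      where
      pieces : ℕ → Pred X 0ℓ
      pieces zero    = A
      pieces (suc _) = B
      borel : ∀ i → Borel dist (pieces i)
      borel zero    = a
      borel (suc _) = b
      from : ⋃ ℕ pieces ⊆ A ∪ B
      from (zero , x∈A)  = inj₁ x∈A
      from (suc _ , x∈B) = inj₂ x∈B
      to : A ∪ B ⊆ ⋃ ℕ pieces
      to (inj₁ x∈A) = 0 , x∈A
      to (inj₂ x∈B) = 1 , x∈B

    ∩-borel : ∀ {A B} → Borel dist A → Borel dist B → Borel dist (A ∩ B)
    ∩-borel a b = respects
      ( (λ h → double-negation (h ∘ inj₁) , double-negation (h ∘ inj₂))
      , (λ { (x∈A , x∈B) (inj₁ x∉A) → x∉A x∈A ; (x∈A , x∈B) (inj₂ x∉B) → x∉B x∈B }))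
      (complement (∪-borel (complement a) (complement b)))

    ⋃-borel : ∀ {n} {A : Fin n → Pred X 0ℓ} → (∀ i → Borel dist (A i)) → Borel dist (⋃ (Fin n) A)
    ⋃-borel {zero}  a = respects ((λ ()) , λ ()) ∅-borel
    ⋃-borel {suc n} a = respects
      ( (λ { (inj₁ x∈A) → zero , x∈A ; (inj₂ (i , x∈A)) → suc i , x∈A })
      , (λ { (zero , x∈A) → inj₁ x∈A ; (suc i , x∈A) → inj₂ (i , x∈A) }))
      (∪-borel (a zero) (⋃-borel (a ∘ suc)))

    module _ (μ : BorelMeasure dist) where
      open BorelMeasure μ renaming (cong to measure-cong)

      -- Countable additivity for the sequence A, B, ∅, ∅, ..., whose partial sums do not change
      -- after the second term, so that their supremum is a sum of two measures.
      measure-∪ : ∀ {A B} → Borel dist A → Borel dist B → A ⊥ B →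
                  measure (A ∪ B) ≈∞ measure A +∞ measure B
      measure-∪ {A} {B} a b A⊥B = ≈∞-trans
        (measure-cong (∪-borel a b)
          ( (λ { (inj₁ x∈A) → 0 , x∈A ; (inj₂ x∈B) → 1 , x∈B })
          , (λ { (0 , x∈A) → inj₁ x∈A ; (1 , x∈B) → inj₂ x∈B ; (suc (suc _) , ()) })))
        (≤∞-antisym
          (proj₂ isLUB _ λ { (n , ≡.refl) → bound n })
          (≤∞-trans
            (+∞-mono-≤ (≤∞-reflexive (≈∞-sym (+∞-identityˡ _))) (≤∞-reflexive ≈∞-refl))
            (proj₁ isLUB (2 , ≡.refl))))
        where
        pieces : ℕ → Pred X 0ℓ
        pieces 0 = A
        pieces 1 = B
        pieces (suc (suc _)) = ∅
        borel : ∀ i → Borel dist (pieces i)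
        borel 0 = a
        borel 1 = b
        borel (suc (suc _)) = ∅-borel
        disjoint : ∀ i j → i ≢ j → pieces i ⊥ pieces j
        disjoint 0 0 i≢j = ⊥-elim (i≢j ≡.refl)
        disjoint 0 1 _ = A⊥B
        disjoint 1 0 _ (x∈B , x∈A) = A⊥B (x∈A , x∈B)
        disjoint 1 1 i≢j = ⊥-elim (i≢j ≡.refl)
        disjoint 0 (suc (suc _)) _ ()
        disjoint 1 (suc (suc _)) _ ()
        disjoint (suc (suc _)) _ _ ()
        isLUB : IsLUB _≤∞_ (λ s → ∃[ n ] s ≡ partialSum (λ i → measure (pieces i)) n) (measure (⋃ ℕ pieces))
        isLUB = σ-additive borel disjoint
        bound : ∀ n → partialSum (λ i → measure (pieces i)) n ≤∞ measure A +∞ measure B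
        bound 0 = ≤∞-trans (≤∞-reflexive (≈∞-sym (+∞-identityˡ _))) (+∞-mono-≤ (nonNeg a) (nonNeg b))
        bound 1 = ≤∞-trans (≤∞-reflexive (+∞-identityˡ _))
          (≤∞-trans (≤∞-reflexive (≈∞-sym (+∞-identityʳ _)))
            (+∞-mono-≤ (≤∞-reflexive ≈∞-refl) (nonNeg b)))
        bound 2 = +∞-mono-≤ (≤∞-reflexive (+∞-identityˡ _)) (≤∞-reflexive ≈∞-refl)
        bound (suc (suc (suc n))) = ≤∞-trans
          (+∞-mono-≤ (bound (suc (suc n))) (≤∞-reflexive empty)) (≤∞-reflexive (+∞-identityʳ _))

      module FiniteMass {C : Pred X 0ℓ} (C-borel : Borel dist C) {c} (C-mass : measure C ≈∞ [ c ]) where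

        mass : Pred X 0ℓ → Carrier
        mass A = toℝ (measure A)

        -- If `measure A` were `⊤⁺`, adding the measure of `C ∩ ∁ A` would make `measure C` infinite
        -- as well. No constructor relates `[ c ]` to `⊤⁺`, so that case is absent.
        measure≡mass : ∀ {A} → Borel dist A → A ⊆ C → measure A ≡ [ mass A ]
        measure≡mass {A} a A⊆C with measure A | ≈∞-trans (≈∞-sym C-mass) (≈∞-trans
          (measure-cong C-borel (split , [ A⊆C , proj₁ ]′))
          (measure-∪ a (∩-borel C-borel (complement a)) (λ { (x∈A , _ , x∉A) → x∉A x∈A })))
          where
          split : C ⊆ A ∪ (C ∩ ∁ A)
          split {x} x∈C with em {P = x ∈ A}
          ... | yes x∈A = inj₁ x∈A
          ... | no  x∉A = inj₂ (x∈C , x∉A)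
        ... | [ _ ] | _ = ≡.refl

        measure≈mass : ∀ {A} → Borel dist A → A ⊆ C → measure A ≈∞ [ mass A ]
        measure≈mass {A} a A⊆C = ≡.subst (measure A ≈∞_) (measure≡mass a A⊆C) ≈∞-refl

        mass-cong : ∀ {A B} → Borel dist A → A ≐ B → mass A ≈ mass B
        mass-cong a A≐B = toℝ-cong (measure-cong a A≐B)

        mass-nonNeg : ∀ {A} → Borel dist A → 0# ≤ mass A
        mass-nonNeg a = toℝ-nonNeg (nonNeg a)

        mass-∅ : mass ∅ ≈ 0#
        mass-∅ = toℝ-cong empty

        mass-∪ : ∀ {A B} → Borel dist A → Borel dist B → A ⊆ C → B ⊆ C → A ⊥ B →
                 mass (A ∪ B) ≈ mass A + mass B
        mass-∪ {A} {B} a b A⊆C B⊆C A⊥B = [≈]-injective (≈∞-trans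
          (≈∞-sym (measure≈mass (∪-borel a b) [ A⊆C , B⊆C ]′))
          (≡.subst₂ (λ u v → measure (A ∪ B) ≈∞ u +∞ v) (measure≡mass a A⊆C) (measure≡mass b B⊆C) (measure-∪ a b A⊥B)))

        mass-⋃ : ∀ {n} {A : Fin n → Pred X 0ℓ} → (∀ i → Borel dist (A i)) → (∀ i → A i ⊆ C) →
                 (∀ {i j x} → x ∈ A i → x ∈ A j → i ≡ j) → mass (⋃ (Fin n) A) ≈ sum (λ i → mass (A i))
        mass-⋃ {zero}  a A⊆C disjoint =
          trans (mass-cong (⋃-borel a) ((λ ()) , λ ())) mass-∅
        mass-⋃ {suc n} {A} a A⊆C disjoint = trans
          (mass-cong (⋃-borel a)
            ( (λ { (zero , x∈A) → inj₁ x∈A ; (suc i , x∈A) → inj₂ (i , x∈A) })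
            , (λ { (inj₁ x∈A) → zero , x∈A ; (inj₂ (i , x∈A)) → suc i , x∈A })))
          (trans
            (mass-∪ (a zero) (⋃-borel (a ∘ suc)) (A⊆C zero) (λ { (i , x∈A) → A⊆C (suc i) x∈A })
              (λ { (x∈A , i , x∈A′) → contradiction (disjoint x∈A x∈A′) λ () }))
            (+-congˡ (mass-⋃ (a ∘ suc) (A⊆C ∘ suc) (λ p q → Fin.suc-injective (disjoint p q)))))

        mass-mono : ∀ {A B} → Borel dist A → Borel dist B → A ⊆ B → B ⊆ C → mass A ≤ mass B
        mass-mono {A} {B} a b A⊆B B⊆C = ≤-respʳ-≈
          (sym (trans (mass-cong b (split , [ A⊆B , proj₁ ]′))
            (mass-∪ a (∩-borel b (complement a)) (B⊆C ∘ A⊆B) (B⊆C ∘ proj₁) λ { (x∈A , _ , x∉A) → x∉A x∈A })))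
          (x≤x+y (mass-nonNeg (∩-borel b (complement a))))
          where
          split : B ⊆ A ∪ (B ∩ ∁ A)
          split {x} x∈B with em {P = x ∈ A}
          ... | yes x∈A = inj₁ x∈A
          ... | no  x∉A = inj₂ (x∈B , x∉A)

      module _ {c} (U-borel : Borel dist U) (U-mass : measure U ≈∞ [ c ]) where
        open FiniteMass U-borel U-mass
        open SimpleFunction

        simpleIntegral-≡ : (s : SimpleFunction dist) →
          simpleIntegral dist μ s ≡ [ sum (λ i → value s i * mass (piece s i)) ]
        simpleIntegral-≡ s = go (value s) (piece s) (borel s)
          where
          go : ∀ {n} (v : Fin n → Carrier) (A : Fin n → Pred X 0ℓ) → (∀ i → Borel dist (A i)) →
               foldr _+∞_ [ 0# ] (λ i → scale dist μ (v i) (measure (A i))) ≡ [ sum (λ i → v i * mass (A i)) ]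
          go {zero}  v A a = ≡.refl
          go {suc n} v A a = ≡.cong₂ _+∞_
            (≡.cong (scale dist μ (v zero)) (measure≡mass (a zero) _))
            (go (v ∘ suc) (A ∘ suc) (a ∘ suc))

        -- The partition is itself a simple function below `g`; simple functions have positive
        -- values, whence `0# < v i`. Any other simple function below `g` is cut along the cells: on
        -- a nonempty part its value is at most `v i`, and the parts inside one cell are disjoint,
        -- so their masses add up to at most that of the cell.
        ∫-cells : ∀ {n} {cell : Fin n → Pred X 0ℓ} → (∀ i → Borel dist (cell i)) →
          (∀ {i j x} → x ∈ cell i → x ∈ cell j → i ≡ j) → (∀ x → ∃[ i ] x ∈ cell i) →
          (v : Fin n → Carrier) → (∀ i → 0# < v i) →
          (g : X → ℝ∞) → (∀ {i x} → x ∈ cell i → g x ≈∞ [ v i ]) →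
          ∫ dist μ g ≈∞ [ sum (λ i → v i * mass (cell i)) ]
        ∫-cells {n} {cell} cell-borel cell-disjoint cover v 0<v g g≈v = sup∞-≈ (above , least)
          where
          s₀ : SimpleFunction dist
          s₀ = record
            { size = n ; value = v ; positive = 0<v ; piece = cell ; borel = cell-borel
            ; disjoint = λ i j i≢j (p , q) → i≢j (cell-disjoint p q) }

          S : Pred ℝ∞ _
          S w = ∃[ s ] (∀ i {x} → x ∈ piece s i → [ value s i ] ≤∞ g x) × w ≡ simpleIntegral dist μ s

          least : ∀ b → IsUpperBound _≤∞_ S b → [ sum (λ i → v i * mass (cell i)) ] ≤∞ b
          least b bound = ≡.subst (_≤∞ b) (simpleIntegral-≡ s₀)
            (bound (s₀ , (λ i p → ≤∞-reflexive (≈∞-sym (g≈v p))) , ≡.refl))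

          module _ (s : SimpleFunction dist) (s≤g : ∀ i {x} → x ∈ piece s i → [ value s i ] ≤∞ g x) where
            part : Fin (size s) → Fin n → Pred X 0ℓ
            part k i = piece s k ∩ cell i

            part-borel : ∀ k i → Borel dist (part k i)
            part-borel k i = ∩-borel (borel s k) (cell-borel i)

            piece-mass : ∀ k → mass (piece s k) ≈ sum (λ i → mass (part k i))
            piece-mass k = trans
              (mass-cong (borel s k)
                ( (λ {x} p → proj₁ (cover x) , p , proj₂ (cover x)) , (λ (_ , p , _) → p)))
              (mass-⋃ (part-borel k) _ (λ (_ , p) (_ , q) → cell-disjoint p q))

            part-bound : ∀ k i → value s k * mass (part k i) ≤ v i * mass (part k i)
            -- The two values can be compared only at a point of the part; an empty part has mass 0,
            -- and both sides vanish.
            part-bound k i with em {P = ∃ (part k i)}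
            ... | yes (x , p , q) = *-monoʳ-≤ _ (mass-nonNeg (part-borel k i))
                  (SupOrder.[≤]-injective _≤_ (≤∞-trans (s≤g k p) (≤∞-reflexive (g≈v q))))
            ... | no none = ≤-reflexive (trans (*-congˡ null) (trans (zeroʳ _) (sym (trans (*-congˡ null) (zeroʳ _)))))
              where
              null : mass (part k i) ≈ 0#
              null = trans (mass-cong (part-borel k i) ((λ {x} p → none (x , p)) , λ ())) mass-∅

            disjoint-pieces : ∀ {k l x} → x ∈ piece s k → x ∈ piece s l → k ≡ l
            disjoint-pieces {k} {l} p q with k Fin.≟ l
            ... | yes e = e
            ... | no k≢l = ⊥-elim (disjoint s k l k≢l (p , q))

            cell-bound : ∀ i → sum (λ k → mass (part k i)) ≤ mass (cell i)
            cell-bound i = ≤-respˡ-≈ (mass-⋃ (λ k → part-borel k i) _ (λ (p , _) (q , _) → disjoint-pieces p q))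
              (mass-mono (⋃-borel λ k → part-borel k i) (cell-borel i) (λ (_ , _ , q) → q) _)

            sum-bound : sum (λ k → value s k * mass (piece s k)) ≤ sum (λ i → v i * mass (cell i))
            sum-bound = ≤-trans (≤-reflexive (sum-cong-≋ λ k →
                trans (*-congˡ (piece-mass k)) (*-distribˡ-sum (value s k) (λ i → mass (part k i)))))
              (≤-trans (sum-mono _ _ λ k → sum-mono _ _ λ i → part-bound k i)
              (≤-trans (≤-reflexive (trans (∑-comm λ k i → v i * mass (part k i))
                (sum-cong-≋ λ i → sym (*-distribˡ-sum (v i) (λ k → mass (part k i))))))
              (sum-mono _ _ λ i → *-monoˡ-≤ (v i) (proj₁ (0<v i)) (cell-bound i))))

          above : IsUpperBound _≤∞_ S [ sum (λ i → v i * mass (cell i)) ]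
          above (s , s≤g , ≡.refl) = ≡.subst (_≤∞ _) (≡.sym (simpleIntegral-≡ s)) SupOrder.[ sum-bound s s≤g ]

  -- Haar measure of a finite union of cosets of an open subgroup.

  module Cosets
    {G : Group 0ℓ 0ℓ} {dist : Group.Carrier G → Group.Carrier G → Carrier} {C : Pred (Group.Carrier G) 0ℓ}
    (H : HaarMeasure G dist C)
    {_~_ : Rel (Group.Carrier G) 0ℓ} (~-isEquivalence : IsEquivalence _~_)
    (~-reflexive : ∀ x y → Group._≈_ G x y → x ~ y)
    (~-translate : ∀ g x y → x ~ y → (Group._∙_ G g x) ~ (Group._∙_ G g y))
    {ε} (0<ε : 0# < ε) (near : ∀ x y → dist x y < ε → x ~ y)
    (C-saturated : ∀ {x y} → x ~ y → x ∈ C → y ∈ C)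
    {n} (rep : Fin n → Group.Carrier G) (rep∈C : ∀ i → rep i ∈ C)
    (rep-distinct : ∀ {i j} → rep i ~ rep j → i ≡ j)
    (rep-covers : ∀ x → x ∈ C → ∃[ i ] x ~ rep i)
    where
    open Group G using (_∙_) renaming (Carrier to |G|)
    private
      module G = Group G
      module ~ = IsEquivalence ~-isEquivalence
    open HaarMeasure H using (borelMeasure; measure; invariant; normalized)

    Saturated : Pred |G| 0ℓ → Set
    Saturated A = ∀ {x y} → x ~ y → x ∈ A → y ∈ A

    -- A class contains the ball of radius `ε` about each of its points, so saturated sets are open.
    -- The neighbourhoods `N[ n ] f` and the events of hitting a point turn out to be of this kind.
    saturated-borel : ∀ {A} → Saturated A → Borel dist A
    saturated-borel sat = open-set λ x∈A → ε , 0<ε , λ d → sat (near _ _ d) x∈A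

    cell : Fin n → Pred |G| 0ℓ
    cell i x = x ~ rep i

    cell-borel : ∀ i → Borel dist (cell i)
    cell-borel i = saturated-borel λ e p → ~.trans (~.sym e) p

    cell⊆C : ∀ i → cell i ⊆ C
    cell⊆C i p = C-saturated (~.sym p) (rep∈C i)

    cell-disjoint : ∀ {i j x} → x ∈ cell i → x ∈ cell j → i ≡ j
    cell-disjoint p q = rep-distinct (~.trans (~.sym p) q)

    open FiniteMass dist borelMeasure (saturated-borel C-saturated) normalized public

    translate-measure : ∀ g {A} → Saturated A → measure (λ x → (g ∙ x) ∈ A) ≈∞ measure A
    translate-measure g sat = invariant g (saturated-borel sat)

    -- The preimage of one class under translation by `rep i ∙ rep j ⁻¹` is the other.
    cells-equal : ∀ i j → mass (cell i) ≈ mass (cell j)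
    cells-equal i j = [≈]-injective (≈∞-trans (≈∞-sym (measure≈mass (cell-borel i) (cell⊆C i)))
      (≈∞-trans (≈∞-sym (translate-measure g (λ e p → ~.trans (~.sym e) p)))
      (≈∞-trans (BorelMeasure.cong borelMeasure (saturated-borel λ e p → ~.trans (~-translate g _ _ (~.sym e)) p) (to , from))
        (measure≈mass (cell-borel j) (cell⊆C j)))))
      where
      g : |G|
      g = rep i ∙ rep j G.⁻¹
      g∙repj : (g ∙ rep j) G.≈ rep i
      g∙repj = G.trans (G.assoc _ _ _) (G.trans (G.∙-congˡ (G.inverseˡ _)) (G.identityʳ _))
      cancel : ∀ x → (g G.⁻¹ ∙ (g ∙ x)) G.≈ x
      cancel x = G.trans (G.sym (G.assoc _ _ _)) (G.trans (G.∙-congʳ (G.inverseˡ g)) (G.identityˡ x))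
      to : ∀ {x} → (g ∙ x) ~ rep i → x ~ rep j
      to {x} p = ~.trans (~-reflexive _ _ (G.sym (cancel x)))
        (~.trans (~-translate (g G.⁻¹) _ _ (~.trans p (~-reflexive _ _ (G.sym g∙repj)))) (~-reflexive _ _ (cancel _)))
      from : ∀ {x} → x ~ rep j → (g ∙ x) ~ rep i
      from p = ~.trans (~-translate g _ _ p) (~-reflexive _ _ g∙repj)

    cell-mass : ∀ i → mass (cell i) ≈ fromℕ n ⁻¹
    cell-mass i = ⁻¹-unique (begin
      fromℕ n * mass (cell i)            ≈⟨ sum-const n _ ⟨
      sum {n} (λ _ → mass (cell i))      ≈⟨ sum-cong-≋ (cells-equal i) ⟩
      sum (λ j → mass (cell j))          ≈⟨ mass-⋃ cell-borel cell⊆C cell-disjoint ⟨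
      mass (⋃ (Fin n) cell)              ≈⟨ mass-cong (⋃-borel dist cell-borel) ((λ (j , p) → cell⊆C j p) , rep-covers _) ⟩
      mass C                             ≈⟨ [≈]-injective (≈∞-trans (≈∞-sym (measure≈mass (saturated-borel C-saturated) id)) normalized) ⟩
      1#                                 ∎)
      where open SetoidReasoning setoid

    saturated-mass : ∀ {A} → Saturated A → A ⊆ C → mass A ≈ average (λ i → 𝟙 (rep i ∈ A))
    saturated-mass {A} sat A⊆C = begin
      mass A
        ≈⟨ mass-cong (saturated-borel sat)
             ( (λ x∈A → let (i , p) = rep-covers _ (A⊆C x∈A) in i , x∈A , p) , (λ (_ , x∈A , _) → x∈A)) ⟩
      mass (⋃ (Fin n) (λ i → A ∩ cell i))
        ≈⟨ mass-⋃ part-borel (λ i → A⊆C ∘ proj₁) (λ (_ , p) (_ , q) → cell-disjoint p q) ⟩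
      sum (λ i → mass (A ∩ cell i))
        ≈⟨ sum-cong-≋ part-mass ⟩
      sum (λ i → 𝟙 (rep i ∈ A) * fromℕ n ⁻¹)
        ≈⟨ *-distribʳ-sum (fromℕ n ⁻¹) (λ i → 𝟙 (rep i ∈ A)) ⟨
      average (λ i → 𝟙 (rep i ∈ A)) ∎
      where
      open SetoidReasoning setoid
      part-borel : ∀ i → Borel dist (A ∩ cell i)
      part-borel i = ∩-borel dist (saturated-borel sat) (cell-borel i)
      part-mass : ∀ i → mass (A ∩ cell i) ≈ 𝟙 (rep i ∈ A) * fromℕ n ⁻¹
      part-mass i with em {P = rep i ∈ A}
      ... | yes r∈A = trans (mass-cong (part-borel i) (proj₂ , λ p → sat (~.sym p) r∈A , p))
                        (trans (cell-mass i) (sym (*-identityˡ _)))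
      ... | no  r∉A = trans (mass-cong (part-borel i) ((λ (x∈A , p) → r∉A (sat p x∈A)) , λ ()))
                        (trans mass-∅ (sym (zeroˡ _)))

-- Powers of the maximal ideal and residue digits.

funToFin-cong : ∀ {m n} {f g : Fin m → Fin n} → (∀ i → f i ≡ g i) → funToFin f ≡ funToFin g
funToFin-cong {zero}  e = ≡.refl
funToFin-cong {suc m} e = ≡.cong₂ combine (e zero) (funToFin-cong (e ∘ suc))

finToFun-injective : ∀ {m n} {i j : Fin (n ℕ.^ m)} → (∀ k → finToFun {n} {m} i k ≡ finToFun j k) → i ≡ j
finToFun-injective {m} {n} {i} {j} e = ≡.trans (≡.sym (Fin.funToFin-finToFin {m} {n} i))
  (≡.trans (funToFin-cong e) (Fin.funToFin-finToFin {m} {n} j))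

module LocalFieldProperties (em : Classical) (K : LocalField) where
  open LocalField K hiding (zero)
  open IntegerSolver commutativeRing
  open AbelianGroupProperties +-abelianGroup using (x∙y⁻¹≈ε⇒x≈y)

  infix 9 𝔪^_
  -- Given by the valuation rather than as multiples of πⁿ, so that `𝔪^ 0` is `R` definitionally and
  -- integrality proofs serve as congruences at level 0.
  𝔪^_ : ℕ → Pred Carrier 0ℓ
  (𝔪^ n) x = [ + n ] ℤ∞.≤ val x

  module _ {n : ℕ} where

    𝔪^-cong : ∀ {x y} → x ≈ y → x ∈ 𝔪^ n → y ∈ 𝔪^ n
    𝔪^-cong x≈y = ≡.subst ([ + n ] ℤ∞.≤_) (val-cong x≈y)

    𝔪^-0 : 0# ∈ 𝔪^ n
    𝔪^-0 = ≡.subst ([ + n ] ℤ∞.≤_) (≡.sym val-0) (_ SupOrder.≤⊤⁺)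

    𝔪^-≈0 : ∀ {x} → x ≈ 0# → x ∈ 𝔪^ n
    𝔪^-≈0 e = 𝔪^-cong (sym e) 𝔪^-0

    𝔪^-+ : ∀ {x y} → x ∈ 𝔪^ n → y ∈ 𝔪^ n → x + y ∈ 𝔪^ n
    𝔪^-+ {x} {y} p q = ℤ∞.≤-trans (⊓-glb (val x) (val y) p q) (val-+ x y)

    𝔪^-neg : ∀ {x} → x ∈ 𝔪^ n → - x ∈ 𝔪^ n
    𝔪^-neg {x} = ≡.subst ([ + n ] ℤ∞.≤_) (≡.sym (val-neg x))

    𝔪^-- : ∀ {x y} → x ∈ 𝔪^ n → y ∈ 𝔪^ n → x - y ∈ 𝔪^ n
    𝔪^-- p q = 𝔪^-+ p (𝔪^-neg q)

    𝔪^-* : ∀ {x r} → x ∈ 𝔪^ n → r ∈ R → x * r ∈ 𝔪^ n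
    𝔪^-* {x} {r} p q = ≡.subst ([ + n ] ℤ∞.≤_) (≡.sym (val-* x r)) (add p q)
      where
      add : ∀ {u v} → [ + n ] ℤ∞.≤ u → [ + 0 ] ℤ∞.≤ v → [ + n ] ℤ∞.≤ u ℤ∞.+ v
      add {[ k ]} {[ l ]} SupOrder.[ a ] SupOrder.[ b ] =
        SupOrder.[ ≡.subst (ℤ._≤ k ℤ.+ l) (ℤ.+-identityʳ (+ n)) (ℤ.+-mono-≤ a b) ]
      add {[ k ]} {⊤⁺}    _ _ = _ SupOrder.≤⊤⁺
      add {⊤⁺}            _ _ = _ SupOrder.≤⊤⁺

    𝔪^-*ˡ : ∀ {r x} → r ∈ R → x ∈ 𝔪^ n → r * x ∈ 𝔪^ n
    𝔪^-*ˡ q p = 𝔪^-cong (*-comm _ _) (𝔪^-* p q)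

    π*-𝔪^ : ∀ {x} → x ∈ 𝔪^ n → π * x ∈ 𝔪^ suc n
    π*-𝔪^ {x} p = ≡.subst ([ + suc n ] ℤ∞.≤_) (≡.sym (≡.trans (val-* π x) (≡.cong (ℤ∞._+ val x) val-π))) (add p)
      where
      add : ∀ {v} → [ + n ] ℤ∞.≤ v → [ + suc n ] ℤ∞.≤ [ + 1 ] ℤ∞.+ v
      add SupOrder.[ a ]        = SupOrder.[ ℤ.+-monoʳ-≤ (+ 1) a ]
      add (_ SupOrder.≤⊤⁺)      = _ SupOrder.≤⊤⁺

    π*-𝔪^⁻ : ∀ {x} → π * x ∈ 𝔪^ suc n → x ∈ 𝔪^ n
    π*-𝔪^⁻ {x} p = cancel (≡.subst ([ + suc n ] ℤ∞.≤_) (≡.trans (val-* π x) (≡.cong (ℤ∞._+ val x) val-π)) p)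
      where
      cancel : ∀ {v} → [ + suc n ] ℤ∞.≤ [ + 1 ] ℤ∞.+ v → [ + n ] ℤ∞.≤ v
      cancel {[ k ]} SupOrder.[ a ] = SupOrder.[ ≡.subst₂ ℤ._≤_ (ℤ.pred-suc (+ n)) (ℤ.pred-suc k) (ℤ.pred-mono a) ]
      cancel {⊤⁺} _ = _ SupOrder.≤⊤⁺

    𝔪^-weaken : ∀ {x} → x ∈ 𝔪^ suc n → x ∈ 𝔪^ 1
    𝔪^-weaken = ℤ∞.≤-trans SupOrder.[ ℤ.+≤+ (ℕ.s≤s ℕ.z≤n) ]

    𝔪^⊆R : ∀ {x} → x ∈ 𝔪^ n → x ∈ R
    𝔪^⊆R = ℤ∞.≤-trans SupOrder.[ ℤ.+≤+ ℕ.z≤n ]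

    𝔪^-trans : ∀ {x y z} → x - y ∈ 𝔪^ n → y - z ∈ 𝔪^ n → x - z ∈ 𝔪^ n
    𝔪^-trans {x} {y} {z} p q =
      𝔪^-cong (solve 3 (λ x y z → (x :- y) :+ (y :- z) := x :- z) refl x y z) (𝔪^-+ p q)

    𝔪^-sym : ∀ {x y} → x - y ∈ 𝔪^ n → y - x ∈ 𝔪^ n
    𝔪^-sym {x} {y} p = 𝔪^-cong (solve 2 (λ x y → :- (x :- y) := y :- x) refl x y) (𝔪^-neg p)

    𝔪^-refl : ∀ {x y} → x ≈ y → x - y ∈ 𝔪^ n
    𝔪^-refl {x} {y} e = 𝔪^-≈0 (trans (+-congʳ e) (-‿inverseʳ y))

    𝔪^-resp : ∀ {x y} → x - y ∈ 𝔪^ n → y ∈ 𝔪^ n → x ∈ 𝔪^ n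
    𝔪^-resp {x} {y} p q = 𝔪^-cong (solve 2 (λ x y → (x :- y) :+ y := x) refl x y) (𝔪^-+ p q)

    𝔪^-cong₂ : ∀ {x x′ y y′} → x ≈ x′ → y ≈ y′ → x - y ∈ 𝔪^ n → x′ - y′ ∈ 𝔪^ n
    𝔪^-cong₂ e e′ = 𝔪^-cong (+-cong e (-‿cong e′))

    𝔪^-+-cong : ∀ {x x′ y y′} → x - x′ ∈ 𝔪^ n → y - y′ ∈ 𝔪^ n → (x + y) - (x′ + y′) ∈ 𝔪^ n
    𝔪^-+-cong {x} {x′} {y} {y′} p q = 𝔪^-cong
      (solve 4 (λ x x′ y y′ → (x :- x′) :+ (y :- y′) := (x :+ y) :- (x′ :+ y′)) refl x x′ y y′) (𝔪^-+ p q)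

    𝔪^---cong : ∀ {x x′ y y′} → x - x′ ∈ 𝔪^ n → y - y′ ∈ 𝔪^ n → (x - y) - (x′ - y′) ∈ 𝔪^ n
    𝔪^---cong {x} {x′} {y} {y′} p q = 𝔪^-cong
      (solve 4 (λ x x′ y y′ → (x :- x′) :- (y :- y′) := (x :- y) :- (x′ :- y′)) refl x x′ y y′) (𝔪^-- p q)

    𝔪^-*-cong : ∀ {x x′ y y′} → x′ ∈ R → y ∈ R → x - x′ ∈ 𝔪^ n → y - y′ ∈ 𝔪^ n → x * y - x′ * y′ ∈ 𝔪^ n
    𝔪^-*-cong {x} {x′} {y} {y′} x′∈R y∈R p q = 𝔪^-cong
      (solve 4 (λ x x′ y y′ → (x :- x′) :* y :+ x′ :* (y :- y′) := x :* y :- x′ :* y′) refl x x′ y y′)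
      (𝔪^-+ (𝔪^-* p y∈R) (𝔪^-*ˡ x′∈R q))

  1∉𝔪^1 : 1# ∉ 𝔪^ 1
  1∉𝔪^1 p with val 1# | val-1 | p
  ... | _ | ≡.refl | SupOrder.[ ℤ.+≤+ () ]

  -- A nonzero element has a finite valuation k and so lies outside `𝔪^ suc k`. Only positive levels
  -- are asked for, since the comparison of canonical representatives provides only those.
  separated : ∀ {x} → (∀ n → x ∈ 𝔪^ suc n) → x ≈ 0#
  separated {x} p with em {P = x ≈ 0#}
  ... | yes e = e
  ... | no  x≉0 = ⊥-elim (finite (val x) (val-≢⊤ x≉0) p)
    where
    finite : ∀ v → v ≢ ⊤⁺ → ¬ (∀ n → [ + suc n ] ℤ∞.≤ v)
    finite ⊤⁺         v≢⊤ _ = v≢⊤ ≡.refl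
    finite [ + k ]    _ p with p k
    ... | SupOrder.[ ℤ.+≤+ k<k ] = ℕ.<-irrefl ≡.refl k<k
    finite [ -[1+ k ] ] _ p with p 0
    ... | SupOrder.[ () ]

  separated-≈ : ∀ {x y} → (∀ n → x - y ∈ 𝔪^ suc n) → x ≈ y
  separated-≈ {x} {y} p = x∙y⁻¹≈ε⇒x≈y x y (separated p)

  π≉0 : ¬ π ≈ 0#
  π≉0 e with ≡.trans (≡.sym val-π) (≡.trans (val-cong e) val-0)
  ... | ()

  infix 8 _/π
  _/π : Carrier → Carrier
  x /π = x * π ⁻¹

  π*/π : ∀ x → π * x /π ≈ x
  π*/π x = trans (solve 3 (λ p p′ x → p :* (x :* p′) := (p :* p′) :* x) refl π (π ⁻¹) x)
    (trans (*-congʳ (inverseʳ π π≉0)) (*-identityˡ x))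

  /π-𝔪^ : ∀ {n x} → x ∈ 𝔪^ suc n → x /π ∈ 𝔪^ n
  /π-𝔪^ {x = x} p = π*-𝔪^⁻ (𝔪^-cong (sym (π*/π x)) p)

  /π--𝔪^ : ∀ {n x y} → x - y ∈ 𝔪^ suc n → x /π - y /π ∈ 𝔪^ n
  /π--𝔪^ {x = x} {y} p = 𝔪^-cong
    (solve 3 (λ x y p → (x :- y) :* p := x :* p :- y :* p) refl x y (π ⁻¹)) (/π-𝔪^ p)

  π*--𝔪^ : ∀ {n x y} → x - y ∈ 𝔪^ n → π * x - π * y ∈ 𝔪^ suc n
  π*--𝔪^ {x = x} {y} p = 𝔪^-cong (solve 3 (λ x y p → p :* (x :- y) := p :* x :- p :* y) refl x y π) (π*-𝔪^ p)

  /π-unique : ∀ {x y} → x ≈ π * y → x /π ≈ y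
  /π-unique {x} {y} e = trans (*-congʳ e)
    (trans (solve 3 (λ p p′ y → (p :* y) :* p′ := (p :* p′) :* y) refl π (π ⁻¹) y)
      (trans (*-congʳ (inverseʳ π π≉0)) (*-identityˡ y)))

  π∈R : π ∈ R
  π∈R = 𝔪^⊆R {1} (𝔪^-cong (*-identityʳ π) (π*-𝔪^ R-1))

  𝔪⇒𝔪^1 : ∀ {x} → x ∈ 𝔪 → x ∈ 𝔪^ 1
  𝔪⇒𝔪^1 (r , r∈R , e) = 𝔪^-cong (sym e) (π*-𝔪^ r∈R)

  𝔪^1⇒𝔪 : ∀ {x} → x ∈ 𝔪^ 1 → x ∈ 𝔪
  𝔪^1⇒𝔪 {x} p = x /π , /π-𝔪^ p , sym (π*/π x)

  val-unit : ∀ {x} → x ∈ R → x ∉ 𝔪^ 1 → val x ≡ [ + 0 ]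
  val-unit {x} p ¬q with val x | p | ¬q
  ... | ⊤⁺            | _ | ¬q = ⊥-elim (¬q (_ SupOrder.≤⊤⁺))
  ... | [ + zero ]    | _ | _ = ≡.refl
  ... | [ + suc k ]   | _ | ¬q = ⊥-elim (¬q SupOrder.[ ℤ.+≤+ (ℕ.s≤s ℕ.z≤n) ])
  ... | [ -[1+ k ] ]  | SupOrder.[ () ] | _

  unit : ∀ {x} → x ∈ R → x ∉ 𝔪^ 1 → x ∈ R×
  unit {x} x∈R x∉𝔪 = x∈R , x ⁻¹ , ≡.subst ([ + 0 ] ℤ∞.≤_) (≡.sym val-inverse) SupOrder.[ ℤ.≤-refl ] , x*x⁻¹
    where
    x*x⁻¹ : x * x ⁻¹ ≈ 1#
    x*x⁻¹ = inverseʳ x (λ e → x∉𝔪 (𝔪^-≈0 e))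
    0+ : ∀ v → v ≡ [ + 0 ] ℤ∞.+ v
    0+ [ k ] = ≡.cong [_] (≡.sym (ℤ.+-identityˡ k))
    0+ ⊤⁺    = ≡.refl
    val-inverse : val (x ⁻¹) ≡ [ + 0 ]
    val-inverse = ≡.trans (0+ _) (≡.trans (≡.cong (ℤ∞._+ val (x ⁻¹)) (≡.sym (val-unit x∈R x∉𝔪)))
      (≡.trans (≡.sym (val-* x (x ⁻¹))) (≡.trans (val-cong x*x⁻¹) val-1)))

  unit-cancel : ∀ {n u x} → u ∈ R× → u * x ∈ 𝔪^ n → x ∈ 𝔪^ n
  unit-cancel {u = u} {x} (_ , v , v∈R , uv≈1) p = 𝔪^-cong
    (trans (solve 3 (λ u v x → v :* (u :* x) := (u :* v) :* x) refl u v x)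
      (trans (*-congʳ uv≈1) (*-identityˡ x)))
    (𝔪^-*ˡ v∈R p)

  module residue = Bijection residueCount

  abstract
    -- Extended by the residue of 0 outside `R`, so that vectors of digits can be formed without
    -- carrying integrality proofs.
    residue : Carrier → Fin q
    residue x with em {P = x ∈ R}
    ... | yes x∈R = residue.to (x , x∈R)
    ... | no  _   = residue.to (0# , R-0)

    residue-R : ∀ {x} (x∈R : x ∈ R) → residue x ≡ residue.to (x , x∈R)
    residue-R {x} x∈R with em {P = x ∈ R}
    ... | yes x∈R′ = residue.cong (𝔪^1⇒𝔪 (𝔪^-refl refl))
    ... | no  x∉R  = ⊥-elim (x∉R x∈R)

  residue-cong : ∀ {x y} → x ∈ R → y ∈ R → x - y ∈ 𝔪^ 1 → residue x ≡ residue y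
  residue-cong p q e = ≡.trans (residue-R p) (≡.trans (residue.cong (𝔪^1⇒𝔪 e)) (≡.sym (residue-R q)))

  residue-injective : ∀ {x y} → x ∈ R → y ∈ R → residue x ≡ residue y → x - y ∈ 𝔪^ 1
  residue-injective p q e = 𝔪⇒𝔪^1 (residue.injective (≡.trans (≡.sym (residue-R p)) (≡.trans e (residue-R q))))

  0̂ : Fin q
  0̂ = residue 0#

  abstract
    -- The representative of the zero residue is zero itself, so that a digit
    -- expansion vanishes modulo 𝔪ⁿ exactly when its first n digits are 0̂.
    lift : Fin q → Carrier
    lift i with i Fin.≟ 0̂
    ... | yes _ = 0#
    ... | no  _ = proj₁ (proj₁ (residue.surjective i))

    lift-R : ∀ i → lift i ∈ R
    lift-R i with i Fin.≟ 0̂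
    ... | yes _ = R-0
    ... | no  _ = proj₂ (proj₁ (residue.surjective i))

    lift-0̂ : lift 0̂ ≈ 0#
    lift-0̂ with 0̂ Fin.≟ 0̂
    ... | yes _ = refl
    ... | no ¬e = ⊥-elim (¬e ≡.refl)

    residue-lift : ∀ i → residue (lift i) ≡ i
    residue-lift i with i Fin.≟ 0̂
    ... | yes e = ≡.sym e
    ... | no  _ with residue.surjective i
    ... | (x , x∈R) , s = ≡.trans (residue-R x∈R) (s (𝔪^1⇒𝔪 (𝔪^-refl refl)))

  lift-residue : ∀ {x} → x ∈ R → x - lift (residue x) ∈ 𝔪^ 1
  lift-residue x∈R = residue-injective x∈R (lift-R _) (≡.sym (residue-lift _))

  lift-injective : ∀ {i j} → lift i - lift j ∈ 𝔪^ 1 → i ≡ j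
  lift-injective e = ≡.trans (≡.sym (residue-lift _))
    (≡.trans (residue-cong (lift-R _) (lift-R _) e) (residue-lift _))

  2≤q : 2 ℕ.≤ q
  2≤q = two-elements (residue 0#) (residue 1#) λ e →
    1∉𝔪^1 (𝔪^-cong (solve 1 (λ x → x :- con (+ 0) := x) refl 1#) (residue-injective R-1 R-0 (≡.sym e)))
    where
    two-elements : ∀ {n} (i j : Fin n) → i ≢ j → 2 ℕ.≤ n
    two-elements {suc (suc n)} _ _ _ = ℕ.s≤s (ℕ.s≤s ℕ.z≤n)
    two-elements {suc zero} zero zero i≢j = ⊥-elim (i≢j ≡.refl)

  module _ {k : ℕ} where

    liftᵛ : Fin (q ℕ.^ k) → Fin k → Carrier
    liftᵛ i = lift ∘ finToFun i

    residueᵛ : (Fin k → Carrier) → Fin (q ℕ.^ k)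
    residueᵛ x = funToFin (residue ∘ x)

    liftᵛ-R : ∀ i j → liftᵛ i j ∈ R
    liftᵛ-R i j = lift-R (finToFun i j)

    liftᵛ-residueᵛ : ∀ {x : Fin k → Carrier} → (∀ j → x j ∈ R) → ∀ j → x j - liftᵛ (residueᵛ x) j ∈ 𝔪^ 1
    liftᵛ-residueᵛ {x} x∈R j = ≡.subst (λ i → x j - lift i ∈ 𝔪^ 1)
      (≡.sym (Fin.finToFun-funToFin (residue ∘ x) j)) (lift-residue (x∈R j))

    liftᵛ-injective : ∀ {i i′} → (∀ j → liftᵛ i j - liftᵛ i′ j ∈ 𝔪^ 1) → i ≡ i′
    liftᵛ-injective {i} {i′} e = finToFun-injective {k} {q} λ j → lift-injective (e j)

    residueᵛ-cong : ∀ {x y : Fin k → Carrier} → (∀ j → x j ∈ R) → (∀ j → y j ∈ R) →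
                    (∀ j → x j - y j ∈ 𝔪^ 1) → residueᵛ x ≡ residueᵛ y
    residueᵛ-cong p q e = funToFin-cong λ j → residue-cong (p j) (q j) (e j)

    residueᵛ-unique : ∀ {x : Fin k → Carrier} {i} → (∀ j → x j ∈ R) →
                      (∀ j → x j - liftᵛ i j ∈ 𝔪^ 1) → residueᵛ x ≡ i
    residueᵛ-unique p e = liftᵛ-injective λ j → 𝔪^-trans (𝔪^-sym (liftᵛ-residueᵛ p j)) (e j)

-- Counting Lipschitz functions modulo powers of the maximal ideal.

module LipschitzFunctions (em : Classical) (ℝ : RealNumbers) (K : LocalField) (e : ℕ) where
  private
    module ℝ = RealNumbers ℝ
    module ℝExp = Exp ℝ.semiring
    module ℝSolver = IntegerSolver ℝ.commutativeRing
  open ℝ using () renaming (Carrier to |ℝ|)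
  open LocalField K hiding (zero; _⁻¹)
  open LocalFieldProperties em K
  open IntegerSolver commutativeRing
  open OrderedField ℝ
  open ClassicalAnalysis em ℝ

  Value : Set
  Value = Fin (suc e) → Carrier

  -- A set with congruences modulo the powers of 𝔪; `close n` stands for
  -- being at distance at most q⁻ⁿ.
  record Domain : Set₁ where
    field
      Point      : Set
      close      : ℕ → Rel Point 0ℓ
      close-zero : ∀ x y → close 0 x y
      point      : Point

  open Domain

  record IsLipschitz (X : Domain) (h : Point X → Value) : Set where
    field
      integral  : ∀ x i → h x i ∈ R
      contracts : ∀ {n x y} → close X n x y → ∀ i → h x i - h y i ∈ 𝔪^ n

  open IsLipschitz

  -- Coordinate 0 is left free: after the shear it is the displacement along the line, which the
  -- parameter of the line absorbs.
  HasZero : (X : Domain) → ℕ → (Point X → Value) → Set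
  HasZero X n h = ∃[ x ] ∀ k → h x (suc k) ∈ 𝔪^ n

  -- Representatives of the Lipschitz functions on `X` modulo 𝔪ⁿ, a proportion
  -- `r` of which have no zero.
  record System (X : Domain) (n : ℕ) (r : |ℝ|) : Set where
    field
      size     : ℕ
      function : Fin size → Point X → Value
      lipschitz : ∀ τ → IsLipschitz X (function τ)
      distinct : ∀ {τ τ′} → (∀ x i → function τ x i - function τ′ x i ∈ 𝔪^ n) → τ ≡ τ′
      covers   : ∀ {h} → IsLipschitz X h → ∃[ τ ] ∀ x i → h x i - function τ x i ∈ 𝔪^ n
      zero-free : average (λ τ → 𝟙 (¬ HasZero X n (function τ))) ℝ.≈ r

    instance
      size-nonZero : NonZero size
      size-nonZero = Fin.nonZeroIndex (proj₁ (covers {λ _ _ → 0#} record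
        { integral = λ _ _ → R-0 ; contracts = λ _ _ → 𝔪^-refl refl }))

  -- `X` is the disjoint union of `N` copies of `Y` with distances scaled by q⁻¹.
  record Chart (X Y : Domain) (N : ℕ) : Set where
    field
      node       : Point X → Fin N
      sub        : Point X → Point Y
      glue       : Fin N → Point Y → Point X
      node-glue  : ∀ i y → node (glue i y) ≡ i
      sub-glue   : ∀ i y n → close Y n (sub (glue i y)) y
      glue-sub   : ∀ x n → close X n x (glue (node x) (sub x))
      node-close : ∀ {n x x′} → close X (suc n) x x′ → node x ≡ node x′
      sub-close  : ∀ {n x x′} → close X (suc n) x x′ → close Y n (sub x) (sub x′)
      glue-close : ∀ {n y y′} i → close Y n y y′ → close X (suc n) (glue i y) (glue i y′)

  -- Modulo `𝔪^ 0` there is a single function and every point is a zero of it, which is the initial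
  -- value `u 0 = 1`.
  system₀ : ∀ X → System X 0 ℝ.0#
  system₀ X = record
    { size      = 1
    ; function  = λ _ _ _ → 0#
    ; lipschitz = λ _ → record { integral = λ _ _ → R-0 ; contracts = λ _ _ → 𝔪^-refl refl }
    ; distinct  = λ { {zero} {zero} _ → ≡.refl }
    ; covers    = λ lip → zero , λ x i → 𝔪^-- (integral lip x i) R-0
    ; zero-free = ℝ.trans
        (average-cong {1} λ _ → ℝ.reflexive (𝟙-false {¬ HasZero X 0 (λ _ _ → 0#)} λ no-zero → no-zero (point X , λ _ → R-0)))
        (average-const 1 ℝ.0#)
    }

  -- Adding one level to the tree.

  module Refine {X Y : Domain} {N n : ℕ} {r : |ℝ|} (chart : Chart X Y N) (system : System Y n r) where
    open Chart chart
    open System system renaming (size to M; function to fn)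

    instance
      q^e-nonZero : NonZero (q ℕ.^ e)
      q^e-nonZero = ℕ.m^n≢0 q e

      q^d-nonZero : NonZero (q ℕ.^ suc e)
      q^d-nonZero = ℕ.m^n≢0 q (suc e)

      branches-nonZero : NonZero (q ℕ.^ suc e ℕ.* M)
      branches-nonZero = ℕ.m*n≢0 (q ℕ.^ suc e) M {{q^d-nonZero}} {{size-nonZero}}

    branch : Fin (q ℕ.^ suc e) × Fin M → Point Y → Value
    branch (l , t) y k = liftᵛ l k + π * fn t y k

    decode : Fin (q ℕ.^ suc e ℕ.* M) → Fin (q ℕ.^ suc e) × Fin M
    decode = remQuot {q ℕ.^ suc e} M

    branch-R : ∀ p y k → branch p y k ∈ R
    branch-R (l , t) y k = R-+ (liftᵛ-R l k) (R-* π∈R (integral (lipschitz t) y k))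

    branch-contracts : ∀ p {m y y′} → close Y m y y′ → ∀ k → branch p y k - branch p y′ k ∈ 𝔪^ suc m
    branch-contracts (l , t) c k = 𝔪^-+-cong (𝔪^-refl refl) (π*--𝔪^ (contracts (lipschitz t) c k))

    branch-label : ∀ l t y k → branch (l , t) y k - liftᵛ l k ∈ 𝔪^ 1
    branch-label l t y k = 𝔪^-cong (solve 2 (λ a b → b := (a :+ b) :- a) refl _ _)
      (π*-𝔪^ (integral (lipschitz t) y k))

    -- The label is the residue of the values anywhere, for instance at `point Y`. Once the labels
    -- agree they cancel, and π divides out of the remainder.
    branch-injective : ∀ {p p′} → (∀ y k → branch p y k - branch p′ y k ∈ 𝔪^ suc n) → p ≡ p′
    branch-injective {l , t} {l′ , t′} h = ≡.cong₂ _,_ l≡l′ (distinct λ y k → π*-𝔪^⁻ (𝔪^-cong (rearrange y k) (h y k)))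
      where
      l≡l′ : l ≡ l′
      l≡l′ = liftᵛ-injective λ k → 𝔪^-trans (𝔪^-sym (branch-label l t (point Y) k))
        (𝔪^-trans (𝔪^-weaken (h (point Y) k)) (branch-label l′ t′ (point Y) k))
      rearrange : ∀ y k → branch (l , t) y k - branch (l′ , t′) y k ≈ π * (fn t y k - fn t′ y k)
      rearrange y k = trans (+-congˡ (-‿cong (+-congʳ (reflexive (≡.cong (λ l → liftᵛ l k) (≡.sym l≡l′))))))
        (solve 4 (λ a p x y → (a :+ p :* x) :- (a :+ p :* y) := p :* (x :- y)) refl _ _ _ _)

    -- `finToFun` peels off the first digit by `remQuot`, so the second component codes the last `e`
    -- digits. Keeping these as one number lets `average-×` separate them from the first digit.
    Hit : Fin (q ℕ.^ suc e) × Fin M → Set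
    Hit (l , t) = proj₂ (remQuot {q} (q ℕ.^ e) l) ≡ funToFin {e} (const 0̂) × HasZero Y n (fn t)

    branch-zero⇒Hit : ∀ p → HasZero Y (suc n) (branch p) → Hit p
    branch-zero⇒Hit (l , t) (y , h) =
      finToFun-injective {e} {q} (λ k → ≡.trans (digit k) (≡.sym (Fin.finToFun-funToFin {e} (const 0̂) k))) ,
      y , λ k → π*-𝔪^⁻ (𝔪^-cong (trans (+-congʳ (trans (reflexive (≡.cong lift (digit k))) lift-0̂)) (+-identityˡ _)) (h k))
      where
      digit : ∀ k → finToFun {q} {suc e} l (suc k) ≡ 0̂
      digit k = lift-injective (𝔪^-trans (𝔪^-sym (branch-label l t y (suc k)))
        (𝔪^-- (𝔪^-weaken (h k)) (𝔪^-≈0 lift-0̂)))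

    Hit⇒branch-zero : ∀ p → Hit p → HasZero Y (suc n) (branch p)
    Hit⇒branch-zero (l , t) (e≡ , y , h) = y , λ k → 𝔪^-+ (𝔪^-≈0 (trans (reflexive (≡.cong lift (digit k))) lift-0̂)) (π*-𝔪^ (h k))
      where
      digit : ∀ k → finToFun {q} {suc e} l (suc k) ≡ 0̂
      digit k = ≡.trans (≡.cong (λ c → finToFun {q} {e} c k) e≡) (Fin.finToFun-funToFin {e} (const 0̂) k)

    average-Hit : average (λ p → 𝟙 (Hit (decode p))) ℝ.≈ (ℝ.1# ℝ.- r) ℝ.* ℝ.fromℕ (q ℕ.^ e) ℝ.⁻¹
    average-Hit = begin
      average (λ p → 𝟙 (Hit (decode p)))
        ≈⟨ average-cong {q ℕ.^ suc e ℕ.* M} (λ p → 𝟙-×) ⟩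
      average (λ p → f (proj₁ (decode p)) ℝ.* g (proj₂ (decode p)))
        ≈⟨ average-× (q ℕ.^ suc e) M f g ⟩
      average f ℝ.* average g
        ≈⟨ ℝ.*-cong average-f average-g ⟩
      ℝ.fromℕ (q ℕ.^ e) ℝ.⁻¹ ℝ.* (ℝ.1# ℝ.- r)
        ≈⟨ ℝ.*-comm _ _ ⟩
      (ℝ.1# ℝ.- r) ℝ.* ℝ.fromℕ (q ℕ.^ e) ℝ.⁻¹ ∎
      where
      open SetoidReasoning ℝ.setoid
      f : Fin (q ℕ.^ suc e) → |ℝ|
      f l = 𝟙 (proj₂ (remQuot {q} (q ℕ.^ e) l) ≡ funToFin {e} (const 0̂))
      g : Fin M → |ℝ|
      g t = 𝟙 (HasZero Y n (fn t))
      average-f : average f ℝ.≈ ℝ.fromℕ (q ℕ.^ e) ℝ.⁻¹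
      average-f = begin
        average f
          -- The first digit is unconstrained and enters `average-×` as the constant factor 1.
          ≈⟨ average-cong {q ℕ.^ suc e} (λ l → ℝ.*-identityˡ (f l)) ⟨
        average {q ℕ.^ suc e} (λ l → ℝ.1# ℝ.* f l)
          ≈⟨ average-× q (q ℕ.^ e) (λ _ → ℝ.1#) (λ c → 𝟙 (c ≡ funToFin {e} (const 0̂))) ⟩
        average {q} (λ _ → ℝ.1#) ℝ.* average (λ c → 𝟙 (c ≡ funToFin {e} (const 0̂)))
          ≈⟨ ℝ.*-cong (average-const q ℝ.1#) (ℝ.*-congʳ (sum-𝟙-≡ (funToFin {e} (const 0̂)))) ⟩
        ℝ.1# ℝ.* (ℝ.1# ℝ.* ℝ.fromℕ (q ℕ.^ e) ℝ.⁻¹)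
          ≈⟨ ℝ.trans (ℝ.*-identityˡ _) (ℝ.*-identityˡ _) ⟩
        ℝ.fromℕ (q ℕ.^ e) ℝ.⁻¹ ∎
      average-g : average g ℝ.≈ ℝ.1# ℝ.- r
      average-g = begin
        average g
          ≈⟨ ℝSolver.solve 1 (λ x → x ℝSolver.:= ℝSolver.con (+ 1) ℝSolver.:- (ℝSolver.con (+ 1) ℝSolver.:- x)) ℝ.refl (average g) ⟩
        ℝ.1# ℝ.- (ℝ.1# ℝ.- average g)
          ≈⟨ ℝ.+-congˡ (ℝ.-‿cong (average-1- M g)) ⟨
        ℝ.1# ℝ.- average (λ t → ℝ.1# ℝ.- g t)
          ≈⟨ ℝ.+-congˡ (ℝ.-‿cong (average-cong {M} λ t → 𝟙-¬)) ⟨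
        ℝ.1# ℝ.- average (λ t → 𝟙 (¬ HasZero Y n (fn t)))
          ≈⟨ ℝ.+-congˡ (ℝ.-‿cong zero-free) ⟩
        ℝ.1# ℝ.- r ∎

    function : Fin ((q ℕ.^ suc e ℕ.* M) ℕ.^ N) → Point X → Value
    function τ x = branch (decode (finToFun τ (node x))) (sub x)

    function-glue : ∀ τ i y {m} k → function τ (glue i y) k - branch (decode (finToFun τ i)) y k ∈ 𝔪^ suc m
    function-glue τ i y {m} k = ≡.subst
      (λ j → branch (decode (finToFun τ j)) (sub (glue i y)) k - branch (decode (finToFun τ i)) y k ∈ 𝔪^ suc m)
      (≡.sym (node-glue i y)) (branch-contracts (decode (finToFun τ i)) (sub-glue i y m) k)

    -- Points of different classes are close only at level 0, where integrality suffices. At a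
    -- positive level the classes agree, and the factor π regains the level lost in passing to
    -- `sub`.
    function-lipschitz : ∀ τ → IsLipschitz X (function τ)
    function-lipschitz τ .integral x = branch-R _ _
    function-lipschitz τ .contracts {zero} c i = 𝔪^-- (branch-R _ _ i) (branch-R _ _ i)
    function-lipschitz τ .contracts {suc m} {x} {x′} c i = ≡.subst
      (λ j → function τ x i - branch (decode (finToFun τ j)) (sub x′) i ∈ 𝔪^ suc m)
      (node-close c) (branch-contracts (decode (finToFun τ (node x))) (sub-close c) i)

    function-distinct : ∀ {τ τ′} → (∀ x i → function τ x i - function τ′ x i ∈ 𝔪^ suc n) → τ ≡ τ′
    function-distinct {τ} {τ′} h = finToFun-injective {N} λ i → remQuot-injective
      (branch-injective λ y k → 𝔪^-trans (𝔪^-sym (function-glue τ i y k))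
        (𝔪^-trans (h (glue i y) k) (function-glue τ′ i y k)))
      where
      remQuot-injective : ∀ {p p′} → decode p ≡ decode p′ → p ≡ p′
      remQuot-injective {p} {p′} eq = ≡.trans (≡.sym (Fin.combine-remQuot {q ℕ.^ suc e} M p))
        (≡.trans (≡.cong (uncurry combine) eq) (Fin.combine-remQuot {q ℕ.^ suc e} M p′))

    module _ {h : Point X → Value} (lip : IsLipschitz X h) where
      label : Fin N → Fin (q ℕ.^ suc e)
      label i = residueᵛ (h (glue i (point Y)))

      -- `glue-close` raises the trivial `close-zero` to level 1, so `h` is constant modulo 𝔪 on a
      -- class and the digits at `point Y` serve all of it.
      label-close : ∀ i y k → h (glue i y) k - liftᵛ (label i) k ∈ 𝔪^ 1
      label-close i y k = 𝔪^-trans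
        (contracts lip (glue-close i (close-zero Y y (point Y))) k)
        (liftᵛ-residueᵛ (integral lip (glue i (point Y))) k)

      restriction : Fin N → Point Y → Value
      restriction i y k = (h (glue i y) k - liftᵛ (label i) k) /π

      restriction-lipschitz : ∀ i → IsLipschitz Y (restriction i)
      restriction-lipschitz i .integral y k = /π-𝔪^ (label-close i y k)
      restriction-lipschitz i .contracts c k =
        /π--𝔪^ (𝔪^---cong (contracts lip (glue-close i c) k) (𝔪^-refl refl))

      subtree : Fin N → Fin M
      subtree i = proj₁ (covers (restriction-lipschitz i))

      function-covers : ∃[ τ ] ∀ x i → h x i - function τ x i ∈ 𝔪^ suc n
      function-covers = funToFin (λ i → combine (label i) (subtree i)) , λ x k →
        𝔪^-trans (contracts lip (glue-sub x (suc n)) k)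
          (≡.subst (λ p → h (glue (node x) (sub x)) k - branch p (sub x) k ∈ 𝔪^ suc n)
            (≡.sym (≡.trans (≡.cong decode (Fin.finToFun-funToFin _ (node x)))
              (Fin.remQuot-combine (label (node x)) (subtree (node x)))))
            (expand (node x) (sub x) k))
        where
        expand : ∀ i y k → h (glue i y) k - branch (label i , subtree i) y k ∈ 𝔪^ suc n
        expand i y k = 𝔪^-cong
          (trans (solve 4 (λ a l p s → p :* a :- p :* s := (l :+ p :* a) :- (l :+ p :* s)) refl
              (restriction i y k) (liftᵛ (label i) k) π (fn (subtree i) y k))
            (+-congʳ (trans (+-congˡ (π*/π _)) (solve 2 (λ a l → l :+ (a :- l) := a) refl _ _))))
          (π*--𝔪^ (proj₂ (covers (restriction-lipschitz i)) y k))

    HasZero⇔ : ∀ τ → 𝟙 (¬ HasZero X (suc n) (function τ)) ≡ 𝟙 (∀ i → ¬ Hit (decode (finToFun τ i)))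
    HasZero⇔ τ = 𝟙-cong
      (λ none i hit → let (y , z) = Hit⇒branch-zero _ hit in
        none (glue i y , λ k → 𝔪^-resp (function-glue τ i y (suc k)) (z k)))
      (λ none (x , z) → none (node x) (branch-zero⇒Hit _ (sub x , z)))

    -- A function has no zero exactly when none of its `N` independent branches is a `Hit`. The
    -- number `N` stays general: `q ^ e` gives the recurrence of `u`, and `pointCount (suc e)` the
    -- count on projective space.
    refine : System X (suc n) ((ℝ.1# ℝ.- (ℝ.1# ℝ.- r) ℝ.* ℝ.fromℕ (q ℕ.^ e) ℝ.⁻¹) ℝ.^ N)
    refine = record
      { size      = (q ℕ.^ suc e ℕ.* M) ℕ.^ N
      ; function  = function
      ; lipschitz = function-lipschitz
      ; distinct  = function-distinct
      ; covers    = function-covers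
      ; zero-free = begin
          average (λ τ → 𝟙 (¬ HasZero X (suc n) (function τ)))
            ≈⟨ average-cong (λ τ → ℝ.trans (ℝ.reflexive (HasZero⇔ τ)) (𝟙-∀ {N} (λ i → ¬ Hit (decode (finToFun τ i))))) ⟩
          average (λ τ → ℝProduct.sum {N} λ i → 𝟙 (¬ Hit (decode (finToFun τ i))))
            ≈⟨ average-^ (q ℕ.^ suc e ℕ.* M) N (λ p → 𝟙 (¬ Hit (decode p))) ⟩
          average (λ p → 𝟙 (¬ Hit (decode p))) ℝ.^ N
            ≈⟨ ℝExp.^-congˡ N (average-cong {q ℕ.^ suc e ℕ.* M} λ p → 𝟙-¬) ⟩
          average (λ p → ℝ.1# ℝ.- 𝟙 (Hit (decode p))) ℝ.^ N
            ≈⟨ ℝExp.^-congˡ N (average-1- (q ℕ.^ suc e ℕ.* M) (λ p → 𝟙 (Hit (decode p)))) ⟩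
          (ℝ.1# ℝ.- average (λ p → 𝟙 (Hit (decode p)))) ℝ.^ N
            ≈⟨ ℝExp.^-congˡ N (ℝ.+-congˡ (ℝ.-‿cong average-Hit)) ⟩
          (ℝ.1# ℝ.- (ℝ.1# ℝ.- r) ℝ.* ℝ.fromℕ (q ℕ.^ e) ℝ.⁻¹) ℝ.^ N ∎
      }
      where
      open SetoidReasoning ℝ.setoid
      module ℝProduct = MonoidSum ℝ.*-commutativeMonoid

-- Projective space, its norms and canonical representatives.

least-index : Classical → ∀ {n} (P : Fin n → Set) → ∃ P → ∃[ j ] P j × (∀ i → i Fin.< j → ¬ P i)
least-index em {suc n} P (k , p) with em {P = P zero}
... | yes p₀ = zero , p₀ , λ i ()
least-index em {suc n} P (zero , p)  | no ¬p₀ = ⊥-elim (¬p₀ p)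
least-index em {suc n} P (suc k , p) | no ¬p₀ with least-index em (P ∘ suc) (k , p)
... | j , pj , below = suc j , pj , λ { zero _ → ¬p₀ ; (suc i) (ℕ.s≤s i<j) → below i i<j }

module ProjectiveSpace (em : Classical) (ℝ : RealNumbers) (K : LocalField) (e : ℕ) where
  private
    module ℝ = RealNumbers ℝ
    module ℝExp = Exp ℝ.semiring
    module ℝSolver = IntegerSolver ℝ.commutativeRing
    module ≤ = TotalOrder ℝ.totalOrder
  open ℝ using () renaming (Carrier to |ℝ|)
  open LocalField K hiding (zero; _⁻¹)
  open LocalFieldProperties em K
  open IntegerSolver commutativeRing
  open OrderedField ℝ
  open ClassicalAnalysis em ℝ
  open LipschitzFunctions em ℝ K e
  open Kakeya em ℝ K (suc e) hiding (0≤1)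
  open Ω using (to)

  System-resp : ∀ {X n r r′} → r ℝ.≈ r′ → System X n r → System X n r′
  System-resp r≈r′ s = record { System s; zero-free = ℝ.trans (System.zero-free s) r≈r′ }

  affine : Domain
  affine = record
    { Point      = ∃[ x ] ∀ (i : Fin e) → x i ∈ R
    ; close      = λ n x y → ∀ i → proj₁ x i - proj₁ y i ∈ 𝔪^ n
    ; close-zero = λ x y i → 𝔪^-- (proj₂ x i) (proj₂ y i)
    ; point      = (λ _ → 0#) , λ _ → R-0
    }

  -- The π-adic expansion: `node` is the vector of leading digits, and `sub` is what remains,
  -- divided by π.
  affine-chart : Chart affine affine (q ℕ.^ e)
  affine-chart = record
    { node       = λ x → residueᵛ (proj₁ x)
    ; sub        = sub
    ; glue       = glue
    ; node-glue  = λ i y → residueᵛ-unique (proj₂ (glue i y)) (glue-base i y)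
    ; sub-glue   = λ i y n j → 𝔪^-refl (/π-unique (trans
        (+-congˡ (-‿cong (reflexive (≡.cong (λ i → liftᵛ i j) (residueᵛ-unique (proj₂ (glue i y)) (glue-base i y))))))
        (solve 2 (λ a b → (a :+ b) :- a := b) refl _ _)))
    ; glue-sub   = λ x n j → 𝔪^-refl (sym (trans (+-congˡ (π*/π _)) (solve 2 (λ a x → a :+ (x :- a) := x) refl _ _)))
    ; node-close = λ {_} {x} {x′} c → residueᵛ-cong (proj₂ x) (proj₂ x′) (𝔪^-weaken ∘ c)
    ; sub-close  = λ {_} {x} {x′} c j → /π--𝔪^ (𝔪^---cong (c j) (𝔪^-refl
        (reflexive (≡.cong (λ i → liftᵛ i j) (residueᵛ-cong (proj₂ x) (proj₂ x′) (𝔪^-weaken ∘ c))))))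
    ; glue-close = λ i c j → 𝔪^-+-cong (𝔪^-refl refl) (π*--𝔪^ (c j))
    }
    where
    open Domain affine
    sub : Point → Point
    sub (x , x∈R) = (λ j → (x j - liftᵛ (residueᵛ x) j) /π) , λ j → /π-𝔪^ (liftᵛ-residueᵛ x∈R j)
    glue : Fin (q ℕ.^ e) → Point → Point
    glue i (y , y∈R) = (λ j → liftᵛ i j + π * y j) , λ j → R-+ (liftᵛ-R i j) (R-* π∈R (y∈R j))
    glue-base : ∀ i y j → proj₁ (glue i y) j - liftᵛ i j ∈ 𝔪^ 1
    glue-base i (y , y∈R) j = 𝔪^-cong (solve 2 (λ a b → b := (a :+ b) :- a) refl _ _) (π*-𝔪^ (y∈R j))

  affine-system : ∀ n → System affine n (ℝ.1# ℝ.- u n)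
  affine-system zero    = System-resp (ℝ.sym (ℝ.-‿inverseʳ ℝ.1#)) (system₀ affine)
  affine-system (suc n) = System-resp
    (ℝ.trans
      (ℝExp.^-congˡ (q ℕ.^ e) (ℝ.+-congˡ (ℝ.-‿cong (ℝ.*-congʳ (double-minus (u n))))))
      (ℝ.sym (double-minus _)))
    (Refine.refine affine-chart (affine-system n))
    where
    double-minus : ∀ x → ℝ.1# ℝ.- (ℝ.1# ℝ.- x) ℝ.≈ x
    double-minus = ℝSolver.solve 1
      (λ x → ℝSolver.con (+ 1) ℝSolver.:- (ℝSolver.con (+ 1) ℝSolver.:- x) ℝSolver.:= x) ℝ.refl

  -- Norms

  1<q : ℝ.1# ℝ.< ℝ.fromℕ q
  1<q = go 2≤q
    where
    go : ∀ {n} → 2 ℕ.≤ n → ℝ.1# ℝ.< ℝ.fromℕ n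
    go {suc (suc n)} (ℕ.s≤s (ℕ.s≤s _)) = 1≤1+1+n , λ 1≈ → proj₂ (fromℕ-pos (suc n))
      (ℝ.trans (ℝ.sym (ℝ.-‿inverseʳ ℝ.1#)) (ℝ.trans (ℝ.+-congʳ 1≈)
        (ℝSolver.solve 2 (λ a b → (a ℝSolver.:+ b) ℝSolver.:- a ℝSolver.:= b) ℝ.refl _ _)))
      where
      1≤1+1+n : ℝ.1# ℝ.≤ ℝ.fromℕ (suc (suc n))
      1≤1+1+n = x≤x+y (proj₁ (fromℕ-pos (suc n)))

  0<q⁻¹ : ℝ.0# ℝ.< ℝ.fromℕ q ℝ.⁻¹
  0<q⁻¹ = ⁻¹-pos (fromℕ-pos q)

  q⁻¹<1 : ℝ.fromℕ q ℝ.⁻¹ ℝ.< ℝ.1#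
  q⁻¹<1 = ≤-<-trans (≤.reflexive (ℝ.sym (ℝ.*-identityˡ _)))
    (<-≤-trans (*-monoʳ-< _ 0<q⁻¹ 1<q) (≤.reflexive (*-⁻¹-cancel q)))

  q^--suc : ∀ n → q^- [ + suc n ] ℝ.≈ ℝ.fromℕ q ℝ.⁻¹ ℝ.* q^- [ + n ]
  q^--suc zero    = ℝ.refl
  q^--suc (suc n) = ℝ.refl

  q^--pos : ∀ n → ℝ.0# ℝ.< q^- [ + n ]
  q^--pos zero    = 0<1
  q^--pos (suc n) = <-≤-trans (*-pos 0<q⁻¹ (q^--pos n)) (≤.reflexive (ℝ.sym (q^--suc n)))

  q^--strict : ∀ n → q^- [ + suc n ] ℝ.< q^- [ + n ]
  q^--strict n = ≤-<-trans (≤.reflexive (q^--suc n))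
    (<-≤-trans (*-monoʳ-< _ (q^--pos n) q⁻¹<1) (≤.reflexive (ℝ.*-identityˡ _)))

  𝔪^⇒∣∣≤ : ∀ {n x} → x ∈ 𝔪^ n → ∣ x ∣ ℝ.≤ q^- [ + n ]
  𝔪^⇒∣∣≤ = q^--antitone

  -- Valuations are integers or infinite, so one that is not at least n + 1 is at most n. This gap
  -- between consecutive norms takes the place of limiting arguments.
  ∉𝔪^⇒∣∣≥ : ∀ {n x} → x ∉ 𝔪^ suc n → q^- [ + n ] ℝ.≤ ∣ x ∣
  ∉𝔪^⇒∣∣≥ {n} {x} x∉ = q^--antitone (below (val x) x∉)
    where
    below : ∀ v → ¬ [ + suc n ] ℤ∞.≤ v → v ℤ∞.≤ [ + n ]
    below ⊤⁺    ¬p = ⊥-elim (¬p (_ SupOrder.≤⊤⁺))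
    below [ k ] ¬p = SupOrder.[ ≡.subst (k ℤ.≤_) (ℤ.pred-suc (+ n)) (ℤ.i<j⇒i≤pred[j] (ℤ.≰⇒> λ q → ¬p SupOrder.[ q ])) ]

  ∣∣≤⇒𝔪^ : ∀ n {x} → ∣ x ∣ ℝ.≤ q^- [ + n ] → x ∈ 𝔪^ n
  ∣∣≤⇒𝔪^ zero {x} p = go (val x) p
    where
    go : ∀ v → q^- v ℝ.≤ ℝ.1# → [ + 0 ] ℤ∞.≤ v
    go ⊤⁺           _ = _ SupOrder.≤⊤⁺
    go [ + k ]      _ = SupOrder.[ ℤ.+≤+ ℕ.z≤n ]
    go [ -[1+ k ] ] p = ⊥-elim (<⇒≱ (<-≤-trans 1<q q≤) p)
      where
      q≤ : ℝ.fromℕ q ℝ.≤ ℝ.fromℕ q ℝ.^ suc k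
      q≤ = ≤.≤-respˡ-≈ (ℝ.*-identityʳ _) (q^.b^-mono {1} {suc k} (ℕ.≤⇒≤′ (ℕ.s≤s ℕ.z≤n)))
  ∣∣≤⇒𝔪^ (suc n) p = double-negation λ x∉ → <⇒≱ (q^--strict n) (≤.trans (∉𝔪^⇒∣∣≥ x∉) p)

  𝔪^⇒‖‖≤ : ∀ n {x} → (∀ i → x i ∈ 𝔪^ n) → ‖ x ‖ ℝ.≤ q^- [ + n ]
  𝔪^⇒‖‖≤ n {x} x∈ = ‖‖≤ x (proj₁ (q^--pos n)) (λ i → 𝔪^⇒∣∣≤ {n} {x i} (x∈ i))

  ‖‖≤⇒𝔪^ : ∀ n {x} → ‖ x ‖ ℝ.≤ q^- [ + n ] → ∀ i → x i ∈ 𝔪^ n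
  ‖‖≤⇒𝔪^ n {x} p i = ∣∣≤⇒𝔪^ n (≤.trans (∣∣≤‖‖ x i) p)

  ∉𝔪^⇒‖‖≥ : ∀ n {x} → ¬ (∀ i → x i ∈ 𝔪^ suc n) → q^- [ + n ] ℝ.≤ ‖ x ‖
  ∉𝔪^⇒‖‖≥ n {x} x∉ = double-negation λ ¬p → x∉ λ i → double-negation λ xi∉ →
    ¬p (≤.trans (∉𝔪^⇒∣∣≥ xi∉) (∣∣≤‖‖ x i))

  -- A nonzero coordinate of `x` has norm exactly q⁻ᵏ for some k ≥ 0 and lies outside `𝔪^ suc k`. By
  -- hypothesis `y` then has a coordinate outside `𝔪^ suc k` too, hence norm at least q⁻ᵏ.
  ‖‖-compare : ∀ {x y} → (∀ i → x i ∈ R) → (∀ n → (∀ i → y i ∈ 𝔪^ suc n) → ∀ i → x i ∈ 𝔪^ suc n) → ‖ x ‖ ℝ.≤ ‖ y ‖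
  ‖‖-compare {x} {y} x∈R h = ‖‖≤ x (0≤‖‖ y) bound
    where
    attained : ∀ v → [ + 0 ] ℤ∞.≤ v → q^- v ≡ ℝ.0# ⊎ ∃[ k ] q^- v ≡ q^- [ + k ] × ¬ [ + suc k ] ℤ∞.≤ v
    attained ⊤⁺      _ = inj₁ ≡.refl
    attained [ + k ] _ = inj₂ (k , ≡.refl , λ { SupOrder.[ ℤ.+≤+ k<k ] → ℕ.<-irrefl ≡.refl k<k })
    attained [ -[1+ k ] ] SupOrder.[ () ]
    bound : ∀ i → ∣ x i ∣ ℝ.≤ ‖ y ‖
    bound i with attained (val (x i)) (x∈R i)
    ... | inj₁ 0≡      = ≡.subst (ℝ._≤ ‖ y ‖) (≡.sym 0≡) (0≤‖‖ y)
    ... | inj₂ (k , e , xi∉) = ≡.subst (ℝ._≤ ‖ y ‖) (≡.sym e) (∉𝔪^⇒‖‖≥ k λ y∈ → xi∉ (h k y∈ i))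

  -- Canonical representatives

  IsPivot : (Fin (suc e) → Carrier) → Fin (suc e) → Set
  IsPivot x j = x j ≈ 1# × (∀ i → i Fin.< j → x i ∈ 𝔪^ 1)

  ∣1∣≡1 : ∣ 1# ∣ ≡ ℝ.1#
  ∣1∣≡1 = ≡.cong q^-_ val-1

  sphere-R : (a : 𝕊) → ∀ i → proj₁ a i ∈ R
  sphere-R (x , ‖x‖≈1) = ‖‖≤⇒𝔪^ 0 (≤.reflexive ‖x‖≈1)

  pivot⇒‖‖≈1 : ∀ {x j} → (∀ i → x i ∈ R) → x j ≈ 1# → ‖ x ‖ ℝ.≈ ℝ.1#
  pivot⇒‖‖≈1 {x} {j} x∈R xj≈1 = ≤.antisym (𝔪^⇒‖‖≤ 0 {x} x∈R)
    (≡.subst (ℝ._≤ ‖ x ‖) (≡.trans (∣∣-cong xj≈1) ∣1∣≡1) (∣∣≤‖‖ x j))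

  sphere-unit : (a : 𝕊) → ∃[ j ] proj₁ a j ∉ 𝔪^ 1
  sphere-unit (x , ‖x‖≈1) = double-negation λ none →
    <⇒≱ (q^--strict 0) (≤.trans (≤.reflexive (ℝ.sym ‖x‖≈1))
      (𝔪^⇒‖‖≤ 1 {x} λ i → double-negation λ xi∉ → none (i , xi∉)))

  canonical⇒pivot : ∀ {a} → IsCanonical a → ∃[ j ] IsPivot (proj₁ a) j
  canonical⇒pivot (j , xj≈1 , below) = j , xj≈1 , λ i i<j → double-negation λ xi∉ →
    <⇒≱ (below i i<j) (∉𝔪^⇒∣∣≥ xi∉)

  pivot⇒canonical : ∀ {a j} → IsPivot (proj₁ a) j → IsCanonical a
  pivot⇒canonical {a} {j} (xj≈1 , below) = j , xj≈1 , λ i i<j → ≤-<-trans (𝔪^⇒∣∣≤ {1} {proj₁ a i} (below i i<j)) (q^--strict 0)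

  scale-to-canonical : (a : 𝕊) → ∀ {j} → (∀ i → i Fin.< j → proj₁ a i ∈ 𝔪^ 1) → proj₁ a j ∈ R× →
                       ∃[ c ] c ∼ a × IsCanonical c
  scale-to-canonical a@(x , _) {j} below xj×@(_ , v , v∈R , xjv≈1) =
    (c , pivot⇒‖‖≈1 c∈R cj≈1) , (x j , xj× , a≈) ,
    pivot⇒canonical {c , pivot⇒‖‖≈1 c∈R cj≈1} (cj≈1 , λ i i<j → 𝔪^-*ˡ v∈R (below i i<j))
    where
    c : Fin (suc e) → Carrier
    c i = v * x i
    c∈R : ∀ i → c i ∈ R
    c∈R i = R-* v∈R (sphere-R a i)
    cj≈1 : c j ≈ 1#
    cj≈1 = trans (*-comm _ _) xjv≈1
    a≈ : ∀ i → x i ≈ x j * c i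
    a≈ i = sym (trans (sym (*-assoc _ _ _)) (trans (*-congʳ xjv≈1) (*-identityˡ _)))

  canonical-exists : (a : 𝕊) → ∃[ c ] c ∼ a × IsCanonical c
  canonical-exists a = let (j , xj∉ , below) = least-index em (λ j → proj₁ a j ∉ 𝔪^ 1) (sphere-unit a) in
    scale-to-canonical a (λ i i<j → double-negation (below i i<j)) (unit (sphere-R a j) xj∉)

  abstract
    -- Modulo 𝔪 both vectors span the same line, and the pivot is the position of the first nonzero
    -- coordinate on that line.
    pivots-agree : ∀ {x y j j′ s t} → (∀ i → x i ∈ R) → (∀ i → y i ∈ R) → IsPivot x j → IsPivot y j′ →
      s ∈ R× → t ∈ R× → (∀ i → s * x i - t * y i ∈ 𝔪^ 1) → j ≡ j′
    pivots-agree {x} {y} {j} {j′} {s} {t} x∈R y∈R (xj , x<) (yj , y<) s× t× h with Fin.<-cmp j j′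
    ... | tri≈ _ j≡j′ _ = j≡j′
    ... | tri< j<j′ _ _ = ⊥-elim (1∉𝔪^1 (𝔪^-cong xj (unit-cancel s×
            (𝔪^-resp (h j) (𝔪^-*ˡ (proj₁ t×) (y< j j<j′))))))
    ... | tri> _ _ j′<j = ⊥-elim (1∉𝔪^1 (𝔪^-cong yj (unit-cancel t×
            (𝔪^-resp (𝔪^-sym (h j′)) (𝔪^-*ˡ (proj₁ s×) (x< j′ j′<j))))))

    -- At the common pivot both vectors are 1, so the hypothesis there reads `s - t ∈ 𝔪^ suc n`.
    -- Subtracting `(s - t) * y` and cancelling the unit `s` gives the claim. Hence no other pair of
    -- representatives is closer than the canonical one.
    canonical-close : ∀ {n x y j j′ s t} → (∀ i → x i ∈ R) → (∀ i → y i ∈ R) → IsPivot x j → IsPivot y j′ →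
      s ∈ R× → t ∈ R× → (∀ i → s * x i - t * y i ∈ 𝔪^ suc n) → ∀ i → x i - y i ∈ 𝔪^ suc n
    canonical-close {n} {x} {y} {j} {s = s} {t} x∈R y∈R px py s× t× h i
      with pivots-agree x∈R y∈R px py s× t× (𝔪^-weaken ∘ h)
    ... | ≡.refl = unit-cancel s× (𝔪^-cong
      (solve 4 (λ s t x y → (s :* x :- t :* y) :- (s :- t) :* y := s :* (x :- y)) refl s t (x i) (y i))
      (𝔪^-- (h i) (𝔪^-* s-t (y∈R i))))
      where
      s-t : s - t ∈ 𝔪^ suc n
      s-t = 𝔪^-cong₂ (trans (*-congˡ (proj₁ px)) (*-identityʳ s)) (trans (*-congˡ (proj₁ py)) (*-identityʳ t)) (h j)

  module ∼ = IsEquivalence ∼-isEquivalence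

  R×-1 : 1# ∈ R×
  R×-1 = R-1 , 1# , R-1 , *-identityˡ 1#

  canonical : 𝕊 → 𝕊
  canonical a = the a (λ c → c ∼ a × IsCanonical c)

  canonical-spec : ∀ a → canonical a ∼ a × IsCanonical (canonical a)
  canonical-spec a = the-satisfies {P = λ c → c ∼ a × IsCanonical c} (canonical-exists a)

  canonical∼ : ∀ a → canonical a ∼ a
  canonical∼ = proj₁ ∘ canonical-spec

  can-R : ∀ a i → can a i ∈ R
  can-R a = sphere-R (canonical a)

  abstract
    can-pivot : ∀ a → ∃[ j ] IsPivot (can a) j
    can-pivot a = canonical⇒pivot {canonical a} (proj₂ (canonical-spec a))

    can-scaled : ∀ (a â : 𝕊) → â ∼ a → ∃[ s ] s ∈ R× × (∀ i → proj₁ â i ≈ s * can a i)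
    can-scaled a â â∼a = ∼.trans {canonical a} {a} {â} (canonical∼ a) (∼.sym {â} {a} â∼a)

    can-close : ∀ {n} (a b â b̂ : 𝕊) → â ∼ a → b̂ ∼ b → (∀ i → proj₁ â i - proj₁ b̂ i ∈ 𝔪^ suc n) →
      ∀ i → can a i - can b i ∈ 𝔪^ suc n
    can-close {n} a b â b̂ â∼a b̂∼b h = scaled (can-scaled a â â∼a) (can-scaled b b̂ b̂∼b)
      where
      scaled : ∃[ s ] s ∈ R× × (∀ i → proj₁ â i ≈ s * can a i) →
               ∃[ t ] t ∈ R× × (∀ i → proj₁ b̂ i ≈ t * can b i) → ∀ i → can a i - can b i ∈ 𝔪^ suc n
      scaled (s , s× , â≈) (t , t× , b̂≈) =
        canonical-close (can-R a) (can-R b) (proj₂ (can-pivot a)) (proj₂ (can-pivot b)) s× t×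
          (λ i → 𝔪^-cong₂ (â≈ i) (b̂≈ i) (h i))

    can-of-canonical : ∀ (a : 𝕊) {j} → IsPivot (proj₁ a) j → ∀ i → can a i ≈ proj₁ a i
    can-of-canonical a p i = scaled (can-scaled a a (∼.refl {a}))
      where
      scaled : ∃[ s ] s ∈ R× × (∀ i → proj₁ a i ≈ s * can a i) → can a i ≈ proj₁ a i
      scaled (s , s× , a≈) = separated-≈ λ n →
        canonical-close (can-R a) (sphere-R a) (proj₂ (can-pivot a)) p s× R×-1
          (λ i → 𝔪^-refl (trans (sym (a≈ i)) (sym (*-identityˡ _)))) i

  -- Closeness is read off canonical representatives, which avoids the infimum in `distℙ`. That the
  -- Lipschitz functions are the same is shown by `lipschitz⇒contracts` and `contracts⇒lipschitz`.
  projective : Domain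
  projective = record
    { Point      = 𝕊
    ; close      = λ n a b → ∀ i → can a i - can b i ∈ 𝔪^ n
    ; close-zero = λ a b i → 𝔪^-- (can-R a i) (can-R b i)
    ; point      = point , pivot⇒‖‖≈1 {j = zero} point-R refl
    }
    where
    point : Fin (suc e) → Carrier
    point zero    = 1#
    point (suc _) = 0#
    point-R : ∀ i → point i ∈ R
    point-R zero    = R-1
    point-R (suc _) = R-0

  ∼⇒close : ∀ {n} {a b : 𝕊} → a ∼ b → Domain.close projective (suc n) a b
  ∼⇒close {n} {a} {b} a∼b = can-close a b b b (∼.sym {a} {b} a∼b) (∼.refl {b}) (λ i → 𝔪^-refl refl)

  module _ (a b : 𝕊) where
    distances : Pred |ℝ| 0ℓ
    distances r = ∃[ â ] ∃[ b̂ ] â ∼ a × b̂ ∼ b × r ≡ distKᵈ (proj₁ â) (proj₁ b̂)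

    distℙ-isGLB : IsGLB ℝ._≤_ distances (distℙ a b)
    distℙ-isGLB = inf-isGLB {distances} (_ , a , b , ∼.refl {a} , ∼.refl {b} , ≡.refl)
      (λ { (â , b̂ , _ , _ , ≡.refl) → 0≤‖‖ (proj₁ â Kᵈ.- proj₁ b̂) })

  open IsLipschitz

  lipschitz⇒contracts : (f : Ω) → IsLipschitz projective (to f)
  lipschitz⇒contracts f .integral = Ω.integral f
  lipschitz⇒contracts f .contracts {n} {a} {b} c = ‖‖≤⇒𝔪^ n (≤.trans (Ω.lipschitz f a b)
    (≤.trans (proj₁ (distℙ-isGLB a b) (canonical a , canonical b , canonical∼ a , canonical∼ b , ≡.refl))
      (𝔪^⇒‖‖≤ n c)))

  -- By `can-close`, every pair of representatives is at least as far apart as the two values, so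
  -- the values are bounded by the infimum. Equal lines are close at every positive level, which
  -- gives `cong`.
  contracts⇒lipschitz : ∀ {h} → IsLipschitz projective h → Ω
  contracts⇒lipschitz {h} lip = record
    { to        = h
    ; cong      = λ {a} {b} a∼b i → (separated-≈ λ n → contracts lip (∼⇒close {n} {a} {b} a∼b) i)
    ; integral  = integral lip
    ; lipschitz = λ a b → proj₂ (distℙ-isGLB a b) _ λ { (â , b̂ , â∼a , b̂∼b , ≡.refl) →
        ‖‖-compare (λ i → 𝔪^-- (integral lip a i) (integral lip b i))
          (λ n d → contracts lip (can-close a b â b̂ â∼a b̂∼b d)) }
    }

-- Points of projective space over the residue field.

punchIn-elim : ∀ {n} (P : Fin (suc n) → Set) j → P j → (∀ k → P (Fin.punchIn j k)) → ∀ i → P i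
punchIn-elim P j pj p i with j Fin.≟ i
... | yes ≡.refl = pj
... | no  j≢i    = ≡.subst P (Fin.punchIn-punchOut j≢i) (p (Fin.punchOut j≢i))

module KakeyaSets (em : Classical) (ℝ : RealNumbers) (K : LocalField) (e : ℕ) where
  private
    module ℝ = RealNumbers ℝ
    module ≤ = TotalOrder ℝ.totalOrder
  open LocalField K hiding (zero; _⁻¹)
  open LocalFieldProperties em K
  open IntegerSolver commutativeRing
  open OrderedField ℝ
  open ClassicalAnalysis em ℝ
  open LipschitzFunctions em ℝ K e
  open ProjectiveSpace em ℝ K e
  open Kakeya em ℝ K (suc e) hiding (0≤1)
  open Ω using (to)
  open IsLipschitz

  -- This is 1 + q + ⋯ + q^(k-1), the number of lines in the k-dimensional space over the residue
  -- field.
  pointCount : ℕ → ℕ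
  pointCount zero    = 0
  pointCount (suc k) = q ℕ.^ k ℕ.+ pointCount k

  -- Representatives of the points of projective space over the residue field:
  -- the first coordinate is either 1, and the others are arbitrary, or 0, and
  -- the others form a point of a smaller space.
  base : ∀ k → Fin (pointCount k) → Fin k → Carrier
  base′ : ∀ k → Fin (q ℕ.^ k) ⊎ Fin (pointCount k) → Fin (suc k) → Carrier
  base (suc k) i = base′ k (Fin.splitAt (q ℕ.^ k) i)
  base′ k (inj₁ i) = 1# ∷ liftᵛ i
  base′ k (inj₂ i) = 0# ∷ base k i

  pivot : ∀ k → Fin (pointCount k) → Fin k
  pivot′ : ∀ k → Fin (q ℕ.^ k) ⊎ Fin (pointCount k) → Fin (suc k)
  pivot (suc k) i = pivot′ k (Fin.splitAt (q ℕ.^ k) i)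
  pivot′ k (inj₁ i) = zero
  pivot′ k (inj₂ i) = suc (pivot k i)

  base-R : ∀ k i l → base k i l ∈ R
  base′-R : ∀ k i l → base′ k i l ∈ R
  base-R (suc k) i = base′-R k (Fin.splitAt (q ℕ.^ k) i)
  base′-R k (inj₁ i) zero    = R-1
  base′-R k (inj₁ i) (suc l) = liftᵛ-R i l
  base′-R k (inj₂ i) zero    = R-0
  base′-R k (inj₂ i) (suc l) = base-R k i l

  base-pivot : ∀ k i → base k i (pivot k i) ≈ 1#
  base-pivot (suc k) i = helper (Fin.splitAt (q ℕ.^ k) i)
    where
    helper : ∀ i → base′ k i (pivot′ k i) ≈ 1#
    helper (inj₁ i) = refl
    helper (inj₂ i) = base-pivot k i

  base-below : ∀ k i l → l Fin.< pivot k i → base k i l ≈ 0#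
  base-below (suc k) i = helper (Fin.splitAt (q ℕ.^ k) i)
    where
    helper : ∀ i l → l Fin.< pivot′ k i → base′ k i l ≈ 0#
    helper (inj₂ i) zero    _           = refl
    helper (inj₂ i) (suc l) (ℕ.s≤s l<p) = base-below k i l l<p

  base-injective : ∀ k {i i′} → (∀ l → base k i l - base k i′ l ∈ 𝔪^ 1) → i ≡ i′
  base-injective (suc k) {i} {i′} h = ≡.trans (≡.sym (Fin.join-splitAt (q ℕ.^ k) _ i))
    (≡.trans (≡.cong (Fin.join (q ℕ.^ k) _) (helper (Fin.splitAt (q ℕ.^ k) i) (Fin.splitAt (q ℕ.^ k) i′) h))
      (Fin.join-splitAt (q ℕ.^ k) _ i′))
    where
    1-0∉𝔪 : 1# - 0# ∉ 𝔪^ 1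
    1-0∉𝔪 p = 1∉𝔪^1 (𝔪^-resp p 𝔪^-0)
    helper : ∀ i i′ → (∀ l → base′ k i l - base′ k i′ l ∈ 𝔪^ 1) → i ≡ i′
    helper (inj₁ i) (inj₁ i′) h = ≡.cong inj₁ (liftᵛ-injective (h ∘ suc))
    helper (inj₁ i) (inj₂ i′) h = ⊥-elim (1-0∉𝔪 (h zero))
    helper (inj₂ i) (inj₁ i′) h = ⊥-elim (1-0∉𝔪 (𝔪^-sym (h zero)))
    helper (inj₂ i) (inj₂ i′) h = ≡.cong inj₂ (base-injective k (h ∘ suc))

  base-covers : ∀ k (x : Fin k → Carrier) j → (∀ l → x l ∈ R) → x j ≈ 1# → (∀ l → l Fin.< j → x l ∈ 𝔪^ 1) →
                ∃[ i ] pivot k i ≡ j × (∀ l → x l - base k i l ∈ 𝔪^ 1)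
  base-covers (suc k) x zero x∈R x₀≈1 _ =
    residueᵛ (x ∘ suc) ↑ˡ pointCount k ,
    ≡.cong (pivot′ k) split ,
    ≡.subst (λ i → ∀ l → x l - base′ k i l ∈ 𝔪^ 1) (≡.sym split)
      (λ { zero → 𝔪^-refl x₀≈1 ; (suc l) → liftᵛ-residueᵛ (x∈R ∘ suc) l })
    where
    split : Fin.splitAt (q ℕ.^ k) (residueᵛ (x ∘ suc) ↑ˡ pointCount k) ≡ inj₁ (residueᵛ (x ∘ suc))
    split = Fin.splitAt-↑ˡ (q ℕ.^ k) _ (pointCount k)
  base-covers (suc k) x (suc j) x∈R xj≈1 below
    with base-covers k (x ∘ suc) j (x∈R ∘ suc) xj≈1 (λ l l<j → below (suc l) (ℕ.s≤s l<j))
  ... | i , pivot≡ , close =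
    (q ℕ.^ k) ↑ʳ i ,
    ≡.trans (≡.cong (pivot′ k) split) (≡.cong suc pivot≡) ,
    ≡.subst (λ i → ∀ l → x l - base′ k i l ∈ 𝔪^ 1) (≡.sym split)
      (λ { zero → 𝔪^-- (below zero (ℕ.s≤s ℕ.z≤n)) 𝔪^-0 ; (suc l) → close l })
    where
    split : Fin.splitAt (q ℕ.^ k) ((q ℕ.^ k) ↑ʳ i) ≡ inj₂ i
    split = Fin.splitAt-↑ʳ (q ℕ.^ k) (pointCount k) i

  -- The residue classes of projective space as affine charts.

  Node : Set
  Node = Fin (pointCount (suc e))

  origin : Node → Value
  origin = base (suc e)

  pivotAt : Node → Fin (suc e)
  pivotAt = pivot (suc e)

  abstract
    node-exists : ∀ a → ∃[ i ] can a (pivotAt i) ≈ 1# × (∀ l → can a l - origin i l ∈ 𝔪^ 1)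
    node-exists a = let (j , cj≈1 , below) = can-pivot a
                        (i , pivot≡ , close) = base-covers (suc e) (can a) j (can-R a) cj≈1 below
                    in i , ≡.subst (λ j → can a j ≈ 1#) (≡.sym pivot≡) cj≈1 , close

    node : 𝕊 → Node
    node a = proj₁ (node-exists a)

    can-at-pivot : ∀ a → can a (pivotAt (node a)) ≈ 1#
    can-at-pivot a = proj₁ (proj₂ (node-exists a))

    can-origin : ∀ a l → can a l - origin (node a) l ∈ 𝔪^ 1
    can-origin a = proj₂ (proj₂ (node-exists a))

  node-unique : ∀ {a i} → (∀ l → can a l - origin i l ∈ 𝔪^ 1) → node a ≡ i
  node-unique {a} h = base-injective (suc e) λ l → 𝔪^-trans (𝔪^-sym (can-origin a l)) (h l)

  node-cong : ∀ {n a b} → Domain.close projective (suc n) a b → node a ≡ node b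
  node-cong {a = a} {b} c = node-unique {a} λ l → 𝔪^-trans (𝔪^-weaken (c l)) (can-origin b l)

  module Glue (i : Node) (y : Fin e → Carrier) (y∈R : ∀ k → y k ∈ R) where
    -- The inserted 0 keeps the pivot coordinate of `vector` equal to 1, so that `vector` is already
    -- canonical and `can` gives it back.
    offset : Value
    offset = insertAt y (pivotAt i) 0#

    vector : Value
    vector l = origin i l + π * offset l

    offset-R : ∀ l → offset l ∈ R
    offset-R = punchIn-elim _ (pivotAt i)
      (≡.subst R (≡.sym (Vector.insertAt-lookup y (pivotAt i) 0#)) R-0)
      (λ k → ≡.subst R (≡.sym (Vector.insertAt-punchIn y (pivotAt i) 0# k)) (y∈R k))

    vector-R : ∀ l → vector l ∈ R
    vector-R l = R-+ (base-R (suc e) i l) (R-* π∈R (offset-R l))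

    vector-pivot : IsPivot vector (pivotAt i)
    vector-pivot = trans (+-cong (base-pivot (suc e) i)
        (trans (*-congˡ (reflexive (Vector.insertAt-lookup y (pivotAt i) 0#))) (zeroʳ π))) (+-identityʳ 1#) ,
      λ l l<p → 𝔪^-+ (𝔪^-≈0 (base-below (suc e) i l l<p)) (π*-𝔪^ (offset-R l))

    glued : 𝕊
    glued = vector , pivot⇒‖‖≈1 vector-R (proj₁ vector-pivot)

    can-glued : ∀ l → can glued l ≈ vector l
    can-glued = can-of-canonical glued vector-pivot

    node-glued : node glued ≡ i
    node-glued = node-unique {glued} λ l → 𝔪^-cong
      (trans (solve 2 (λ o x → x := (o :+ x) :- o) refl (origin i l) (π * offset l)) (+-congʳ (sym (can-glued l))))
      (π*-𝔪^ (offset-R l))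

  subᵛ : Node → Value → Fin e → Carrier
  subᵛ i x k = (x (Fin.punchIn (pivotAt i) k) - origin i (Fin.punchIn (pivotAt i) k)) /π

  -- Canonical vectors in one class share the pivot, where they are 1, and differ by arbitrary
  -- multiples of π in the other `e` coordinates. Each class is thus affine space scaled by π.
  projective-chart : Chart projective affine (pointCount (suc e))
  projective-chart = record
    { node       = node
    ; sub        = λ a → subᵛ (node a) (can a) , λ k → /π-𝔪^ (can-origin a _)
    ; glue       = λ i (y , y∈R) → Glue.glued i y y∈R
    ; node-glue  = λ i (y , y∈R) → Glue.node-glued i y y∈R
    ; sub-glue   = λ i (y , y∈R) n → sub-glued i y y∈R
    ; glue-sub   = λ a n l → 𝔪^-refl (sym (trans (Glue.can-glued (node a) _ _ l) (glue-sub a l)))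
    ; node-close = λ {_} {a} {b} → node-cong {a = a} {b}
    ; sub-close  = λ {n} {a} {b} c k → ≡.subst (λ i → subᵛ (node a) (can a) k - subᵛ i (can b) k ∈ 𝔪^ n)
        (node-cong {a = a} {b} c) (/π--𝔪^ (𝔪^---cong (c _) (𝔪^-refl refl)))
    ; glue-close = λ {n} {y} {y′} i c l → 𝔪^-cong₂
        (sym (Glue.can-glued i (proj₁ y) (proj₂ y) l)) (sym (Glue.can-glued i (proj₁ y′) (proj₂ y′) l))
        (𝔪^-+-cong (𝔪^-refl refl) (π*--𝔪^ (offset-close i (proj₁ y) (proj₁ y′) c l)))
    }
    where
    sub-glued : ∀ i y y∈R {n} k →
      subᵛ (node (Glue.glued i y y∈R)) (can (Glue.glued i y y∈R)) k - y k ∈ 𝔪^ n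
    sub-glued i y y∈R {n} k = ≡.subst (λ j → subᵛ j (can glued) k - y k ∈ 𝔪^ n) (≡.sym node-glued)
      (𝔪^-refl (/π-unique (trans (+-congʳ (can-glued _))
        (trans (solve 2 (λ o x → (o :+ x) :- o := x) refl _ _)
          (*-congˡ (reflexive (Vector.insertAt-punchIn y (pivotAt i) 0# k)))))))
      where open Glue i y y∈R

    glue-sub : ∀ a l → origin (node a) l + π * insertAt (subᵛ (node a) (can a)) (pivotAt (node a)) 0# l ≈ can a l
    glue-sub a = punchIn-elim _ (pivotAt (node a))
      (trans (+-cong (base-pivot (suc e) (node a))
        (trans (*-congˡ (reflexive (Vector.insertAt-lookup _ (pivotAt (node a)) 0#))) (zeroʳ π)))
        (trans (+-identityʳ 1#) (sym (can-at-pivot a))))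
      (λ k → trans (+-congˡ (trans (*-congˡ (reflexive (Vector.insertAt-punchIn _ (pivotAt (node a)) 0# k))) (π*/π _)))
        (solve 2 (λ o x → o :+ (x :- o) := x) refl _ _))

    offset-close : ∀ i y y′ {n} → (∀ k → y k - y′ k ∈ 𝔪^ n) →
      ∀ l → insertAt y (pivotAt i) 0# l - insertAt y′ (pivotAt i) 0# l ∈ 𝔪^ n
    offset-close i y y′ c = punchIn-elim _ (pivotAt i)
      (𝔪^-refl (reflexive (≡.trans (Vector.insertAt-lookup y (pivotAt i) 0#) (≡.sym (Vector.insertAt-lookup y′ (pivotAt i) 0#)))))
      (λ k → 𝔪^-cong₂ (reflexive (≡.sym (Vector.insertAt-punchIn y (pivotAt i) 0# k)))
                       (reflexive (≡.sym (Vector.insertAt-punchIn y′ (pivotAt i) 0# k))) (c k))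

  -- The projection along a vector `x` with x_p = 1 onto the hyperplane y_p = 0,
  -- completed to a linear automorphism by the coordinate y_p: a line with
  -- direction `x` through `y` passes through 0 exactly when the last `e`
  -- coordinates vanish.
  shear : Fin (suc e) → Value → Value → Value
  shear p x y = y p ∷ λ k → y (Fin.punchIn p k) - y p * x (Fin.punchIn p k)

  unshear : Fin (suc e) → Value → Value → Value
  unshear p x z = insertAt (λ k → z (suc k) + z zero * x (Fin.punchIn p k)) p (z zero)

  shear-unshear : ∀ p x z i → shear p x (unshear p x z) i ≈ z i
  shear-unshear p x z zero    = reflexive (Vector.insertAt-lookup _ p (z zero))
  shear-unshear p x z (suc k) = trans
    (+-cong (reflexive (Vector.insertAt-punchIn _ p (z zero) k))
      (-‿cong (*-congʳ (reflexive (Vector.insertAt-lookup _ p (z zero))))))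
    (solve 2 (λ a b → (a :+ b) :- b := a) refl _ _)

  module _ (p : Fin (suc e)) {x x′ : Value} (x∈R : ∀ i → x i ∈ R) where

    shear-R : ∀ {y} → (∀ i → y i ∈ R) → ∀ i → shear p x y i ∈ R
    shear-R y∈R zero    = y∈R p
    shear-R y∈R (suc k) = 𝔪^-- (y∈R _) (R-* (y∈R p) (x∈R _))

    unshear-R : ∀ {z} → (∀ i → z i ∈ R) → ∀ i → unshear p x z i ∈ R
    unshear-R {z} z∈R = punchIn-elim _ p
      (≡.subst R (≡.sym (Vector.insertAt-lookup _ p (z zero))) (z∈R zero))
      (λ k → ≡.subst R (≡.sym (Vector.insertAt-punchIn _ p (z zero) k)) (R-+ (z∈R (suc k)) (R-* (z∈R zero) (x∈R _))))

    module _ {n : ℕ} (x-x′ : ∀ i → x i - x′ i ∈ 𝔪^ n) where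

      shear-close : ∀ {y y′} → (∀ i → y′ i ∈ R) → (∀ i → y i - y′ i ∈ 𝔪^ n) →
                    ∀ i → shear p x y i - shear p x′ y′ i ∈ 𝔪^ n
      shear-close y′∈R h zero    = h p
      shear-close y′∈R h (suc k) = 𝔪^---cong (h _) (𝔪^-*-cong (y′∈R p) (x∈R _) (h p) (x-x′ _))

      unshear-close : ∀ {z z′} → (∀ i → z′ i ∈ R) → (∀ i → z i - z′ i ∈ 𝔪^ n) →
                      ∀ i → unshear p x z i - unshear p x′ z′ i ∈ 𝔪^ n
      unshear-close {z} {z′} z′∈R h = punchIn-elim _ p
        (𝔪^-cong₂ (reflexive (≡.sym (Vector.insertAt-lookup _ p (z zero))))
                   (reflexive (≡.sym (Vector.insertAt-lookup _ p (z′ zero)))) (h zero))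
        (λ k → 𝔪^-cong₂ (reflexive (≡.sym (Vector.insertAt-punchIn _ p (z zero) k)))
                         (reflexive (≡.sym (Vector.insertAt-punchIn _ p (z′ zero) k)))
          (𝔪^-+-cong (h (suc k)) (𝔪^-*-cong (z′∈R zero) (x∈R _) (h zero) (x-x′ _))))

  shear-reflects : ∀ p {x n y y′} → (∀ i → x i ∈ R) → (∀ i → shear p x y i - shear p x y′ i ∈ 𝔪^ n) →
                   ∀ i → y i - y′ i ∈ 𝔪^ n
  shear-reflects p {x} {n} {y} {y′} x∈R h = punchIn-elim _ p (h zero)
    (λ k → 𝔪^-cong
      (solve 5 (λ a b c c′ x → ((a :- c :* x) :- (b :- c′ :* x)) :+ (c :- c′) :* x := a :- b) refl _ _ (y p) (y′ p) _)
      (𝔪^-+ (h (suc k)) (𝔪^-* (h zero) (x∈R _))))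

  -- Sheared functions, and lines through the origin as zeros.

  sheared : (𝕊 → Value) → 𝕊 → Value
  sheared h a = shear (pivotAt (node a)) (can a) (h a)

  unsheared : (𝕊 → Value) → 𝕊 → Value
  unsheared h a = unshear (pivotAt (node a)) (can a) (h a)

  -- At a positive level close points share the class and hence the pivot, so the same formula
  -- applies to both, with coefficients `can a` and `can b` that are themselves congruent. At level
  -- 0 pivots may differ, but integrality is enough.
  sheared-lipschitz : ∀ {h} → IsLipschitz projective h → IsLipschitz projective (sheared h)
  sheared-lipschitz lip .integral a = shear-R (pivotAt (node a)) {x′ = can a} (can-R a) (integral lip a)
  sheared-lipschitz lip .contracts {zero} {a} {b} c i = 𝔪^--
    (shear-R (pivotAt (node a)) {x′ = can a} (can-R a) (integral lip a) i)
    (shear-R (pivotAt (node b)) {x′ = can b} (can-R b) (integral lip b) i)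
  sheared-lipschitz {h} lip .contracts {suc n} {a} {b} c i = ≡.subst
    (λ j → sheared h a i - shear (pivotAt j) (can b) (h b) i ∈ 𝔪^ suc n) (node-cong {a = a} {b} c)
    (shear-close (pivotAt (node a)) (can-R a) c (integral lip b) (contracts lip {suc n} {a} {b} c) i)

  unsheared-lipschitz : ∀ {h} → IsLipschitz projective h → IsLipschitz projective (unsheared h)
  unsheared-lipschitz lip .integral a = unshear-R (pivotAt (node a)) {x′ = can a} (can-R a) (integral lip a)
  unsheared-lipschitz lip .contracts {zero} {a} {b} c i = 𝔪^--
    (unshear-R (pivotAt (node a)) {x′ = can a} (can-R a) (integral lip a) i)
    (unshear-R (pivotAt (node b)) {x′ = can b} (can-R b) (integral lip b) i)
  unsheared-lipschitz {h} lip .contracts {suc n} {a} {b} c i = ≡.subst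
    (λ j → unsheared h a i - unshear (pivotAt j) (can b) (h b) i ∈ 𝔪^ suc n) (node-cong {a = a} {b} c)
    (unshear-close (pivotAt (node a)) (can-R a) c (integral lip b) (contracts lip {suc n} {a} {b} c) i)

  -- The neighbourhood `N[ n ]` as a congruence with explicit witnesses instead of an infimum.
  Meets : ℕ → Value → (𝕊 → Value) → Set
  Meets n x h = ∃[ a ] ∃[ t ] t ∈ R × (∀ i → x i - (t * can a i + h a i) ∈ 𝔪^ n)

  -- Since `can a` is 1 at the pivot, the congruence there forces `t` to be `- h a p` modulo 𝔪ⁿ.
  -- Eliminating `t` from the other coordinates leaves the sheared ones.
  Meets-0⇒HasZero : ∀ {n h} → Meets n Kᵈ.0# h → HasZero projective n (sheared h)
  Meets-0⇒HasZero {n} {h} (a , t , _ , m) = a , λ k → 𝔪^-cong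
    (trans (+-congʳ (*-congʳ (+-congˡ (-‿cong (+-congʳ (trans (*-congˡ (can-at-pivot a)) (*-identityʳ t)))))))
      (solve 4 (λ t x hk hp → (con (+ 0) :- (t :+ hp)) :* x :- (con (+ 0) :- (t :* x :+ hk)) := hk :- hp :* x)
        refl t (can a (Fin.punchIn p k)) (h a (Fin.punchIn p k)) (h a p)))
    (𝔪^-- (𝔪^-* (m p) (can-R a _)) (m _))
    where
    p : Fin (suc e)
    p = pivotAt (node a)

  HasZero⇒Meets-0 : ∀ {n h} → IsLipschitz projective h → HasZero projective n (sheared h) → Meets n Kᵈ.0# h
  HasZero⇒Meets-0 {n} {h} lip (a , z) = a , - h a p , R-neg (integral lip a p) , punchIn-elim _ p
    (𝔪^-≈0 (trans (+-congˡ (-‿cong (+-congʳ (trans (*-congˡ (can-at-pivot a)) (*-identityʳ _)))))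
      (solve 1 (λ y → con (+ 0) :- (:- y :+ y) := con (+ 0)) refl _)))
    (λ k → 𝔪^-cong
      (solve 3 (λ hk hp x → :- (hk :- hp :* x) := con (+ 0) :- (:- hp :* x :+ hk)) refl _ _ _)
      (𝔪^-neg (z k)))
    where
    p : Fin (suc e)
    p = pivotAt (node a)

  -- If no point of `N f` were congruent to `x` modulo `𝔪^ suc n`, all distances would be at least
  -- q⁻ⁿ, and so would their infimum. The gap in the norm stands in for the compactness of `N f`.
  N⇒Meets : ∀ {n f x} → N[ suc n ] f x → Meets (suc n) x (to f)
  N⇒Meets {n} {f} {x} (_ , inf≤) = double-negation λ none → <⇒≱ (q^--strict n)
    (≤.trans (proj₂ isGLB (q^- [ + n ]) λ { (y , (a , t , t∈R , y≈) , ≡.refl) →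
      ∉𝔪^⇒‖‖≥ n {x Kᵈ.- y} λ m → none (a , t , t∈R , λ i → 𝔪^-cong (+-congˡ (-‿cong (y≈ i))) (m i)) }) inf≤)
    where
    a₀ : 𝕊
    a₀ = Domain.point projective
    isGLB : IsGLB ℝ._≤_ (λ r → ∃[ y ] y ∈ N f × r ≡ distKᵈ x y) _
    isGLB = inf-isGLB (_ , (1# · can a₀) Kᵈ.+ to f a₀ , (a₀ , 1# , R-1 , λ i → refl) , ≡.refl)
      (λ { (y , _ , ≡.refl) → 0≤‖‖ (x Kᵈ.- y) })

  Meets⇒N : ∀ {n f x} → x ∈ Rᵈ → Meets n x (to f) → N[ n ] f x
  Meets⇒N {n} {f} {x} x∈R (a , t , t∈R , m) = x∈R ,
    ≤.trans (proj₁ isGLB (y , y∈N , ≡.refl)) (𝔪^⇒‖‖≤ n {x Kᵈ.- y} m)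
    where
    y : Value
    y = (t · can a) Kᵈ.+ to f a
    y∈N : y ∈ N f
    y∈N = a , t , t∈R , λ i → refl
    isGLB : IsGLB ℝ._≤_ (λ r → ∃[ y ] y ∈ N f × r ≡ distKᵈ x y) _
    isGLB = inf-isGLB (_ , y , y∈N , ≡.refl) (λ { (y , _ , ≡.refl) → 0≤‖‖ (x Kᵈ.- y) })

-- The exponent as a fraction.

module RationalSum where
  open MonoidSum ℕ.+-0-commutativeMonoid using () renaming (sum to ℕ-sum)
  open MonoidSum ℚ.+-0-commutativeMonoid using () renaming (sum to ℚ-sum)
  open ℤSolver.+-*-Solver

  toℚᵘ-/ : ∀ i n .{{_ : NonZero n}} → toℚᵘ (i ℚ./ n) ≃ i ℚᵘ./ n
  toℚᵘ-/ i (suc n) = ℚ.toℚᵘ-fromℚᵘ (ℚᵘ.mkℚᵘ i n)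

  -- Each summand is `c i / n`. In unnormalised rationals addition is a formula in numerators and
  -- denominators, with no gcd.
  sum-over-common-denominator : ∀ {k} n .{{_ : NonZero n}} (a c : Fin k → ℕ) (a≢0 : ∀ i → NonZero (a i)) →
    (∀ i → c i ℕ.* a i ≡ n) → toℚᵘ (ℚ-sum λ i → ((+ 1) ℚ./ a i) {{a≢0 i}}) ≃ (+ ℕ-sum c) ℚᵘ./ n
  sum-over-common-denominator {zero}  (suc n) a c a≢0 h = *≡* ≡.refl
  sum-over-common-denominator {suc k} n a c a≢0 h = ℚᵘ.≃-trans
    (ℚ.toℚᵘ-homo-+ (((+ 1) ℚ./ a zero) {{a≢0 zero}}) (ℚ-sum λ i → ((+ 1) ℚ./ a (suc i)) {{a≢0 (suc i)}}))
    (ℚᵘ.≃-trans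
      (ℚᵘ.+-cong (toℚᵘ-/ (+ 1) (a zero) {{a≢0 zero}})
        (sum-over-common-denominator n (a ∘ suc) (c ∘ suc) (a≢0 ∘ suc) (h ∘ suc)))
      (add n (a zero) {{a≢0 zero}} (c zero) (ℕ-sum (c ∘ suc)) (h zero)))
    where
    add : ∀ n .{{_ : NonZero n}} a .{{_ : NonZero a}} c s → c ℕ.* a ≡ n →
          (+ 1) ℚᵘ./ a ℚᵘ.+ (+ s) ℚᵘ./ n ≃ (+ (c ℕ.+ s)) ℚᵘ./ n
    -- Writing `n` as `c * a` turns the cross-multiplied equation into a polynomial identity.
    add (suc n) (suc a) c s e = *≡* (≡.subst₂
      (λ ν σ → (+ 1 ℤ.* ν ℤ.+ + s ℤ.* + suc a) ℤ.* ν ≡ σ ℤ.* (+ suc a ℤ.* ν))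
      (≡.trans (≡.sym (ℤ.pos-* c (suc a))) (≡.cong +_ e)) (≡.sym (ℤ.pos-+ c s))
      (solve 3 (λ a c s → (con (+ 1) :* (c :* a) :+ s :* a) :* (c :* a) := (c :+ s) :* (a :* (c :* a))) ≡.refl (+ suc a) (+ c) (+ s)))

  cross-multiply : ∀ p s n .{{_ : NonZero n}} → toℚᵘ p ≃ (+ s) ℚᵘ./ n → ↥ p ℤ.* + n ≡ + s ℤ.* ↧ p
  cross-multiply (ℚ.mkℚ _ _ _) s (suc n) (*≡* h) = h

-- The power S / Q and the count at the top level.

module ExpectedMeasure (em : Classical) (ℝ : RealNumbers) (K : LocalField) (e : ℕ) where
  private
    module ℝ = RealNumbers ℝ
    module ≤ = TotalOrder ℝ.totalOrder
    module ℝExp = Exp ℝ.semiring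
    module ℝSum = SemiringSum ℝ.semiring
    module ℝSolver = IntegerSolver ℝ.commutativeRing
  open ℝ using () renaming (Carrier to |ℝ|)
  open LocalField K hiding (zero; _⁻¹)
  open LocalFieldProperties em K
  open IntegerSolver commutativeRing
  open OrderedField ℝ
  open ClassicalAnalysis em ℝ
  open LipschitzFunctions em ℝ K e
  open ProjectiveSpace em ℝ K e
  open KakeyaSets em ℝ K e
  open Kakeya em ℝ K (suc e) hiding (0≤1)
  open Ω using (to)
  open IsLipschitz

  Q S : ℕ
  Q = q ℕ.^ e
  S = pointCount (suc e)

  instance
    Q-nonZero : NonZero Q
    Q-nonZero = ℕ.m^n≢0 q e

  open MonoidSum ℕ.+-0-commutativeMonoid using () renaming (sum to ℕ-sum)

  pointCount-sum : ∀ k → ℕ-sum {k} (λ i → q ℕ.^ (k ℕ.∸ suc (Fin.toℕ i))) ≡ pointCount k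
  pointCount-sum zero    = ≡.refl
  pointCount-sum (suc k) = ≡.cong (q ℕ.^ k ℕ.+_) (pointCount-sum k)

  -- The term 1 / qⁱ is q^(e-i) / `Q`. Cross-multiplying avoids computing the normalised numerator
  -- and denominator.
  exponent-value : ↥ exponent ℤ.* + Q ≡ + S ℤ.* ↧ exponent
  exponent-value = ≡.subst (λ s → ↥ exponent ℤ.* + Q ≡ + s ℤ.* ↧ exponent) (pointCount-sum (suc e))
    (RationalSum.cross-multiply exponent _ Q
      (RationalSum.sum-over-common-denominator Q (λ i → q ℕ.^ Fin.toℕ i) (λ i → q ℕ.^ (e ℕ.∸ Fin.toℕ i))
        (λ i → ℕ.m^n≢0 q (Fin.toℕ i))
        (λ i → ≡.trans (≡.sym (ℕ.^-distribˡ-+-* q (e ℕ.∸ Fin.toℕ i) (Fin.toℕ i)))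
          (≡.cong (q ℕ.^_) (ℕ.m∸n+n≡m (Fin.toℕ≤pred[n] i))))))

  -- If `exponent` is a / D, then a * Q = S * D, so xᵃ = y^(Q * a) = (y^S)^D and y^S is the root of
  -- order D.
  power-of-root : ∀ {x y} → ℝ.0# ℝ.≤ y → x ℝ.≈ y ℝ.^ Q → x ^ℚ exponent ℝ.≈ y ℝ.^ S
  power-of-root {x} {y} 0≤y x≈ = power (↥ exponent) (↧ₙ exponent) exponent-value
    where
    power : ∀ i D .{{_ : NonZero D}} → i ℤ.* + Q ≡ + S ℤ.* + D → root D (x ℝ.^ℤ i) ℝ.≈ y ℝ.^ S
    power (+ a) D eq = root-unique D (^-nonNeg 0≤y S) (begin
      x ℝ.^ a              ≈⟨ ℝExp.^-congˡ a x≈ ⟩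
      (y ℝ.^ Q) ℝ.^ a      ≈⟨ ℝExp.^-assocʳ y Q a ⟩
      y ℝ.^ (Q ℕ.* a)      ≡⟨ ≡.cong (y ℝ.^_) (≡.trans (ℕ.*-comm Q a) (ℤ.+-injective
                                (≡.trans (ℤ.pos-* a Q) (≡.trans eq (≡.sym (ℤ.pos-* S D)))))) ⟩
      y ℝ.^ (S ℕ.* D)      ≈⟨ ℝExp.^-assocʳ y S D ⟨
      (y ℝ.^ S) ℝ.^ D      ∎)
      where open SetoidReasoning ℝ.setoid
    power -[1+ a ] D eq = ⊥-elim (negative Q (≡.trans eq (≡.sym (ℤ.pos-* S D))))
      where
      negative : ∀ n .{{_ : NonZero n}} {m} → -[1+ a ] ℤ.* + n ≢ + m
      negative (suc n) ()

  -- The proportion of functions on a residue class of projective space whose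
  -- lines miss the origin.
  missing : ℕ → |ℝ|
  missing n = ℝ.1# ℝ.- u n ℝ.* ℝ.fromℕ Q ℝ.⁻¹

  1-u-suc : ∀ n → ℝ.1# ℝ.- u (suc n) ℝ.≈ missing n ℝ.^ Q
  1-u-suc n = ℝSolver.solve 1
    (λ x → ℝSolver.con (+ 1) ℝSolver.:- (ℝSolver.con (+ 1) ℝSolver.:- x) ℝSolver.:= x) ℝ.refl _

  Q⁻¹≤1 : ℝ.fromℕ Q ℝ.⁻¹ ℝ.≤ ℝ.1#
  Q⁻¹≤1 = ≤.≤-respˡ-≈ (ℝ.*-identityˡ _) (≤.≤-respʳ-≈ (*-⁻¹-cancel Q)
    (*-monoʳ-≤ _ (proj₁ (⁻¹-pos (fromℕ-pos Q))) (1≤fromℕ Q)))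

  -- A mutual induction with `missing-bounds`, whose lower bound supplies the nonnegative base that
  -- `power-of-root` asks for.
  u-bounds : ∀ n → ℝ.0# ℝ.≤ u n × u n ℝ.≤ ℝ.1#
  missing-bounds : ∀ n → ℝ.0# ℝ.≤ missing n × missing n ℝ.≤ ℝ.1#
  u-bounds zero    = 0≤1 , ≤.refl
  u-bounds (suc n) =
    nonNeg-diff (≤.trans (^-mono-≤ (proj₁ (missing-bounds n)) (proj₂ (missing-bounds n)) Q) (≤.reflexive (1^n≈1 Q))) ,
    x-y≤x (^-nonNeg (proj₁ (missing-bounds n)) Q)
  missing-bounds n =
    nonNeg-diff (≤.trans (*-monoʳ-≤ _ 0≤Q⁻¹ (proj₂ (u-bounds n))) (≤.trans (≤.reflexive (ℝ.*-identityˡ _)) Q⁻¹≤1)) ,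
    x-y≤x (ℝ.*-nonNeg (proj₁ (u-bounds n)) 0≤Q⁻¹)
    where
    0≤Q⁻¹ : ℝ.0# ℝ.≤ ℝ.fromℕ Q ℝ.⁻¹
    0≤Q⁻¹ = proj₁ (⁻¹-pos (fromℕ-pos Q))

  projective-system : ∀ n → System projective (suc n) (missing n ℝ.^ S)
  projective-system n = System-resp
    (ℝExp.^-congˡ S (ℝ.+-congˡ (ℝ.-‿cong (ℝ.*-congʳ (ℝSolver.solve 1
      (λ x → ℝSolver.con (+ 1) ℝSolver.:- (ℝSolver.con (+ 1) ℝSolver.:- x) ℝSolver.:= x) ℝ.refl (u n))))))
    (Refine.refine projective-chart (affine-system n))

  singleton : Domain
  singleton = record { Point = ⊤ ; close = λ _ _ _ → ⊤ ; close-zero = λ _ _ → tt ; point = tt }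

  -- Distances on a point stay 0 under scaling, so a point is its own rescaled copy and each
  -- refinement adds one vector of digits.
  singleton-chart : Chart singleton singleton 1
  singleton-chart = record
    { node       = λ _ → zero
    ; sub        = id
    ; glue       = λ _ → id
    ; node-glue  = λ { zero _ → ≡.refl }
    ; sub-glue   = λ _ _ _ → tt
    ; glue-sub   = λ _ _ → tt
    ; node-close = λ _ → ≡.refl
    ; sub-close  = λ _ → tt
    ; glue-close = λ _ _ → tt
    }

  -- Functions on a point give the residue classes of Rᵈ.
  singleton-system : ∀ n → ∃ (System singleton n)
  singleton-system zero    = _ , system₀ singleton
  singleton-system (suc n) = _ , Refine.refine singleton-chart (proj₂ (singleton-system n))

  translation : ∀ {y : Value} → (∀ i → y i ∈ R) → Ω
  translation {y} y∈R = contracts⇒lipschitz {λ _ → y} record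
    { integral = λ _ → y∈R ; contracts = λ _ _ → 𝔪^-refl refl }

  -- Hitting probabilities and the expectation.

  module _ (μ : HaarMeasureKᵈ) (P : HaarProbabilityΩ) (m : ℕ) where

    private
      n : ℕ
      n = suc m

      ε : |ℝ|
      ε = q^- [ + n ]

    module σ = System (proj₂ (singleton-system n))

    residueClass : Fin σ.size → Value
    residueClass ξ = σ.function ξ tt

    _≈ᴷ_ : Rel Value 0ℓ
    x ≈ᴷ y = ∀ i → x i - y i ∈ 𝔪^ n

    ≈ᴷ-isEquivalence : IsEquivalence _≈ᴷ_
    ≈ᴷ-isEquivalence = record
      { refl = λ i → 𝔪^-refl refl ; sym = λ h i → 𝔪^-sym (h i) ; trans = λ h h′ i → 𝔪^-trans (h i) (h′ i) }

    Rᵈ-saturated : ∀ {x y} → x ≈ᴷ y → x ∈ Rᵈ → y ∈ Rᵈ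
    Rᵈ-saturated h x∈R i = 𝔪^-resp {0} (𝔪^-sym (𝔪^⊆R (h i))) (x∈R i)

    κ-reflexive : ∀ x y → x Kᵈ.≈ y → x ≈ᴷ y
    κ-reflexive _ _ e i = 𝔪^-refl (e i)

    κ-translate : ∀ g x y → x ≈ᴷ y → (g Kᵈ.+ x) ≈ᴷ (g Kᵈ.+ y)
    κ-translate g _ _ h i = 𝔪^-+-cong (𝔪^-refl refl) (h i)

    distKᵈ-close : ∀ x y → distKᵈ x y ℝ.< ε → x ≈ᴷ y
    distKᵈ-close x y d = ‖‖≤⇒𝔪^ n {x Kᵈ.- y} (proj₁ d)

    residueClass-R : ∀ ξ → residueClass ξ ∈ Rᵈ
    residueClass-R ξ = integral (σ.lipschitz ξ) tt

    residueClass-distinct : ∀ {ξ ξ′} → residueClass ξ ≈ᴷ residueClass ξ′ → ξ ≡ ξ′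
    residueClass-distinct h = σ.distinct λ _ → h

    residueClass-covers : ∀ x → x ∈ Rᵈ → ∃[ ξ ] x ≈ᴷ residueClass ξ
    residueClass-covers x x∈R = proj₁ covering , proj₂ covering tt
      where
      covering : ∃[ ξ ] ∀ (_ : ⊤) i → x i - σ.function ξ tt i ∈ 𝔪^ n
      covering = σ.covers {λ _ → x} record { integral = λ _ → x∈R ; contracts = λ _ _ → 𝔪^-refl refl }

    module κ = Cosets μ ≈ᴷ-isEquivalence κ-reflexive κ-translate (q^--pos n) distKᵈ-close Rᵈ-saturated
      residueClass residueClass-R residueClass-distinct residueClass-covers

    module τ = System (projective-system m)

    -- Unshearing makes the sheared representatives the tree functions `τ.function`, whose zeros
    -- have been counted.
    representative : Fin τ.size → Ω
    representative i = contracts⇒lipschitz (unsheared-lipschitz (τ.lipschitz i))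

    _≈Ω_ : Rel Ω 0ℓ
    f ≈Ω g = ∀ a i → to f a i - to g a i ∈ 𝔪^ n

    ≈Ω-isEquivalence : IsEquivalence _≈Ω_
    ≈Ω-isEquivalence = record
      { refl = λ a i → 𝔪^-refl refl ; sym = λ h a i → 𝔪^-sym (h a i) ; trans = λ h h′ a i → 𝔪^-trans (h a i) (h′ a i) }

    distΩ-close : ∀ f g → distΩ f g ℝ.< ε → f ≈Ω g
    distΩ-close f g d a = ‖‖≤⇒𝔪^ n {to f a Kᵈ.- to g a} (≤.trans (proj₁ isLUB (a , ≡.refl)) (proj₁ d))
      where
      isLUB : IsLUB ℝ._≤_ (λ r → ∃[ a ] r ≡ distKᵈ (to f a) (to g a)) (distΩ f g)
      -- The supremum exists because integral values are at distance at most 1, the norm at level 0.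
      isLUB = sup-isLUB (_ , a , ≡.refl) (λ { (b , ≡.refl) →
        𝔪^⇒‖‖≤ 0 {to f b Kᵈ.- to g b} λ i → 𝔪^-- (Ω.integral f b i) (Ω.integral g b i) })

    sheared-representative : ∀ j a i {k} → sheared (to (representative j)) a i - τ.function j a i ∈ 𝔪^ k
    sheared-representative j a i = 𝔪^-refl (shear-unshear (pivotAt (node a)) (can a) (τ.function j a) i)

    representative-distinct : ∀ {j j′} → representative j ≈Ω representative j′ → j ≡ j′
    representative-distinct {j} {j′} h = τ.distinct λ a i →
      𝔪^-trans (𝔪^-sym (sheared-representative j a i))
        (𝔪^-trans (shear-close (pivotAt (node a)) (can-R a) (λ _ → 𝔪^-refl refl) (Ω.integral (representative j′) a) (h a) i)
          (sheared-representative j′ a i))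

    representative-covers : ∀ f → ∃[ j ] f ≈Ω representative j
    representative-covers f = let (j , h) = τ.covers (sheared-lipschitz (lipschitz⇒contracts f)) in
      j , λ a → shear-reflects (pivotAt (node a)) (can-R a)
        λ i → 𝔪^-trans (h a i) (𝔪^-sym (sheared-representative j a i))

    ω-reflexive : ∀ f g → Group._≈_ Ω-group f g → f ≈Ω g
    ω-reflexive _ _ e a i = 𝔪^-refl (e a i)

    ω-translate : ∀ h f g → f ≈Ω g → Group._∙_ Ω-group h f ≈Ω Group._∙_ Ω-group h g
    ω-translate h _ _ p a i = 𝔪^-+-cong (𝔪^-refl refl) (p a i)

    module ω = Cosets P {_~_ = _≈Ω_} ≈Ω-isEquivalence ω-reflexive ω-translate (q^--pos n) distΩ-close _
      representative _ representative-distinct (λ f _ → representative-covers f)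

    N-saturated : ∀ f → κ.Saturated (N[ n ] f)
    N-saturated f {x} {y} h x∈N = let (a , t , t∈R , p) = N⇒Meets {m} {f} {x} x∈N in
      Meets⇒N {n} {f} {y} (Rᵈ-saturated h (proj₁ x∈N)) (a , t , t∈R , λ i → 𝔪^-trans (𝔪^-sym (h i)) (p i))

    N-saturatedΩ : ∀ x → ω.Saturated (λ f → x ∈ N[ n ] f)
    N-saturatedΩ x {f} {g} h x∈N = let (a , t , t∈R , p) = N⇒Meets {m} {f} {x} x∈N in
      Meets⇒N {n} {g} {x} (proj₁ x∈N) (a , t , t∈R , λ i → 𝔪^-trans (p i) (𝔪^-+-cong (𝔪^-refl refl) (h a i)))

    hits : Fin σ.size → Ω → Set
    hits ξ f = residueClass ξ ∈ N[ n ] f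

    hitsOrigin : Ω → Set
    hitsOrigin f = Kᵈ.0# ∈ N[ n ] f

    hitsAverage : Fin τ.size → |ℝ|
    hitsAverage j = average λ ξ → 𝟙 (hits ξ (representative j))

    -- `N[ n ] f` is a union of residue classes of Rᵈ, and which ones occur depends only on the
    -- class of `f` in Ω. So `X[ n ] μ` is a step function.
    X-constant : ∀ {j f} → f ∈ ω.cell j → X[ n ] μ f ≈∞ [ hitsAverage j ]
    X-constant {j} {f} h = ≈∞-trans
      (κ.measure≈mass (κ.saturated-borel (N-saturated f)) proj₁)
      SupEq.[ ℝ.trans (κ.saturated-mass (N-saturated f) proj₁) (average-cong λ ξ → ℝ.reflexive (𝟙-cong
        (N-saturatedΩ (residueClass ξ) {f} {representative j} h)
        (N-saturatedΩ (residueClass ξ) {representative j} {f} λ a i → 𝔪^-sym (h a i)))) ]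

    -- Required by `∫-cells`. The set `N f` contains `to f a`, at `t = 0`, so the residue class of
    -- that point is always hit.
    hitsAverage-pos : ∀ j → ℝ.0# ℝ.< hitsAverage j
    hitsAverage-pos j = *-pos (<-≤-trans 0<1 (≤.trans (≤.reflexive (ℝ.reflexive (≡.sym (𝟙-true hit))))
      (term≤sum (λ ξ → 𝟙 (hits ξ f)) (λ _ → 𝟙-nonNeg) ξ))) (⁻¹-pos (fromℕ-pos σ.size))
      where
      f : Ω
      f = representative j
      a : 𝕊
      a = Domain.point projective
      covering : ∃[ ξ ] to f a ≈ᴷ residueClass ξ
      covering = residueClass-covers _ (Ω.integral f a)
      ξ : Fin σ.size
      ξ = proj₁ covering
      hit : hits ξ f
      hit = N-saturated f {to f a} {residueClass ξ} (proj₂ covering) (Meets⇒N {n} {f} {to f a} (Ω.integral f a)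
        (a , 0# , R-0 , λ i → 𝔪^-refl (sym (trans (+-congʳ (zeroˡ _)) (+-identityˡ _)))))

    -- Translating f by a constant moves N(f), so every point is as likely to
    -- be hit as the origin.
    hit-mass : ∀ ξ → ω.mass (hits ξ) ℝ.≈ ω.mass hitsOrigin
    hit-mass ξ = [≈]-injective (≈∞-trans (≈∞-sym (ω.measure≈mass {hits ξ} (ω.saturated-borel {hits ξ} (λ {f} {g} → N-saturatedΩ x {f} {g})) _))
      (≈∞-trans (Analysis.BorelMeasure.cong (HaarMeasure.borelMeasure P) (ω.saturated-borel {hits ξ} (λ {f} {g} → N-saturatedΩ x {f} {g}))
        ((λ {f} → to-origin {f}) , λ {f} → from-origin {f}))
      (≈∞-trans (ω.translate-measure -x {hitsOrigin} (λ {f} {g} → N-saturatedΩ Kᵈ.0# {f} {g}))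
        (ω.measure≈mass {hitsOrigin} (ω.saturated-borel {hitsOrigin} (λ {f} {g} → N-saturatedΩ Kᵈ.0# {f} {g})) _))))
      where
      open Group Ω-group using (_∙_)
      x : Value
      x = residueClass ξ
      x∈R : ∀ i → x i ∈ R
      x∈R = residueClass-R ξ
      -x : Ω
      -x = translation (λ i → R-neg (x∈R i))
      move : ∀ x y z → x - (y + z) ≈ 0# - (y + (- x + z))
      move = solve 3 (λ x y z → x :- (y :+ z) := con (+ 0) :- (y :+ (:- x :+ z))) refl
      to-origin : ∀ {f} → hits ξ f → Kᵈ.0# ∈ N[ n ] (-x ∙ f)
      to-origin {f} h = let (a , t , t∈R , p) = N⇒Meets {m} {f} {x} h in
        Meets⇒N {n} { -x ∙ f } {Kᵈ.0#} (λ _ → R-0) (a , t , t∈R , λ i → 𝔪^-cong (move _ _ _) (p i))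
      from-origin : ∀ {f} → Kᵈ.0# ∈ N[ n ] (-x ∙ f) → hits ξ f
      from-origin {f} h = let (a , t , t∈R , p) = N⇒Meets {m} { -x ∙ f } {Kᵈ.0#} h in
        Meets⇒N {n} {f} {x} x∈R (a , t , t∈R , λ i → 𝔪^-cong (sym (move _ _ _)) (p i))

    origin-mass : ω.mass hitsOrigin ℝ.≈ ℝ.1# ℝ.- missing m ℝ.^ S
    origin-mass = begin
      ω.mass hitsOrigin
        ≈⟨ ω.saturated-mass {hitsOrigin} (λ {f} {g} → N-saturatedΩ Kᵈ.0# {f} {g}) _ ⟩
      average (λ j → 𝟙 (Kᵈ.0# ∈ N[ n ] (representative j)))
        ≈⟨ average-cong (λ j → ℝ.reflexive (𝟙-cong (hit⇒zero j) (zero⇒hit j))) ⟩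
      average (λ j → 𝟙 (HasZero projective n (τ.function j)))
        ≈⟨ ℝSolver.solve 1 (λ x → x ℝSolver.:= ℝSolver.con (+ 1) ℝSolver.:- (ℝSolver.con (+ 1) ℝSolver.:- x)) ℝ.refl _ ⟩
      ℝ.1# ℝ.- (ℝ.1# ℝ.- average (λ j → 𝟙 (HasZero projective n (τ.function j))))
        ≈⟨ ℝ.+-congˡ (ℝ.-‿cong (average-1- τ.size (λ j → 𝟙 (HasZero projective n (τ.function j))))) ⟨
      ℝ.1# ℝ.- average (λ j → ℝ.1# ℝ.- 𝟙 (HasZero projective n (τ.function j)))
        ≈⟨ ℝ.+-congˡ (ℝ.-‿cong (average-cong {τ.size} λ j → 𝟙-¬)) ⟨
      ℝ.1# ℝ.- average (λ j → 𝟙 (¬ HasZero projective n (τ.function j)))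
        ≈⟨ ℝ.+-congˡ (ℝ.-‿cong τ.zero-free) ⟩
      ℝ.1# ℝ.- missing m ℝ.^ S ∎
      where
      open SetoidReasoning ℝ.setoid
      hit⇒zero : ∀ j → Kᵈ.0# ∈ N[ n ] (representative j) → HasZero projective n (τ.function j)
      hit⇒zero j h = let (a , z) = Meets-0⇒HasZero (N⇒Meets {m} {representative j} {Kᵈ.0#} h) in
        a , λ k → 𝔪^-resp (𝔪^-sym (sheared-representative j a (suc k))) (z k)
      zero⇒hit : ∀ j → HasZero projective n (τ.function j) → Kᵈ.0# ∈ N[ n ] (representative j)
      zero⇒hit j (a , z) = Meets⇒N {n} {representative j} {Kᵈ.0#} (λ _ → R-0)
        (HasZero⇒Meets-0 (lipschitz⇒contracts (representative j))
          (a , λ k → 𝔪^-resp (sheared-representative j a (suc k)) (z k)))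

    -- Exchanging the two averages replaces the measure of the neighbourhood for each function by
    -- the probability that a given residue class is hit, which `hit-mass` makes the same for all
    -- classes.
    expected-hits : ℝSum.sum (λ j → hitsAverage j ℝ.* ω.mass (ω.cell j)) ℝ.≈ ℝ.1# ℝ.- missing m ℝ.^ S
    expected-hits = begin
      ℝSum.sum (λ j → hitsAverage j ℝ.* ω.mass (ω.cell j))
        ≈⟨ ℝSum.sum-cong-≋ (λ j → ℝ.*-congˡ (ω.cell-mass j)) ⟩
      ℝSum.sum (λ j → hitsAverage j ℝ.* ℝ.fromℕ τ.size ℝ.⁻¹)
        ≈⟨ ℝSum.*-distribʳ-sum (ℝ.fromℕ τ.size ℝ.⁻¹) hitsAverage ⟨
      average hitsAverage
        ≈⟨ average-swap τ.size σ.size (λ j ξ → 𝟙 (hits ξ (representative j))) ⟩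
      average (λ ξ → average λ j → 𝟙 (hits ξ (representative j)))
        ≈⟨ average-cong (λ ξ → ω.saturated-mass {hits ξ} (λ {f} {g} → N-saturatedΩ (residueClass ξ) {f} {g}) _) ⟨
      average (λ ξ → ω.mass (hits ξ))
        ≈⟨ average-cong (λ ξ → ℝ.trans (hit-mass ξ) origin-mass) ⟩
      average {σ.size} (λ _ → ℝ.1# ℝ.- missing m ℝ.^ S)
        ≈⟨ average-const σ.size _ ⟩
      ℝ.1# ℝ.- missing m ℝ.^ S ∎
      where open SetoidReasoning ℝ.setoid

    expectation : 𝔼 P (X[ n ] μ) ≈∞ [ ℝ.1# ℝ.- (ℝ.1# ℝ.- u n) ^ℚ exponent ]
    expectation = ≈∞-trans
      (∫-cells distΩ (HaarMeasure.borelMeasure P) (ω.saturated-borel {U} _) (HaarMeasure.normalized P)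
        ω.cell-borel (λ {i} {j} {f} → ω.cell-disjoint {i} {j} {f}) representative-covers hitsAverage hitsAverage-pos
        (X[ n ] μ) (λ {j} {f} → X-constant {j} {f}))
      -- As `n` is `suc m`, `1 - u n` is the power `Q` of `missing m`, so raising it to `exponent`
      -- yields the power `S`.
      SupEq.[ ℝ.trans expected-hits (ℝ.+-congˡ (ℝ.-‿cong (ℝ.sym
        (power-of-root (proj₁ (missing-bounds m)) (1-u-suc m))))) ]

open import Data.Nat using (_≤_)

theorem1p18 : (em : Classical) (ℝ : RealNumbers) (K : LocalField) (d : ℕ) → 2 ≤ d →
    let open Kakeya em ℝ K d
        open RealNumbers ℝ using (1#)
        open RealNumbers ℝ using (_-_)
    in (μ : HaarMeasureKᵈ) (P : HaarProbabilityΩ) (n : ℕ) → 1 ≤ n →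
       𝔼 P (X[ n ] μ) ≈∞ [ 1# - (1# - u n) ^ℚ exponent ]
theorem1p18 em ℝ K (suc e) _ μ P (suc m) _ = ExpectedMeasure.expectation em ℝ K e μ P m
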